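{- Let $k,t$ be positive integers and let $n\geq 161t^2k^4$. If $G$ is a connected graph with $n$ vertices and at most $n\left(1+\frac{1}{204tk^3+147tk^2}\right)$ edges, then $$r(G,tF_k)=2n+t-2.$$
   Context: All graphs are finite and simple. For graphs $G$ and $H$, the Ramsey number $r(G,H)$ is the smallest positive integer $N$ such that every red-blue coloring of the edges of $K_N$ contains a red subgraph isomorphic to $G$ or a blue subgraph isomorphic to $H$. The fan $F_k$ is the graph consisting of $k$ triangles sharing one common vertex ($F_k=K_1+kK_2$), and $tF_k$ denotes the disjoint union of $t$ vertex-disjoint copies of $F_k$. -}

module Defs where

open import Data.Nat using (ℕ; zero; suc; _+_; _*_; _∸_; _≤_; _<_; _/_; _%_; _≡ᵇ_; _<ᵇ_)
open import Data.Bool using (Bool; true; false; _∧_; _∨_; if_then_else_; not)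
open import Data.Fin using (Fin; toℕ)
open import Data.List using (List; map; allFin)
open import Data.Nat.ListAction using (sum)
open import Relation.Binary.PropositionalEquality using (_≡_)
open import Function.Definitions using (Injective)
open import Data.Product using (Σ; _×_)
open import Relation.Nullary using (¬_)
open import Data.Sum using (_⊎_)
open import Data.Bool.Properties using (∨-comm; ∨-assoc)
open import Relation.Binary.PropositionalEquality using (refl; cong; cong₂; trans)

record Graph (n : ℕ) : Set where
  field
    adj   : Fin n → Fin n → Bool
    sym   : ∀ u v → adj u v ≡ adj v u
    irrefl : ∀ u → adj u u ≡ false
open Graph public

edgeCount : ∀ {n} → Graph n → ℕ
edgeCount {n} G =
  sum (map (λ u → sum (map (λ v → if (toℕ u <ᵇ toℕ v) ∧ adj G u v then 1 else 0)
                            (allFin n)))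
           (allFin n))

data Reachable {n} (G : Graph n) : Fin n → Fin n → Set where
  here : ∀ {u} → Reachable G u u
  step : ∀ {u v w} → adj G u v ≡ true → Reachable G v w → Reachable G u w

Connected : ∀ {n} → Graph n → Set
Connected {n} G = ∀ (u v : Fin n) → Reachable G u v

-- Fan F_k = K_1 + k K_2 on 2k+1 vertices, indexed 0..2k:
-- 0 is the centre, and the i-th triangle uses vertices 2i+1, 2i+2 (i < k).
fanAdjℕ : ℕ → ℕ → Bool
fanAdjℕ a b =
  not (a ≡ᵇ b) ∧ ((a ≡ᵇ 0) ∨ (b ≡ᵇ 0) ∨ (((a ∸ 1) / 2) ≡ᵇ ((b ∸ 1) / 2)))

-- t F_k : t vertex-disjoint copies of F_k on t(2k+1) vertices;
-- vertex x lies in copy x / (2k+1) at position x % (2k+1).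
tFanAdjℕ : ℕ → ℕ → ℕ → Bool
tFanAdjℕ k a b =
  ((a / suc (2 * k)) ≡ᵇ (b / suc (2 * k))) ∧ fanAdjℕ (a % suc (2 * k)) (b % suc (2 * k))

≡ᵇ-sym : ∀ a b → (a ≡ᵇ b) ≡ (b ≡ᵇ a)
≡ᵇ-sym zero zero = refl
≡ᵇ-sym zero (suc b) = refl
≡ᵇ-sym (suc a) zero = refl
≡ᵇ-sym (suc a) (suc b) = ≡ᵇ-sym a b

≡ᵇ-refl : ∀ a → (a ≡ᵇ a) ≡ true
≡ᵇ-refl zero = refl
≡ᵇ-refl (suc a) = ≡ᵇ-refl a

fanAdjℕ-sym : ∀ a b → fanAdjℕ a b ≡ fanAdjℕ b a
fanAdjℕ-sym a b =
  cong₂ _∧_ (cong not (≡ᵇ-sym a b))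
    (trans (cong₂ _∨_ (refl {x = a ≡ᵇ 0}) (cong ((b ≡ᵇ 0) ∨_) (≡ᵇ-sym ((a ∸ 1) / 2) ((b ∸ 1) / 2))))
    (trans (sym' (∨-assoc (a ≡ᵇ 0) (b ≡ᵇ 0) _))
    (trans (cong (_∨ (((b ∸ 1) / 2) ≡ᵇ ((a ∸ 1) / 2))) (∨-comm (a ≡ᵇ 0) (b ≡ᵇ 0)))
           (∨-assoc (b ≡ᵇ 0) (a ≡ᵇ 0) _))))
  where open import Relation.Binary.PropositionalEquality using () renaming (sym to sym')

tFanAdjℕ-sym : ∀ k a b → tFanAdjℕ k a b ≡ tFanAdjℕ k b a
tFanAdjℕ-sym k a b = cong₂ _∧_ (≡ᵇ-sym (a / suc (2 * k)) (b / suc (2 * k)))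
  (fanAdjℕ-sym (a % suc (2 * k)) (b % suc (2 * k)))

tFanAdjℕ-irrefl : ∀ k a → tFanAdjℕ k a a ≡ false
tFanAdjℕ-irrefl k a rewrite ≡ᵇ-refl (a / suc (2 * k)) | ≡ᵇ-refl (a % suc (2 * k)) = refl

tFan : (t k : ℕ) → Graph (t * suc (2 * k))
tFan t k = record
  { adj = λ u v → tFanAdjℕ k (toℕ u) (toℕ v)
  ; sym = λ u v → tFanAdjℕ-sym k (toℕ u) (toℕ v)
  ; irrefl = λ u → tFanAdjℕ-irrefl k (toℕ u)
  }

-- A red/blue colouring of the edges of K_N: true = red, false = blue,
-- symmetric (the value on the diagonal is irrelevant).
Colouring : ℕ → Set
Colouring N = Fin N → Fin N → Bool

SymmetricColouring : ∀ {N} → Colouring N → Set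
SymmetricColouring c = ∀ x y → c x y ≡ c y x

ContainsCopy : ∀ {N m} → Colouring N → Bool → Graph m → Set
ContainsCopy {N} {m} c b H =
  Σ (Fin m → Fin N) λ f → Injective _≡_ _≡_ f ×
    (∀ u v → adj H u v ≡ true → c (f u) (f v) ≡ b)

Arrows : ℕ → ∀ {m p} → Graph m → Graph p → Set
Arrows N G H = (c : Colouring N) → SymmetricColouring c →
  ContainsCopy c true G ⊎ ContainsCopy c false H

RamseyNumberIs : ∀ {m p} → Graph m → Graph p → ℕ → Set
RamseyNumberIs G H N = (1 ≤ N) × Arrows N G H × (∀ M → 1 ≤ M → M < N → ¬ Arrows M G H)

{-# OPTIONS --safe #-}

-- Lower bound: split 2n + t - 3 vertices into classes of sizes n - 1, n - 1, t - 1 and colour an edge red iff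
-- it lies inside a class. A red connected graph stays inside a class, and every blue triangle meets the last one.
--
-- Upper bound: suppose there is no red G and no blue tF_k. Deleting a maximal family of disjoint blue fans leaves
-- a set W of at least 2n - 1 - 2k(t-1) vertices without blue F_k; hence any blue neighbourhood in W is a red
-- clique up to 2(k-1) vertices.
-- (1) G is reduced by deleting leaves and contracting vertices of long suspended paths. What remains has at most
--     about 24k²(e - n) vertices and embeds in red W: vertices of high degree go into a red clique inside the largest
--     blue neighbourhood, the others are placed greedily. Undoing the reductions fails only if the unused part
--     of W is a red clique up to 2(k-1) vertices: for a leaf, all unused vertices are blue to its parent; for a
--     path, rotations show that unused vertices have at most 2k red neighbours on it, so that k disjoint blue
--     edges outside have a common blue neighbour on it. Thus W contains a red clique Q with |Q| ≥ n - 2kt + 2.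
-- (2) Put c = n - |Q|. Being sparse, G has a vertex with c leaves, or c vertices of degree at most 2 pairwise
--     at distance at least 3. Placing these outside Q and the rest of G in Q fails only if almost all edges between
--     Q and W ∖ Q are blue, which makes W ∖ Q a red clique Q₂ up to few vertices.
-- (3) A vertex with many blue neighbours in both Q and Q₂ is the centre of a blue fan, so there are at most t - 1
--     of these. Among the other 2n - 1 vertices, n are red to almost all of one of the two cliques, say Q; those
--     outside Q receive independent vertices of G of degree at most 3, whose neighbours go to vertices of Q that
--     are red to all of them.
module Submission where

open import Defs
open import Data.Nat using (ℕ; zero; suc; _+_; _*_; _∸_; _^_; _/_; _%_; _≤_; _<_; _≤?_; _≡ᵇ_; _<ᵇ_; z≤n; s≤s)
open import Data.Nat.Properties hiding (_≟_; _≤?_)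
open import Data.Nat.DivMod using (m/n≡1+[m∸n]/n; m≡m%n+[m/n]*n; m%n<n; [m+kn]%n≡m%n; +-distrib-/-∣ʳ; m*n/n≡m; m<n⇒m/n≡0; m<n⇒m%n≡m)
open import Data.Nat.Divisibility using (divides-refl)
open import Data.Nat.ListAction using (sum)
open import Data.Nat.Tactic.RingSolver using (solve-∀)
open import Data.Bool using (Bool; true; false; T; if_then_else_; not; _∧_; _∨_)
import Data.Bool.Properties as Boolₚ
open import Data.Fin using (Fin; zero; suc; toℕ; fromℕ<; combine; _≟_)
open import Data.Fin.Properties using (any?; all?; toℕ<n; toℕ-injective; toℕ-fromℕ<; toℕ-combine; combine-injectiveˡ; injective⇒≤)
open import Data.List using (List; []; _∷_; _++_; _ʳ++_; map; length; filter; allFin; concatMap; upTo; take)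
open import Data.List.Properties using (length-map; length-++; length-tabulate; length-take; length-upTo; map-++; ∷-injective)
open import Data.List.Membership.Propositional using (_∈_; _∉_; find)
open import Data.List.Membership.Propositional.Properties
open import Data.List.Relation.Unary.Any using (here; there)
open import Data.List.Relation.Unary.All as All using (All; []; _∷_)
open import Data.List.Relation.Unary.AllPairs using (AllPairs; []; _∷_) renaming (map to AllPairs-map)
open import Data.List.Relation.Unary.Linked using (Linked; []; [-]; _∷_; tail)
open import Data.List.Relation.Unary.Unique.Propositional using (Unique)
import Data.List.Relation.Unary.Unique.Propositional.Properties as Uniqueₚ
open import Data.List.Relation.Binary.Permutation.Propositional using (_↭_; prep; swap; ↭-refl; ↭-trans; ↭-sym; ↭⇒↭ₛ)
open import Data.List.Relation.Binary.Permutation.Propositional.Properties using (∈-resp-↭; ↭-length; ++↭ʳ++)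
import Data.List.Relation.Binary.Permutation.Setoid.Properties as Setoidₚ
open import Data.Product using (Σ; ∃; _×_; _,_; proj₁; proj₂)
open import Data.Sum using (_⊎_; inj₁; inj₂; [_,_]′)
open import Data.Empty using (⊥; ⊥-elim)
open import Relation.Nullary using (¬_; Dec; yes; no; does)
open import Relation.Nullary.Decidable using (dec-true; dec-false; ¬?; map′; _→-dec_; _×-dec_)
open import Relation.Binary.Definitions using (tri<; tri≈; tri>)
open import Relation.Binary.PropositionalEquality using (_≡_; _≢_; refl; trans; cong; cong₂; subst; setoid) renaming (sym to ≡-sym)
open import Function using (_∘_; id)

-- Sums over lists and finite sets

-- The obstacle is that nothing may be lost at the end. The lower-bound classes have (n - 1) + (n -
-- 1) + (t - 1) vertices, exactly one less than 2n + t - 2, while removing fans and every appeal to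
-- fan-freeness cost an additive multiple of k or kt. Hence the two big red classes are first
-- recovered only approximately, as cliques of size at least n - 2kt, and the exact count is made
-- once, when all vertices are sorted by the clique to which they are nearly red. The parameter ℓ is
-- e - n, cut off at 0; no reduction step increases the difference between edges and live vertices.
-- With minimum degree 2 the excess of degrees over 2 sums to at most 2ℓ, so at most 6ℓ + 2
-- half-edges leave the branch vertices. Each is followed for at most 4k² + 2 vertices, where 4k²
-- comes from the 2k ends of k blue edges with at most 2k red neighbours each; this is the origin of
-- 24k²ℓ. Greedy placement against blue degree 4k multiplies by 4k, so ℓk³ must be small compared
-- with n. The final steps need room for about c² + kc + ktc vertices with c at most 2kt, which t²k⁴
-- dominates.

private variable
  A : Set

-- All linear arithmetic below is done by exhibiting a certificate: a combination a ≤ b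
-- of the hypotheses and a slack s for which l + b + s ≡ r + a is a semiring identity.
linear : ∀ {a b l r} s → a ≤ b → l + b + s ≡ r + a → l ≤ r
linear {a} {b} {l} {r} s a≤b eq = +-cancelʳ-≤ b l r
  (≤-trans (m≤m+n (l + b) s) (≤-trans (≤-reflexive eq) (+-monoʳ-≤ r a≤b)))

true≢false : ∀ {b} → b ≡ true → b ≢ false
true≢false refl ()

¬true⇒false : ∀ {b} → b ≢ true → b ≡ false
¬true⇒false {true} h = ⊥-elim (h refl)
¬true⇒false {false} _ = refl

<ᵇ-true : ∀ {a b} → a < b → (a <ᵇ b) ≡ true
<ᵇ-true {a} {b} lt with a <ᵇ b in eq | <⇒<ᵇ lt
... | true | _ = refl

<ᵇ-true⁻ : ∀ {a b} → (a <ᵇ b) ≡ true → a < b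
<ᵇ-true⁻ {a} {b} e = <ᵇ⇒< a b (subst T (≡-sym e) _)

sumOver : (A → ℕ) → List A → ℕ
sumOver f xs = sum (map f xs)

cnt : (A → Bool) → List A → ℕ
cnt p = sumOver (λ x → if p x then 1 else 0)

sel : (A → Bool) → List A → List A
sel p = filter (λ x → p x Boolₚ.≟ true)

sumOver-mono : ∀ {f g : A → ℕ} xs → (∀ {x} → x ∈ xs → f x ≤ g x) → sumOver f xs ≤ sumOver g xs
sumOver-mono [] h = z≤n
sumOver-mono (x ∷ xs) h = +-mono-≤ (h (here refl)) (sumOver-mono xs (h ∘ there))

sumOver-cong : ∀ {f g : A → ℕ} xs → (∀ x → f x ≡ g x) → sumOver f xs ≡ sumOver g xs
sumOver-cong [] h = refl
sumOver-cong (x ∷ xs) h = cong₂ _+_ (h x) (sumOver-cong xs h)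

sumOver-+ : ∀ (f g : A → ℕ) xs → sumOver (λ x → f x + g x) xs ≡ sumOver f xs + sumOver g xs
sumOver-+ f g [] = refl
sumOver-+ f g (x ∷ xs) rewrite sumOver-+ f g xs = lemma (f x) (g x) (sumOver f xs) (sumOver g xs)
  where
  lemma : ∀ a b c d → a + b + (c + d) ≡ a + c + (b + d)
  lemma = solve-∀

sumOver-const : ∀ m (xs : List A) → sumOver (λ _ → m) xs ≡ length xs * m
sumOver-const m [] = refl
sumOver-const m (x ∷ xs) = cong (m +_) (sumOver-const m xs)

sumOver-* : ∀ m (f : A → ℕ) xs → sumOver (λ x → m * f x) xs ≡ m * sumOver f xs
sumOver-* m f [] = ≡-sym (*-zeroʳ m)
sumOver-* m f (x ∷ xs) rewrite sumOver-* m f xs = ≡-sym (*-distribˡ-+ m (f x) (sumOver f xs))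

sumOver-swap : ∀ {B : Set} (f : A → B → ℕ) xs ys →
  sumOver (λ x → sumOver (f x) ys) xs ≡ sumOver (λ y → sumOver (λ x → f x y) xs) ys
sumOver-swap f [] ys = ≡-sym (trans (sumOver-const 0 ys) (*-zeroʳ (length ys)))
sumOver-swap f (x ∷ xs) ys rewrite sumOver-swap f xs ys =
  ≡-sym (sumOver-+ (f x) (λ y → sumOver (λ x → f x y) xs) ys)

sumOver-bound : ∀ (f : A → ℕ) m xs → (∀ {x} → x ∈ xs → f x ≤ m) → sumOver f xs ≤ length xs * m
sumOver-bound f m xs h = ≤-trans (sumOver-mono xs h) (≤-reflexive (sumOver-const m xs))

term≤sumOver : ∀ (f : A → ℕ) {x xs} → x ∈ xs → f x ≤ sumOver f xs
term≤sumOver f (here refl) = m≤m+n _ _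
term≤sumOver f (there i) = ≤-trans (term≤sumOver f i) (m≤n+m _ _)

length-sel : ∀ (p : A → Bool) xs → length (sel p xs) ≡ cnt p xs
length-sel p [] = refl
length-sel p (x ∷ xs) with p x
... | true = cong suc (length-sel p xs)
... | false = length-sel p xs

cnt-mono : ∀ {p q : A → Bool} xs → (∀ {x} → x ∈ xs → p x ≡ true → q x ≡ true) → cnt p xs ≤ cnt q xs
cnt-mono {p = p} {q} xs h = sumOver-mono xs λ {x} i → lemma (p x) (q x) (h i)
  where
  lemma : ∀ a b → (a ≡ true → b ≡ true) → (if a then 1 else 0) ≤ (if b then 1 else 0)
  lemma true b h rewrite h refl = ≤-refl
  lemma false b h = z≤n

cnt-∨ : ∀ (p q : A → Bool) xs → cnt (λ x → p x ∨ q x) xs ≤ cnt p xs + cnt q xs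
cnt-∨ p q xs = ≤-trans (sumOver-mono xs λ {x} _ → lemma (p x) (q x)) (≤-reflexive (sumOver-+ _ _ xs))
  where
  lemma : ∀ a b → (if a ∨ b then 1 else 0) ≤ (if a then 1 else 0) + (if b then 1 else 0)
  lemma true b = s≤s z≤n
  lemma false b = ≤-refl

cnt-not : ∀ (p : A → Bool) xs → cnt p xs + cnt (not ∘ p) xs ≡ length xs
cnt-not p [] = refl
cnt-not p (x ∷ xs) with p x
... | true = cong suc (cnt-not p xs)
... | false = trans (+-suc _ _) (cong suc (cnt-not p xs))

sel⁺ : ∀ {p : A → Bool} {x xs} → x ∈ xs → p x ≡ true → x ∈ sel p xs
sel⁺ = ∈-filter⁺ _

sel⁻ : ∀ {p : A → Bool} {x xs} → x ∈ sel p xs → x ∈ xs × p x ≡ true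
sel⁻ {xs = xs} = ∈-filter⁻ _ {xs = xs}

sel-Unique : ∀ (p : A → Bool) {xs} → Unique xs → Unique (sel p xs)
sel-Unique p = Uniqueₚ.filter⁺ _

Unique-∷ : ∀ {x : A} {xs} → x ∉ xs → Unique xs → Unique (x ∷ xs)
Unique-∷ x∉ u = All.tabulate (λ { i refl → x∉ i }) ∷ u

Unique-tail : ∀ {x : A} {xs} → Unique (x ∷ xs) → Unique xs
Unique-tail (_ ∷ u) = u

Unique-head : ∀ {x : A} {xs} → Unique (x ∷ xs) → x ∉ xs
Unique-head = Uniqueₚ.Unique[x∷xs]⇒x∉xs

⊆-length : ∀ {xs ys : List A} → Unique xs → (∀ {x} → x ∈ xs → x ∈ ys) → length xs ≤ length ys
⊆-length {xs = []} u h = z≤n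
⊆-length {xs = x ∷ xs} (x∉ ∷ u) h with as , bs , refl ← ∈-∃++ (h (here refl)) =
  ≤-trans (s≤s (⊆-length u h′)) (≤-reflexive eq)
  where
  h′ : ∀ {y} → y ∈ xs → y ∈ as ++ bs
  h′ i with ∈-++⁻ as (h (there i))
  ... | inj₁ j = ∈-++⁺ˡ j
  ... | inj₂ (here refl) = ⊥-elim (All.lookup x∉ i refl)
  ... | inj₂ (there j) = ∈-++⁺ʳ as j
  eq : suc (length (as ++ bs)) ≡ length (as ++ x ∷ bs)
  eq rewrite length-++ as {bs} | length-++ as {x ∷ bs} = ≡-sym (+-suc _ _)

cnt≤ : ∀ {p : A → Bool} {xs ys} → Unique xs → (∀ {x} → x ∈ xs → p x ≡ true → x ∈ ys) → cnt p xs ≤ length ys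
cnt≤ {p = p} {xs} u h = subst (_≤ _) (length-sel p xs)
  (⊆-length (sel-Unique p u) λ i → let j , e = sel⁻ {p = p} {xs = xs} i in h j e)

module Finite {n : ℕ} where
  open import Data.List.Membership.DecPropositional (_≟_ {n}) public using (_∈?_)

  mem : List (Fin n) → Fin n → Bool
  mem xs x = does (x ∈? xs)

  mem⁺ : ∀ {xs x} → x ∈ xs → mem xs x ≡ true
  mem⁺ {xs} {x} = dec-true (x ∈? xs)

  mem⁻ : ∀ {xs x} → mem xs x ≡ true → x ∈ xs
  mem⁻ {xs} {x} e with x ∈? xs
  ... | yes i = i
  ... | no _ with () ← e

  infix 4 _==_
  _==_ : Fin n → Fin n → Bool
  x == y = does (x ≟ y)

  ==-refl : ∀ x → (x == x) ≡ true
  ==-refl x = dec-true (x ≟ x) refl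

  ==⇒≡ : ∀ {x y} → (x == y) ≡ true → x ≡ y
  ==⇒≡ {x} {y} e with x ≟ y
  ... | yes p = p
  ... | no _ with () ← e

  ≢⇒== : ∀ {x y} → x ≢ y → (x == y) ≡ false
  ≢⇒== {x} {y} = dec-false (x ≟ y)

  infixl 5 _∖_
  _∖_ : List (Fin n) → List (Fin n) → List (Fin n)
  xs ∖ ys = filter (λ x → ¬? (x ∈? ys)) xs

  ∖⁺ : ∀ {xs ys x} → x ∈ xs → x ∉ ys → x ∈ xs ∖ ys
  ∖⁺ = ∈-filter⁺ _

  ∖⁻ : ∀ xs {ys x} → x ∈ xs ∖ ys → x ∈ xs × x ∉ ys
  ∖⁻ xs = ∈-filter⁻ _ {xs = xs}

  ∖-Unique : ∀ {xs} ys → Unique xs → Unique (xs ∖ ys)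
  ∖-Unique ys = Uniqueₚ.filter⁺ _

  ∖-length : ∀ {xs} ys → Unique xs → length xs ≤ length (xs ∖ ys) + length ys
  ∖-length {xs} ys u = ≤-trans (⊆-length u h) (≤-reflexive (length-++ (xs ∖ ys)))
    where
    h : ∀ {x} → x ∈ xs → x ∈ (xs ∖ ys) ++ ys
    h {x} i with x ∈? ys
    ... | yes j = ∈-++⁺ʳ (xs ∖ ys) j
    ... | no j = ∈-++⁺ˡ (∖⁺ i j)

  ∖-length′ : ∀ {xs ys} → Unique xs → Unique ys → (∀ {x} → x ∈ ys → x ∈ xs) →
    length (xs ∖ ys) + length ys ≤ length xs
  ∖-length′ {xs} {ys} ux uy sub = subst (_≤ _) (length-++ (xs ∖ ys))
    (⊆-length (Uniqueₚ.++⁺ (∖-Unique ys ux) uy λ (i , j) → proj₂ (∖⁻ xs i) j) h)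
    where
    h : ∀ {x} → x ∈ (xs ∖ ys) ++ ys → x ∈ xs
    h i with ∈-++⁻ (xs ∖ ys) i
    ... | inj₁ j = proj₁ (∖⁻ xs j)
    ... | inj₂ j = sub j

  pick : ∀ {xs} us → Unique xs → length us < length xs → ∃ λ x → x ∈ xs × x ∉ us
  pick {xs} us u lt with xs ∖ us in eq
  ... | [] = ⊥-elim (<-irrefl refl (≤-trans lt
               (subst (λ zs → length xs ≤ length zs + length us) eq (∖-length us u))))
  ... | x ∷ _ = x , ∖⁻ xs (subst (x ∈_) (≡-sym eq) (here refl))

  pick-cnt : ∀ {p : Fin n → Bool} {xs} us → Unique xs → length us < cnt p xs →
    ∃ λ x → x ∈ xs × p x ≡ true × x ∉ us
  pick-cnt {p} {xs} us u lt
    with x , i , x∉ ← pick us (sel-Unique p u) (subst (length us <_) (≡-sym (length-sel p xs)) lt)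
    = x , proj₁ (sel⁻ {p = p} i) , proj₂ (sel⁻ {p = p} {xs = xs} i) , x∉

  length-allFin : length (allFin n) ≡ n
  length-allFin = length-tabulate {n = n} id

  ∈-all : ∀ (v : Fin n) → v ∈ allFin n
  ∈-all = ∈-allFin

  Unique-all : Unique (allFin n)
  Unique-all = Uniqueₚ.allFin⁺ n

  cnt-single : ∀ x {xs} → x ∈ xs → Unique xs → cnt (x ==_) xs ≡ 1
  cnt-single x {xs} i u = ≤-antisym
    (cnt≤ {ys = x ∷ []} u λ _ e → here (≡-sym (==⇒≡ e)))
    (≤-trans (≤-reflexive (cong (λ b → if b then 1 else 0) (≡-sym (==-refl x)))) (term≤sumOver _ i))

  -- The form of most case distinctions below: `Q` carries a success found at some entry (an
  -- embedding, a clique, a longer path), and otherwise its failure at every entry becomes a usable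
  -- property.
  ∃⊎∀ : ∀ {P : Fin n → Set} {Q : Set} xs → (∀ x → x ∈ xs → P x ⊎ Q) → (∀ x → x ∈ xs → P x) ⊎ Q
  ∃⊎∀ [] h = inj₁ λ _ ()
  ∃⊎∀ (x ∷ xs) h with h x (here refl) | ∃⊎∀ xs (λ y → h y ∘ there)
  ... | inj₂ q | _ = inj₂ q
  ... | inj₁ _ | inj₂ q = inj₂ q
  ... | inj₁ p | inj₁ ps = inj₁ λ { _ (here refl) → p ; y (there i) → ps y i }

  upd : ∀ {B : Set} → (Fin n → B) → Fin n → B → Fin n → B
  upd f v y u = if u == v then y else f u

  upd-same : ∀ {B : Set} (f : Fin n → B) v y → upd f v y v ≡ y
  upd-same f v y rewrite ==-refl v = refl

  upd-other : ∀ {B : Set} (f : Fin n → B) {v u} y → u ≢ v → upd f v y u ≡ f u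
  upd-other f y ne rewrite ≢⇒== ne = refl

open Finite public

-- Embeddings into a two-coloured complete graph

length-concatMap : ∀ {A B : Set} (g : A → List B) xs → length (concatMap g xs) ≡ sumOver (length ∘ g) xs
length-concatMap g [] = refl
length-concatMap g (x ∷ xs) = trans (length-++ (g x)) (cong (length (g x) +_) (length-concatMap g xs))

∈-concatMap : ∀ {A B : Set} (g : A → List B) {x y xs} → x ∈ xs → y ∈ g x → y ∈ concatMap g xs
∈-concatMap g (here refl) j = ∈-++⁺ˡ j
∈-concatMap g (there {x} i) j = ∈-++⁺ʳ (g x) (∈-concatMap g i j)

deg : ∀ {n} → Graph n → Fin n → ℕ
deg {n} G v = cnt (adj G v) (allFin n)

nbrs : ∀ {n} → Graph n → Fin n → List (Fin n)
nbrs {n} G v = sel (adj G v) (allFin n)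

module _ {n} (G : Graph n) where

  adj-sym : ∀ {u v} → adj G u v ≡ true → adj G v u ≡ true
  adj-sym {u} {v} = trans (sym G v u)

  adj-≢ : ∀ {u v} → adj G u v ≡ true → u ≢ v
  adj-≢ {u} e refl = true≢false e (irrefl G u)

  nbrs⁺ : ∀ {u v} → adj G u v ≡ true → v ∈ nbrs G u
  nbrs⁺ {u} {v} = sel⁺ {p = adj G u} (∈-all v)

  nbrs⁻ : ∀ {u v} → v ∈ nbrs G u → adj G u v ≡ true
  nbrs⁻ {u} i = proj₂ (sel⁻ {p = adj G u} {xs = allFin n} i)

  length-nbrs : ∀ v → length (nbrs G v) ≡ deg G v
  length-nbrs v = length-sel (adj G v) (allFin n)

  Unique-nbrs : ∀ v → Unique (nbrs G v)
  Unique-nbrs v = sel-Unique (adj G v) Unique-all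

  cnt-adj≤deg : ∀ v {xs} → Unique xs → cnt (adj G v) xs ≤ deg G v
  cnt-adj≤deg v u = ≤-trans (cnt≤ {ys = nbrs G v} u λ _ → nbrs⁺) (≤-reflexive (length-nbrs v))

pairVertices : ∀ {A : Set} → List (A × A) → List A
pairVertices [] = []
pairVertices ((a , b) ∷ es) = a ∷ b ∷ pairVertices es

length-pairVertices : ∀ {A : Set} (es : List (A × A)) → length (pairVertices es) ≡ 2 * length es
length-pairVertices [] = refl
length-pairVertices (e ∷ es) rewrite length-pairVertices es = lemma (length es)
  where
  lemma : ∀ m → suc (suc (2 * m)) ≡ 2 * suc m
  lemma = solve-∀

module Host {N : ℕ} (c : Colouring N) (c-sym : SymmetricColouring c) where

  RedClique : List (Fin N) → Set
  RedClique Q = ∀ {x y} → x ∈ Q → y ∈ Q → x ≢ y → c x y ≡ true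

  -- A partial embedding defined on `ps`. The map is total with arbitrary values elsewhere, so that
  -- placing one more vertex is a single `upd`.
  record Emb {n} (G : Graph n) (ps : List (Fin n)) (f : Fin n → Fin N) : Set where
    field
      inj : ∀ {u v} → u ∈ ps → v ∈ ps → f u ≡ f v → u ≡ v
      hom : ∀ {u v} → u ∈ ps → v ∈ ps → adj G u v ≡ true → c (f u) (f v) ≡ true
  open Emb public

  Emb-[] : ∀ {n} {G : Graph n} f → Emb G [] f
  Emb-[] f = record { inj = λ () ; hom = λ () }

  Emb-⊆ : ∀ {n} {G : Graph n} {ps qs f} → (∀ {v} → v ∈ qs → v ∈ ps) → Emb G ps f → Emb G qs f
  Emb-⊆ h E = record { inj = λ i j → inj E (h i) (h j) ; hom = λ i j → hom E (h i) (h j) }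

  copy : ∀ {n} {G : Graph n} {ps f} → Emb G ps f → (∀ v → v ∈ ps) → ContainsCopy c true G
  copy {f = f} E h = f , (λ {u} {v} → inj E (h u) (h v)) , λ u v → hom E (h u) (h v)

  upd-on : ∀ {n} {ps : List (Fin n)} (f : Fin n → Fin N) {v u} y → v ∉ ps → u ∈ ps → upd f v y u ≡ f u
  upd-on f y v∉ i = upd-other f y λ { refl → v∉ i }

  extend : ∀ {n} {G : Graph n} {ps f v y} → Emb G ps f → v ∉ ps → (∀ {u} → u ∈ ps → f u ≢ y) →
    (∀ {u} → u ∈ ps → adj G u v ≡ true → c (f u) y ≡ true) → Emb G (v ∷ ps) (upd f v y)
  extend {G = G} {ps} {f} {v} {y} E v∉ fresh red = record { inj = inj′ ; hom = hom′ }
    where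
    on : ∀ {u} → u ∈ ps → upd f v y u ≡ f u
    on = upd-on f y v∉
    inj′ : ∀ {u w} → u ∈ v ∷ ps → w ∈ v ∷ ps → upd f v y u ≡ upd f v y w → u ≡ w
    inj′ (here refl) (here refl) e = refl
    inj′ (here refl) (there j) e rewrite upd-same f v y | on j = ⊥-elim (fresh j (≡-sym e))
    inj′ (there i) (here refl) e rewrite upd-same f v y | on i = ⊥-elim (fresh i e)
    inj′ (there i) (there j) e rewrite on i | on j = inj E i j e
    hom′ : ∀ {u w} → u ∈ v ∷ ps → w ∈ v ∷ ps → adj G u w ≡ true → c (upd f v y u) (upd f v y w) ≡ true
    hom′ (here refl) (here refl) e = ⊥-elim (adj-≢ G e refl)
    hom′ {w = w} (here refl) (there j) e rewrite upd-same f v y | on j =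
      trans (c-sym y (f w)) (red j (adj-sym G e))
    hom′ (there i) (here refl) e rewrite upd-same f v y | on i = red i e
    hom′ (there i) (there j) e rewrite on i | on j = hom E i j e

  -- An unplaced vertex has all its placed neighbours in the clique Q, so it can go anywhere in Q.
  complete-list : ∀ {n} {G : Graph n} {Q ps f} → RedClique Q → Unique Q → Emb G ps f →
    (∀ {u} → u ∈ ps → f u ∈ Q ⊎ (∀ {v} → adj G u v ≡ true → v ∈ ps)) →
    ∀ used → (∀ {u} → u ∈ ps → f u ∈ Q → f u ∈ used) →
    ∀ rs → Unique rs → (∀ {v} → v ∈ rs → v ∉ ps) → (∀ v → v ∈ ps ⊎ v ∈ rs) →
    length used + length rs ≤ length Q → ContainsCopy c true G
  complete-list rcl uQ E closed used uh [] ur dis cov len = copy E λ v → case-ps (cov v)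
    where
    case-ps : ∀ {A : Set} {v : A} {ps} → v ∈ ps ⊎ v ∈ [] → v ∈ ps
    case-ps (inj₁ i) = i
  complete-list {G = G} {Q} {ps} {f} rcl uQ E closed used uh (v ∷ rs) ur dis cov len
    with y , y∈Q , y∉ ← pick used uQ (≤-trans (≤-reflexive (+-comm 1 _)) (≤-trans (+-monoʳ-≤ (length used) (s≤s z≤n)) len))
    = complete-list rcl uQ (extend E v∉ fresh red) closed′ (y ∷ used) uh′ rs (Unique-tail ur) dis′ cov′
        (≤-trans (≤-reflexive (≡-sym (+-suc _ _))) len)
    where
    v∉ = dis (here refl)
    f′ = upd f v y
    fresh : ∀ {u} → u ∈ ps → f u ≢ y
    fresh i refl = y∉ (uh i y∈Q)
    red : ∀ {u} → u ∈ ps → adj G u v ≡ true → c (f u) y ≡ true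
    red i e with closed i
    ... | inj₁ j = rcl j y∈Q (fresh i)
    ... | inj₂ h = ⊥-elim (v∉ (h e))
    closed′ : ∀ {u} → u ∈ v ∷ ps → f′ u ∈ Q ⊎ (∀ {w} → adj G u w ≡ true → w ∈ v ∷ ps)
    closed′ (here refl) rewrite upd-same f v y = inj₁ y∈Q
    closed′ (there i) rewrite upd-on f y v∉ i with closed i
    ... | inj₁ j = inj₁ j
    ... | inj₂ h = inj₂ (there ∘ h)
    uh′ : ∀ {u} → u ∈ v ∷ ps → f′ u ∈ Q → f′ u ∈ y ∷ used
    uh′ (here refl) _ rewrite upd-same f v y = here refl
    uh′ (there i) j rewrite upd-on f y v∉ i = there (uh i j)
    dis′ : ∀ {w} → w ∈ rs → w ∉ v ∷ ps
    dis′ i (here refl) = Unique-head ur i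
    dis′ i (there j) = dis (there i) j
    cov′ : ∀ w → w ∈ v ∷ ps ⊎ w ∈ rs
    cov′ w with cov w
    ... | inj₁ i = inj₁ (there i)
    ... | inj₂ (here refl) = inj₁ (here refl)
    ... | inj₂ (there i) = inj₂ i

  -- At most `length used` places of `Q` are taken and n - |ps| vertices of `G` still wait. A vertex
  -- placed outside `Q` increases `ps` but not `used`; this is how a clique smaller than n suffices.
  complete : ∀ {n} {G : Graph n} {Q ps f} → RedClique Q → Unique Q → Unique ps → Emb G ps f →
    (∀ {u} → u ∈ ps → f u ∈ Q ⊎ (∀ {v} → adj G u v ≡ true → v ∈ ps)) →
    ∀ used → (∀ {u} → u ∈ ps → f u ∈ Q → f u ∈ used) →
    length used + n ≤ length Q + length ps → ContainsCopy c true G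
  complete {n} {Q = Q} {ps} rcl uQ ups E closed used uh len =
    complete-list rcl uQ E closed used uh (allFin n ∖ ps) (∖-Unique ps Unique-all)
      (proj₂ ∘ ∖⁻ (allFin n)) cov
      (linear 0 (+-mono-≤ len (≤-trans (∖-length′ Unique-all ups λ {x} _ → ∈-all x) (≤-reflexive length-allFin)))
        (lemma (length used) (length (allFin n ∖ ps)) n (length Q) (length ps)))
    where
    cov : ∀ v → v ∈ ps ⊎ v ∈ allFin n ∖ ps
    cov v with v ∈? ps
    ... | yes i = inj₁ i
    ... | no i = inj₂ (∖⁺ (∈-all v) i)
    lemma : ∀ u r n q p → u + r + (q + p + n) + 0 ≡ q + (u + n + (r + p))
    lemma = solve-∀

  clique-copy : ∀ {n} {G : Graph n} {Q} → Fin N → RedClique Q → Unique Q → n ≤ length Q → ContainsCopy c true G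
  clique-copy {G = G} {Q} y rcl uQ len = complete {G = G} {Q} rcl uQ [] (Emb-[] {G = G} (λ _ → y)) (λ ()) [] (λ ())
    (≤-trans len (≤-reflexive (≡-sym (+-identityʳ _))))

  -- The colour on the diagonal is arbitrary, so equality is excluded explicitly.
  blue : Fin N → Fin N → Bool
  blue x y = not (c x y) ∧ not (x == y)

  blue⁻ : ∀ {x y} → blue x y ≡ true → c x y ≡ false × x ≢ y
  blue⁻ {x} {y} e with c x y | x ≟ y
  ... | false | no ne = refl , ne
  ... | false | yes _ with () ← e
  ... | true | _ with () ← e

  ¬blue⇒red : ∀ {x y} → blue x y ≢ true → x ≢ y → c x y ≡ true
  ¬blue⇒red {x} {y} h ne with c x y
  ... | true = refl
  ... | false = ⊥-elim (h (cong not (≢⇒== ne)))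

  -- The image of `v` has to avoid the images already used and, for each placed neighbour, the at
  -- most `d` blue neighbours of its image. The sum |ps| + |rs| stays constant along the recursion,
  -- so one budget per vertex is enough.
  greedy : ∀ {n} {G : Graph n} {W d} → Unique W → (∀ {y} → y ∈ W → cnt (blue y) W ≤ d) →
    ∀ rs {ps f} → Emb G ps f → Unique ps → (∀ {v} → v ∈ ps → f v ∈ W) → Unique rs → (∀ {v} → v ∈ rs → v ∉ ps) →
    (∀ {v} → v ∈ rs → deg G v * d + (length ps + length rs) ≤ length W) →
    Σ (Fin n → Fin N) λ f′ → Σ (List (Fin n)) λ qs → Emb G qs f′ × (∀ {v} → v ∈ ps → v ∈ qs) ×
      (∀ {v} → v ∈ rs → v ∈ qs) × (∀ {v} → v ∈ qs → f′ v ∈ W)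
  greedy uW bd [] {ps} {f} E ups fW ur dis h = f , ps , E , id , (λ ()) , fW
  greedy {n} {G} {W} {d} uW bd (v ∷ rs) {ps} {f} E ups fW ur dis h
    = let f′ , qs , E′ , sub , sub′ , fW′ = greedy uW bd rs (extend E v∉ fresh red)
            (Unique-∷ v∉ ups) fW₁ (Unique-tail ur) dis′
            (λ {w} i → ≤-trans (≤-reflexive (cong (deg G w * d +_) (≡-sym (+-suc (length ps) (length rs))))) (h (there i)))
      in f′ , qs , E′ , sub ∘ there , (λ { (here refl) → sub (here refl) ; (there i) → sub′ i }) , fW′
    where
    v∉ : v ∉ ps
    v∉ = dis (here refl)
    blueTo : Fin n → List (Fin N)
    blueTo u = sel (blue (f u)) W
    forbidden : List (Fin N)
    forbidden = map f ps ++ concatMap blueTo (sel (adj G v) ps)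
    few-blue : sumOver (length ∘ blueTo) (sel (adj G v) ps) ≤ deg G v * d
    few-blue = ≤-trans (sumOver-bound _ d _ λ {u} i →
              ≤-trans (≤-reflexive (length-sel (blue (f u)) W)) (bd (fW (proj₁ (sel⁻ {p = adj G v} i)))))
            (*-monoˡ-≤ d (≤-trans (≤-reflexive (length-sel (adj G v) ps)) (cnt-adj≤deg G v ups)))
    arith : ∀ p x r w → suc (p + x) + w + r ≡ w + (x + (p + suc r))
    arith = solve-∀
    bound : length forbidden < length W
    bound = ≤-trans (s≤s (≤-trans (≤-reflexive (trans (length-++ (map f ps))
              (cong₂ _+_ (length-map f ps) (length-concatMap blueTo (sel (adj G v) ps)))))
              (+-monoʳ-≤ (length ps) few-blue)))
            (linear (length rs) (h (here refl)) (arith (length ps) (deg G v * d) (length rs) (length W)))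
    picked = pick forbidden uW bound
    y : Fin N
    y = proj₁ picked
    y∈W : y ∈ W
    y∈W = proj₁ (proj₂ picked)
    y∉ : y ∉ forbidden
    y∉ = proj₂ (proj₂ picked)
    fresh : ∀ {u} → u ∈ ps → f u ≢ y
    fresh i e = y∉ (∈-++⁺ˡ (subst (_∈ map f ps) e (∈-map⁺ f i)))
    red : ∀ {u} → u ∈ ps → adj G u v ≡ true → c (f u) y ≡ true
    red {u} i e = ¬blue⇒red (λ b → y∉ (∈-++⁺ʳ (map f ps) (∈-concatMap blueTo
                    (sel⁺ {p = adj G v} i (adj-sym G e)) (sel⁺ {p = blue (f u)} y∈W b)))) (fresh i)
    fW₁ : ∀ {u} → u ∈ v ∷ ps → upd f v y u ∈ W
    fW₁ (here refl) rewrite upd-same f v y = y∈W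
    fW₁ (there i) rewrite upd-on f y v∉ i = fW i
    dis′ : ∀ {w} → w ∈ rs → w ∉ v ∷ ps
    dis′ i (here refl) = Unique-head ur i
    dis′ i (there j) = dis (there i) j

  -- A red clique has no blue edge inside, so this is `greedy` with `d` = 0.
  place-in-clique : ∀ {n} {G : Graph n} {C} → Fin N → RedClique C → Unique C → ∀ {hs} → Unique hs →
    length hs ≤ length C → Σ (Fin n → Fin N) λ f → Emb G hs f × (∀ {v} → v ∈ hs → f v ∈ C)
  place-in-clique {G = G} {C} y rcl uC {hs} uhs len
    with f , qs , E , _ , sub , fC ← greedy {G = G} {d = 0} uC
      (λ {y} i → cnt≤ {ys = []} uC λ j b → ⊥-elim (true≢false (rcl i j (proj₂ (blue⁻ b))) (proj₁ (blue⁻ b))))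
      hs (Emb-[] (λ _ → y)) [] (λ ()) uhs (λ _ ())
      (λ {v} _ → ≤-trans (≤-reflexive (cong (_+ length hs) (*-zeroʳ (deg G v)))) len)
    = f , Emb-⊆ sub E , fC ∘ sub

  BlueMatching : List (Fin N × Fin N) → Set
  BlueMatching es = All (λ (a , b) → c a b ≡ false) es × Unique (pairVertices es)

  -- Subtraction-free form of |Q| ≥ |A| - 2(m - 1): the ends of at most m - 1 blue edges are
  -- missing.
  LargeClique : List (Fin N) → ℕ → Set
  LargeClique A m = Σ (List (Fin N)) λ Q → Unique Q × (∀ {x} → x ∈ Q → x ∈ A) × RedClique Q ×
    length A + 2 ≤ length Q + 2 * m

  blue-edge⊎clique : ∀ A → RedClique A ⊎ (Σ (Fin N) λ x → Σ (Fin N) λ y → x ∈ A × y ∈ A × x ≢ y × c x y ≡ false)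
  blue-edge⊎clique A = [ (λ h → inj₁ λ {x} {y} i j → h x i y j) , inj₂ ]′
    (∃⊎∀ {P = λ x → ∀ y → y ∈ A → x ≢ y → c x y ≡ true} A (λ x i → ∃⊎∀ A (λ y j → test x y i j)))
    where
    test : ∀ x y → x ∈ A → y ∈ A → (x ≢ y → c x y ≡ true) ⊎
      (Σ (Fin N) λ x → Σ (Fin N) λ y → x ∈ A × y ∈ A × x ≢ y × c x y ≡ false)
    test x y i j with x ≟ y | c x y in eq
    ... | yes p | _ = inj₁ λ ne → ⊥-elim (ne p)
    ... | no _ | true = inj₁ λ _ → refl
    ... | no ne | false = inj₂ (x , y , i , j , ne , eq)

  -- Disjoint blue edges are removed from `A` one at a time. If this stops before m edges, what is
  -- left is a red clique.
  matching⊎clique : ∀ m A → Unique A →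
    (Σ (List (Fin N × Fin N)) λ es → length es ≡ m × BlueMatching es × (∀ {x} → x ∈ pairVertices es → x ∈ A))
    ⊎ LargeClique A m
  matching⊎clique zero A u = inj₁ ([] , refl , ([] , []) , λ ())
  matching⊎clique (suc m) A u with blue-edge⊎clique A
  ... | inj₁ rcl = inj₂ (A , u , id , rcl , +-monoʳ-≤ (length A) (≤-trans (m≤m*n 2 (suc m)) ≤-refl))
  ... | inj₂ (x , y , i , j , ne , e) with matching⊎clique m (A ∖ (x ∷ y ∷ [])) (∖-Unique (x ∷ y ∷ []) u)
  ... | inj₁ (es , len , (bs , ues) , sub) = inj₁ ((x , y) ∷ es , cong suc len ,
          (e ∷ bs , Unique-∷ x∉ (Unique-∷ (λ l → proj₂ (sub′ l) (there (here refl))) ues)) ,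
          λ { (here refl) → i ; (there (here refl)) → j ; (there (there l)) → proj₁ (sub′ l) })
    where
    sub′ : ∀ {z} → z ∈ pairVertices es → z ∈ A × z ∉ x ∷ y ∷ []
    sub′ l = ∖⁻ A (sub l)
    x∉ : x ∉ y ∷ pairVertices es
    x∉ (here p) = ne p
    x∉ (there l) = proj₂ (sub′ l) (here refl)
  ... | inj₂ (Q , uQ , sub , rcl , len) = inj₂ (Q , uQ , proj₁ ∘ ∖⁻ A ∘ sub , rcl ,
          linear 0 (+-mono-≤ (∖-length (x ∷ y ∷ []) u) len) (lemma (length A) (length (A ∖ (x ∷ y ∷ []))) (length Q) m))
    where
    lemma : ∀ a b q m → a + 2 + (b + 2 + (q + 2 * m)) + 0 ≡ q + 2 * suc m + (a + (b + 2))
    lemma = solve-∀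

  module Fan (k : ℕ) where

    IsFan : Fin N → List (Fin N × Fin N) → Set
    IsFan v es = length es ≡ k × All (λ (a , b) → c a b ≡ false) es ×
      All (λ x → c v x ≡ false) (pairVertices es) × Unique (v ∷ pairVertices es)

    FanFree : List (Fin N) → Set
    FanFree W = ∀ v es → IsFan v es → (∀ {x} → x ∈ v ∷ pairVertices es → x ∈ W) → ⊥

    matching-fan : ∀ {W v es} → FanFree W → v ∈ W → (∀ {x} → x ∈ pairVertices es → x ∈ W) →
      length es ≡ k → BlueMatching es → (∀ {x} → x ∈ pairVertices es → x ≢ v × c v x ≡ false) → ⊥
    matching-fan {v = v} {es} ff v∈ sub len (bs , u) h = ff v es
      (len , bs , All.tabulate (proj₂ ∘ h) , Unique-∷ (λ i → proj₁ (h i) refl) u)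
      λ { (here refl) → v∈ ; (there i) → sub i }

    -- A blue matching of k edges inside a blue neighbourhood of `v` would be a fan centred at `v`.
    blue-nbhd-clique : ∀ {W v A} → FanFree W → v ∈ W → Unique A → (∀ {x} → x ∈ A → x ∈ W) →
      (∀ {x} → x ∈ A → x ≢ v × c v x ≡ false) → LargeClique A k
    blue-nbhd-clique {A = A} ff v∈ uA sub h with matching⊎clique k A uA
    ... | inj₂ q = q
    ... | inj₁ (es , len , bm , sub′) = ⊥-elim (matching-fan ff v∈ (sub ∘ sub′) len bm (h ∘ sub′))

-- Rotations of red paths

Unique-resp-↭ : ∀ {A : Set} {xs ys : List A} → xs ↭ ys → Unique xs → Unique ys
Unique-resp-↭ {A} p = Setoidₚ.Unique-resp-↭ (setoid A) (↭⇒↭ₛ p)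

lastOf : ∀ {A : Set} → A → List A → A
lastOf a [] = a
lastOf a (b ∷ bs) = lastOf b bs

allButLast : ∀ {A : Set} → A → List A → List A
allButLast a [] = []
allButLast a (b ∷ bs) = a ∷ allButLast b bs

lastOf-++ : ∀ {A : Set} (a : A) xs {b zs} → lastOf a (xs ++ b ∷ zs) ≡ lastOf b zs
lastOf-++ a [] = refl
lastOf-++ a (x ∷ xs) = lastOf-++ x xs

lastOf-ʳ++ : ∀ {A : Set} (a : A) xs {b zs} → lastOf a (xs ʳ++ b ∷ zs) ≡ lastOf b zs
lastOf-ʳ++ a [] = refl
lastOf-ʳ++ a (x ∷ xs) {b} = trans (lastOf-ʳ++ a xs {x}) refl

allButLast-⊆ : ∀ {A : Set} (a : A) {bs x} → x ∈ allButLast a bs → x ∈ a ∷ bs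
allButLast-⊆ a {b ∷ bs} (here e) = here e
allButLast-⊆ a {b ∷ bs} (there i) = there (allButLast-⊆ b i)

length-allButLast : ∀ {A : Set} (a : A) bs → length (allButLast a bs) ≡ length bs
length-allButLast a [] = refl
length-allButLast a (b ∷ bs) = cong suc (length-allButLast b bs)

-- Pósa-style rotation: a vertex x off a red path a, r either has pairwise blue "successors of
-- red neighbours", or can be inserted into the path without moving its two ends.
module Rotation {N} (c : Colouring N) (c-sym : SymmetricColouring c) (x : Fin N) where

  Red : Fin N → Fin N → Set
  Red a b = c a b ≡ true

  BlueClique : List (Fin N) → Set
  BlueClique = AllPairs (λ a b → c a b ≡ false)

  succs : Fin N → List (Fin N) → List (Fin N)
  succs a [] = []
  succs a (b ∷ r) = if c x a then b ∷ succs b r else succs b r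

  Longer : Fin N → List (Fin N) → Set
  Longer a r = Σ (List (Fin N)) λ r′ → Linked Red (a ∷ r′) × (a ∷ r′ ↭ x ∷ a ∷ r) × lastOf a r′ ≡ lastOf a r

  length-succs : ∀ a r → length (succs a r) ≡ cnt (c x) (allButLast a r)
  length-succs a [] = refl
  length-succs a (b ∷ r) with c x a
  ... | true = cong suc (length-succs b r)
  ... | false = length-succs b r

  succs-⊆ : ∀ a r {y} → y ∈ succs a r → y ∈ r
  succs-⊆ a (b ∷ r) i with c x a
  succs-⊆ a (b ∷ r) (here e) | true = here e
  succs-⊆ a (b ∷ r) (there i) | true = there (succs-⊆ b r i)
  succs-⊆ a (b ∷ r) i | false = there (succs-⊆ b r i)

  succs-Unique : ∀ a r → Unique r → Unique (succs a r)
  succs-Unique a [] u = []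
  succs-Unique a (b ∷ r) u with c x a
  ... | true = Unique-∷ (λ i → Unique-head u (succs-⊆ b r i)) (succs-Unique b r (Unique-tail u))
  ... | false = succs-Unique b r (Unique-tail u)

  split : ∀ b r {b′} → b′ ∈ succs b r →
    Σ (List (Fin N)) λ ms → Σ (List (Fin N)) λ zs → r ≡ ms ++ b′ ∷ zs × Red x (lastOf b ms)
  split b (a ∷ r) i with c x b in eq
  split b (a ∷ r) (here refl) | true = [] , r , refl , eq
  split b (a ∷ r) (there i) | true with ms , zs , refl , red ← split a r i = a ∷ ms , zs , refl , red
  split b (a ∷ r) i | false with ms , zs , refl , red ← split a r i = a ∷ ms , zs , refl , red

  linked-++ˡ : ∀ a ms {zs} → Linked Red (a ∷ ms ++ zs) → Linked Red (a ∷ ms)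
  linked-++ˡ a [] l = [-]
  linked-++ˡ a (m ∷ ms) (e ∷ l) = e ∷ linked-++ˡ m ms l

  linked-++ʳ : ∀ a ms {b zs} → Linked Red (a ∷ ms ++ b ∷ zs) → Linked Red (b ∷ zs)
  linked-++ʳ a [] (_ ∷ l) = l
  linked-++ʳ a (m ∷ ms) (_ ∷ l) = linked-++ʳ m ms l

  linked-ʳ++ : ∀ m ms {acc} → Linked Red (m ∷ ms) → Linked Red (m ∷ acc) → Red x (lastOf m ms) →
    Linked Red (x ∷ (m ∷ ms) ʳ++ acc)
  linked-ʳ++ m [] l l′ e = e ∷ l′
  linked-ʳ++ m (m₂ ∷ ms) (e₂ ∷ l) l′ e = linked-ʳ++ m₂ ms l (trans (c-sym m₂ m) e₂ ∷ l′) e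

  -- Let p be the predecessor of `b′`, which is red to `x`. The new path is a, x, then the segment
  -- from b to p in reverse, then b′ and the rest; its new edges are ax, xp and bb′.
  rotate-at : ∀ a b r {b′} → Linked Red (a ∷ b ∷ r) → Red x a → b′ ∈ succs b r → Red b b′ → Longer a (b ∷ r)
  rotate-at a b r {b′} (_ ∷ l) xa i bb′ with ms , zs , refl , e ← split b r i =
    x ∷ (b ∷ ms) ʳ++ b′ ∷ zs ,
    trans (c-sym a x) xa ∷ linked-ʳ++ b ms (linked-++ˡ b ms l) (bb′ ∷ linked-++ʳ b ms l) e ,
    swap a x (↭-sym (++↭ʳ++ (b ∷ ms) (b′ ∷ zs))) ,
    trans (lastOf-ʳ++ x (b ∷ ms) {b′} {zs}) (≡-sym (lastOf-++ b ms))

  -- Induction from the far end. Only `b` can be a new successor, and only if `x` is red to `a`. If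
  -- `x` is also red to `b`, it fits between them; if `b` is red to a later successor, `rotate-at`
  -- applies; otherwise `b` extends the blue clique.
  rotate : ∀ a r → Linked Red (a ∷ r) → BlueClique (x ∷ succs a r) ⊎ Longer a r
  rotate a [] l = inj₁ ([] ∷ [])
  rotate a (b ∷ r) (ab ∷ l) with rotate b r l
  ... | inj₂ (r′ , l′ , p , e) = inj₂ (b ∷ r′ , ab ∷ l′ , ↭-trans (prep a p) (swap a x ↭-refl) , e)
  ... | inj₁ (xs ∷ ps) with c x a in xa
  ...   | false = inj₁ (xs ∷ ps)
  ...   | true with c x b in xb
  ...     | true = inj₂ (x ∷ b ∷ r , trans (c-sym a x) xa ∷ xb ∷ l , swap a x ↭-refl , refl)
  ...     | false with ∃⊎∀ {P = λ b′ → c b b′ ≡ false} {Longer a (b ∷ r)} (succs b r) test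
    where
    test : ∀ b′ → b′ ∈ succs b r → c b b′ ≡ false ⊎ Longer a (b ∷ r)
    test b′ i with c b b′ in e
    ... | true = inj₂ (rotate-at a b r (ab ∷ l) xa i e)
    ... | false = inj₁ refl
  ...       | inj₂ q = inj₂ q
  ...       | inj₁ h = inj₁ ((xb ∷ xs) ∷ All.tabulate (λ {b′} → h b′) ∷ ps)

data Triple {A : Set} (p a s : A) : List A → Set where
  here : ∀ {xs} → Triple p a s (p ∷ a ∷ s ∷ xs)
  there : ∀ {x xs} → Triple p a s xs → Triple p a s (x ∷ xs)

lastOf∈ : ∀ {A : Set} (a : A) bs → lastOf a bs ∈ a ∷ bs
lastOf∈ a [] = here refl
lastOf∈ a (b ∷ bs) = there (lastOf∈ b bs)

last⊎interior : ∀ {A : Set} {a : A} w ws → a ∈ ws →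
  (a ≡ lastOf w ws) ⊎ (Σ A λ p → Σ A λ s → Triple p a s (w ∷ ws))
last⊎interior w (w₁ ∷ []) (here e) = inj₁ e
last⊎interior w (w₁ ∷ w₂ ∷ ws) (here refl) = inj₂ (w , w₂ , here)
last⊎interior w (w₁ ∷ ws) (there i) with last⊎interior w₁ ws i
... | inj₁ e = inj₁ e
... | inj₂ (p , s , t) = inj₂ (p , s , there t)

Triple-linked : ∀ {A : Set} {R : A → A → Set} {p a s xs} → Triple p a s xs → Linked R xs → R p a × R a s
Triple-linked here (e ∷ e′ ∷ _) = e , e′
Triple-linked (there t) (_ ∷ l) = Triple-linked t l
Triple-linked (there ()) [-]

Triple-map : ∀ {A B : Set} (f : A → B) {p a s xs} → Triple p a s xs → Triple (f p) (f a) (f s) (map f xs)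
Triple-map f here = here
Triple-map f (there t) = there (Triple-map f t)

lastOf-map : ∀ {A B : Set} (f : A → B) a bs → lastOf (f a) (map f bs) ≡ f (lastOf a bs)
lastOf-map f a [] = refl
lastOf-map f a (b ∷ bs) = lastOf-map f b bs

allButLast-Unique : ∀ {A : Set} (a : A) {bs} → Unique (a ∷ bs) → Unique (allButLast a bs)
allButLast-Unique a {[]} u = []
allButLast-Unique a {b ∷ bs} u = Unique-∷ (Unique-head u ∘ allButLast-⊆ b) (allButLast-Unique b (Unique-tail u))

Unique-map-injective : ∀ {A B : Set} (f : A → B) {xs u v} → Unique (map f xs) → u ∈ xs → v ∈ xs → f u ≡ f v → u ≡ v
Unique-map-injective f uq (here refl) (here refl) e = refl
Unique-map-injective f {_ ∷ xs} uq (here refl) (there j) e = ⊥-elim (Unique-head uq (subst (_∈ map f xs) (≡-sym e) (∈-map⁺ f j)))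
Unique-map-injective f {_ ∷ xs} uq (there i) (here refl) e = ⊥-elim (Unique-head uq (subst (_∈ map f xs) e (∈-map⁺ f i)))
Unique-map-injective f uq (there i) (there j) e = Unique-map-injective f (Unique-tail uq) i j e

injective-on-Unique : ∀ {A B : Set} (f : A → B) {xs} → Unique xs →
  (∀ {u v} → u ∈ xs → v ∈ xs → f u ≡ f v → u ≡ v) → Unique (map f xs)
injective-on-Unique f {[]} uq h = []
injective-on-Unique f {x ∷ xs} uq h = Unique-∷
  (λ i → let y , j , e = ∈-map⁻ f i in Unique-head uq (subst (_∈ xs) (≡-sym (h (here refl) (there j) e)) j))
  (injective-on-Unique f (Unique-tail uq) λ i j → h (there i) (there j))

module _ {n : ℕ} {B : Set} where

  assign : (Fin n → B) → List (Fin n) → List B → Fin n → B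
  assign f (w ∷ ws) (y ∷ ys) = upd (assign f ws ys) w y
  assign f _ _ = f

  assign-other : ∀ f ws ys {v} → v ∉ ws → assign f ws ys v ≡ f v
  assign-other f [] ys v∉ = refl
  assign-other f (w ∷ ws) [] v∉ = refl
  assign-other f (w ∷ ws) (y ∷ ys) v∉ = trans (upd-other (assign f ws ys) y λ { refl → v∉ (here refl) }) (assign-other f ws ys (v∉ ∘ there))

  map-cong-on : ∀ {f g : Fin n → B} xs → (∀ {v} → v ∈ xs → f v ≡ g v) → map f xs ≡ map g xs
  map-cong-on [] h = refl
  map-cong-on (x ∷ xs) h = cong₂ _∷_ (h (here refl)) (map-cong-on xs (h ∘ there))

  assign-map : ∀ f ws ys → Unique ws → length ws ≡ length ys → map (assign f ws ys) ws ≡ ys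
  assign-map f [] [] u e = refl
  assign-map f (w ∷ ws) (y ∷ ys) u e = cong₂ _∷_ (upd-same (assign f ws ys) w y)
    (trans (map-cong-on ws λ i → upd-other (assign f ws ys) y λ { refl → Unique-head u i })
      (assign-map f ws ys (Unique-tail u) (suc-injective e)))

module Lengthen {N : ℕ} (c : Colouring N) (c-sym : SymmetricColouring c) where
  open Host c c-sym

  blue-clique-matching : ∀ m S → Unique S → AllPairs (λ a b → c a b ≡ false) S → 2 * m ≤ length S →
    Σ (List (Fin N × Fin N)) λ es → length es ≡ m × BlueMatching es × (∀ {x} → x ∈ pairVertices es → x ∈ S)
  blue-clique-matching zero S u b le = [] , refl , ([] , []) , λ ()
  blue-clique-matching (suc m) S u b le with S | u | b | subst (_≤ length S) (*-suc 2 m) le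
  ... | x ∷ y ∷ S′ | ux ∷ uy ∷ u′ | (bxy ∷ _) ∷ _ ∷ b′ | s≤s (s≤s le′)
    with es , len , (bs , ues) , sub ← blue-clique-matching m S′ u′ b′ le′
    = (x , y) ∷ es , cong suc len , (bxy ∷ bs , Unique-∷ x∉ (Unique-∷ (Unique-head (uy ∷ u′) ∘ sub) ues)) ,
      λ { (here e) → here e ; (there (here e)) → there (here e) ; (there (there i)) → there (there (sub i)) }
    where
    x∉ : x ∉ y ∷ pairVertices es
    x∉ (here e) = Unique-head (ux ∷ uy ∷ u′) (here e)
    x∉ (there i) = Unique-head (ux ∷ uy ∷ u′) (there (sub i))

  -- H is G with the interior vertex w₁ of a suspended path contracted.
  module _ {n} {G H : Graph n} {As Bs : List (Fin n)} {w₀ w₁ w₂ : Fin n} {ws : List (Fin n)} {f : Fin n → Fin N}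
    (uq : Unique (w₀ ∷ w₁ ∷ w₂ ∷ ws))
    (interior : ∀ {p a s} → Triple p a s (w₀ ∷ w₁ ∷ w₂ ∷ ws) → ∀ {b} → adj G a b ≡ true → b ≡ p ⊎ b ≡ s)
    (As⇒Bs : ∀ {u} → u ∈ As → u ≢ w₁ → u ∈ Bs)
    (G⇒H : ∀ {u v} → u ≢ w₁ → v ≢ w₁ → adj G u v ≡ true → adj H u v ≡ true)
    (path⊆ : ∀ {u} → u ∈ w₀ ∷ w₂ ∷ ws → u ∈ As)
    (E : Emb H Bs f) where

    private
      path : List (Fin n)
      path = w₀ ∷ w₁ ∷ w₂ ∷ ws

      w₁∉ : w₁ ∉ w₂ ∷ ws
      w₁∉ = Unique-head (Unique-tail uq)

      w₀≢w₁ : w₀ ≢ w₁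
      w₀≢w₁ refl = Unique-head uq (here refl)

      rest≢w₁ : ∀ {u} → u ∈ w₀ ∷ w₂ ∷ ws → u ≢ w₁
      rest≢w₁ (here refl) = w₀≢w₁
      rest≢w₁ (there i) refl = w₁∉ i

      inBs : ∀ {u} → u ∈ w₀ ∷ w₂ ∷ ws → u ∈ Bs
      inBs i = As⇒Bs (path⊆ i) (rest≢w₁ i)

    image-Unique : Unique (map f (w₀ ∷ w₂ ∷ ws))
    image-Unique = injective-on-Unique f
      (Unique-∷ (Unique-head uq ∘ there) (Unique-tail (Unique-tail uq)))
      λ i j → inj E (inBs i) (inBs j)

    -- The path of `G` is laid along the longer red path in order. Its ends keep their images, so
    -- edges leaving the path there stay red, and interior vertices have no edges off the path. An
    -- edge of `G` not covered by the path therefore avoids `w₁` and is an edge of `H` with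
    -- unchanged images.
    insert : ∀ {x} → (∀ {u} → u ∈ Bs → f u ≢ x) → Rotation.Longer c c-sym x (f w₀) (map f (w₂ ∷ ws)) →
      Σ (Fin n → Fin N) λ f′ → Emb G As f′ × (∀ {u} → u ∈ As → f′ u ≡ x ⊎ (Σ (Fin n) λ v → v ∈ Bs × f′ u ≡ f v))
    insert {x} fresh (r′ , l , perm , lst) = f′ , record { inj = inj′ ; hom = hom′ } , image
      where
      f′ : Fin n → Fin N
      f′ = assign f path (f w₀ ∷ r′)
      f′-path : map f′ path ≡ f w₀ ∷ r′
      f′-path = assign-map f path (f w₀ ∷ r′) uq
        (≡-sym (trans (↭-length perm) (cong (2 +_) (length-map f (w₂ ∷ ws)))))
      f′-off : ∀ {v} → v ∉ path → f′ v ≡ f v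
      f′-off = assign-other f path (f w₀ ∷ r′)
      on-path : ∀ {u} → u ∈ path → f′ u ∈ x ∷ map f (w₀ ∷ w₂ ∷ ws)
      on-path {u} i = ∈-resp-↭ perm (subst (f′ u ∈_) f′-path (∈-map⁺ f′ i))
      on-path′ : ∀ {u} → u ∈ path → f′ u ≡ x ⊎ (Σ (Fin n) λ v → v ∈ w₀ ∷ w₂ ∷ ws × f′ u ≡ f v)
      on-path′ i with on-path i
      ... | here e = inj₁ e
      ... | there j = inj₂ (∈-map⁻ f j)
      off≢w₁ : ∀ {v} → v ∉ path → v ≢ w₁
      off≢w₁ v∉ refl = v∉ (there (here refl))
      sub-path : ∀ {v} → v ∈ w₀ ∷ w₂ ∷ ws → v ∈ path
      sub-path (here e) = here e
      sub-path (there i) = there (there i)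
      image : ∀ {u} → u ∈ As → f′ u ≡ x ⊎ (Σ (Fin n) λ v → v ∈ Bs × f′ u ≡ f v)
      image {u} i with u ∈? path
      ... | no u∉ = inj₂ (u , As⇒Bs i (off≢w₁ u∉) , f′-off u∉)
      ... | yes j with on-path′ j
      ...   | inj₁ e = inj₁ e
      ...   | inj₂ (v , l , e) = inj₂ (v , inBs l , e)
      path-Unique : Unique (map f′ path)
      path-Unique = subst Unique (≡-sym f′-path) (Unique-resp-↭ (↭-sym perm)
        (Unique-∷ (λ i → let v , j , e = ∈-map⁻ f i in fresh (inBs j) (≡-sym e)) image-Unique))
      mixed : ∀ {u v} → u ∈ path → v ∈ As → v ∉ path → f′ u ≢ f′ v
      mixed i j v∉ e with on-path′ i | trans e (f′-off v∉)
      ... | inj₁ e₁ | e₂ = fresh (As⇒Bs j (off≢w₁ v∉)) (trans (≡-sym e₂) e₁)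
      ... | inj₂ (w , l , e₁) | e₂ =
        v∉ (subst (_∈ path) (inj E (inBs l) (As⇒Bs j (off≢w₁ v∉)) (trans (≡-sym e₁) e₂)) (sub-path l))
      inj′ : ∀ {u v} → u ∈ As → v ∈ As → f′ u ≡ f′ v → u ≡ v
      inj′ {u} {v} i j e with u ∈? path | v ∈? path
      ... | yes p | yes q = Unique-map-injective f′ path-Unique p q e
      ... | yes p | no q = ⊥-elim (mixed p j q e)
      ... | no p | yes q = ⊥-elim (mixed q i p (≡-sym e))
      ... | no p | no q = inj E (As⇒Bs i (off≢w₁ p)) (As⇒Bs j (off≢w₁ q))
                            (trans (≡-sym (f′-off p)) (trans e (f′-off q)))
      f′-last : f′ (lastOf w₂ ws) ≡ f (lastOf w₂ ws)
      f′-last = trans (≡-sym (lastOf-map f′ w₀ (w₁ ∷ w₂ ∷ ws)))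
        (trans (cong last′ f′-path) (trans lst (lastOf-map f w₀ (w₂ ∷ ws))))
        where
        last′ : List (Fin N) → Fin N
        last′ [] = x
        last′ (y ∷ ys) = lastOf y ys
      red-path : Linked (λ a b → c a b ≡ true) (map f′ path)
      red-path = subst (Linked _) (≡-sym f′-path) l
      classify : ∀ u → (f′ u ≡ f u × u ≢ w₁) ⊎ (Σ (Fin n) λ p → Σ (Fin n) λ s → Triple p u s path)
      classify u with u ∈? path
      ... | no u∉ = inj₁ (f′-off u∉ , off≢w₁ u∉)
      ... | yes (here refl) = inj₁ (proj₁ (∷-injective f′-path) , w₀≢w₁)
      ... | yes (there i) with last⊎interior w₀ (w₁ ∷ w₂ ∷ ws) i
      ...   | inj₁ refl = inj₁ (f′-last , λ e → w₁∉ (subst (_∈ w₂ ∷ ws) e (lastOf∈ w₂ ws)))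
      ...   | inj₂ t = inj₂ t
      red-interior : ∀ {p u s v} → Triple p u s path → adj G u v ≡ true → c (f′ u) (f′ v) ≡ true
      red-interior {p} {u} t e with interior t e | Triple-linked (Triple-map f′ t) red-path
      ... | inj₁ refl | r , _ = trans (c-sym (f′ u) (f′ p)) r
      ... | inj₂ refl | _ , r = r
      hom′ : ∀ {u v} → u ∈ As → v ∈ As → adj G u v ≡ true → c (f′ u) (f′ v) ≡ true
      hom′ {u} {v} i j e with classify u | classify v
      ... | inj₂ (_ , _ , t) | _ = red-interior t e
      ... | inj₁ _ | inj₂ (_ , _ , t) = trans (c-sym (f′ u) (f′ v)) (red-interior t (adj-sym G e))
      ... | inj₁ (eu , nu) | inj₁ (ev , nv) rewrite eu | ev = hom E (As⇒Bs i nu) (As⇒Bs j nv) (G⇒H nu nv e)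

    -- If no unused vertex can be inserted, each has at most 2k red neighbours on the path,
    -- so any k blue edges between unused vertices have a common blue neighbour there.
    lengthen : ∀ {W} k → Unique W → Fan.FanFree k W → (∀ {u} → u ∈ Bs → f u ∈ W) →
      Linked (λ u v → adj H u v ≡ true) (w₀ ∷ w₂ ∷ ws) → 4 * k * k < length (w₂ ∷ ws) →
      (Σ (Fin n → Fin N) λ f′ → Emb G As f′ × (∀ {u} → u ∈ As → f′ u ∈ W)) ⊎ LargeClique (W ∖ map f Bs) k
    lengthen {W} k uW ff f∈W linked long
      with matching⊎clique k (W ∖ map f Bs) (∖-Unique (map f Bs) uW)
    ... | inj₂ q = inj₂ q
    ... | inj₁ (es , len , bm , sub) =
      [ (λ few → ⊥-elim (no-matching few)) , inj₁ ]′ (∃⊎∀ (pairVertices es) (λ x → few⊎longer x ∘ sub))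
      where
      open Fan k
      r : List (Fin N)
      r = map f (w₂ ∷ ws)
      red-path : ∀ u us → (∀ {v} → v ∈ u ∷ us → v ∈ Bs) → Linked (λ u v → adj H u v ≡ true) (u ∷ us) →
        Linked (λ a b → c a b ≡ true) (map f (u ∷ us))
      red-path u [] _ _ = [-]
      red-path u (v ∷ us) h (e ∷ l) = hom E (h (here refl)) (h (there (here refl))) e ∷ red-path v us (h ∘ there) l
      path∈W : ∀ {y} → y ∈ f w₀ ∷ r → y ∈ W
      path∈W i with v , j , refl ← ∈-map⁻ f i = f∈W (inBs j)
      unused : ∀ {x} → x ∈ W ∖ map f Bs → x ∈ W × (∀ {u} → u ∈ Bs → f u ≢ x)
      unused i with j , x∉ ← ∖⁻ W i = j , λ l e → x∉ (subst (_∈ map f Bs) e (∈-map⁺ f l))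
      few⊎longer : ∀ x → x ∈ W ∖ map f Bs → cnt (c x) (allButLast (f w₀) r) ≤ 2 * k ⊎
        (Σ (Fin n → Fin N) λ f′ → Emb G As f′ × (∀ {u} → u ∈ As → f′ u ∈ W))
      few⊎longer x i with Rotation.rotate c c-sym x (f w₀) r (red-path w₀ (w₂ ∷ ws) inBs linked)
      ... | inj₂ longer = let f′ , E′ , image = insert (proj₂ (unused i)) longer in
        inj₂ (f′ , E′ , λ {u} j → [ (λ e → subst (_∈ W) (≡-sym e) (proj₁ (unused i))) ,
                                  (λ (v , l , e) → subst (_∈ W) (≡-sym e) (f∈W l)) ]′ (image j))
      ... | inj₁ (xs ∷ bs) with cnt (c x) (allButLast (f w₀) r) ≤? 2 * k
      ...   | yes le = inj₁ le
      ...   | no gt = ⊥-elim (clique-fan (<⇒≤ (subst (2 * k <_) (≡-sym (Rotation.length-succs c c-sym x (f w₀) r)) (≰⇒> gt))))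
        where
        S = Rotation.succs c c-sym x (f w₀) r
        uS = Rotation.succs-Unique c c-sym x (f w₀) r (Unique-tail image-Unique)
        S⊆ : ∀ {y} → y ∈ S → y ∈ r
        S⊆ = Rotation.succs-⊆ c c-sym x (f w₀) r
        -- `x` is blue to all of `S`, and `S` is pairwise blue, so pairing up 2k of its vertices
        -- gives a fan centred at `x`.
        clique-fan : 2 * k ≤ length S → ⊥
        clique-fan le with es′ , len′ , bm′ , sub′ ← blue-clique-matching k S uS bs le =
          matching-fan ff (proj₁ (unused i)) (path∈W ∘ there ∘ S⊆ ∘ sub′) len′ bm′
            λ j → (λ e → let v , l , e′ = ∈-map⁻ f (S⊆ (sub′ j)) in proj₂ (unused i) (inBs (there l)) (trans (≡-sym e′) e)) ,
                  All.lookup xs (sub′ j)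
      no-matching : (∀ x → x ∈ pairVertices es → cnt (c x) (allButLast (f w₀) r) ≤ 2 * k) → ⊥
      no-matching few = matching-fan ff (path∈W y∈) (proj₁ ∘ unused ∘ sub) len bm
        λ {x} i → (λ e → let v , l , e′ = ∈-map⁻ f y∈ in proj₂ (unused (sub i)) (inBs l) (trans (≡-sym e′) (≡-sym e))) ,
                  ¬true⇒false (λ e → y∉ (∈-concatMap redTo i (sel⁺ {p = c x} y∈′ (trans (c-sym x y) e))))
        where
        redTo : Fin N → List (Fin N)
        redTo x = sel (c x) (allButLast (f w₀) r)
        -- The 2k ends of the matching spoil at most 2k · 2k vertices. The last vertex of the path
        -- has no successor, so its colour to `x` is not controlled by `succs` and it is excluded
        -- from the choice of `y`.
        bound : length (concatMap redTo (pairVertices es)) < length (allButLast (f w₀) r)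
        bound = ≤-trans (s≤s (≤-trans (≤-reflexive (length-concatMap redTo (pairVertices es)))
                  (≤-trans (sumOver-bound _ (2 * k) _ λ {x} i →
                      ≤-trans (≤-reflexive (length-sel (c x) (allButLast (f w₀) r))) (few x i))
                    (≤-reflexive (trans (cong (_* (2 * k)) (trans (length-pairVertices es) (cong (2 *_) len))) (arith k))))))
                (≤-trans long (≤-reflexive (≡-sym (trans (length-allButLast (f w₀) r) (length-map f (w₂ ∷ ws))))))
          where
          arith : ∀ k → 2 * k * (2 * k) ≡ 4 * k * k
          arith = solve-∀
        picked = pick (concatMap redTo (pairVertices es)) (allButLast-Unique (f w₀) image-Unique) bound
        y = proj₁ picked
        y∈′ : y ∈ allButLast (f w₀) r
        y∈′ = proj₁ (proj₂ picked)
        y∉ : y ∉ concatMap redTo (pairVertices es)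
        y∉ = proj₂ (proj₂ picked)
        y∈ : y ∈ f w₀ ∷ r
        y∈ = allButLast-⊆ (f w₀) y∈′

-- Reducing a sparse graph

indicator : ∀ {n} → Fin n → Fin n → Fin n → Fin n → ℕ
indicator a b u v = if (a == u) ∧ (b == v) then 1 else 0

degSum : ∀ {n} → Graph n → ℕ
degSum {n} G = sumOver (deg G) (allFin n)

module _ {n} (G : Graph n) where

  two-neighbours : ∀ {w a b y} → deg G w ≤ 2 → adj G w a ≡ true → adj G w b ≡ true → a ≢ b →
    adj G w y ≡ true → y ≡ a ⊎ y ≡ b
  two-neighbours {w} {a} {b} {y} d2 ea eb ne ey with y ≟ a | y ≟ b
  ... | yes e | _ = inj₁ e
  ... | no _ | yes e = inj₂ e
  ... | no y≢a | no y≢b = ⊥-elim (<-irrefl refl (≤-trans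
      (⊆-length {xs = y ∷ a ∷ b ∷ []} {nbrs G w} ((y≢a ∷ y≢b ∷ []) ∷ (ne ∷ []) ∷ [] ∷ [])
        λ { (here refl) → nbrs⁺ G ey ; (there (here refl)) → nbrs⁺ G ea ; (there (there (here refl))) → nbrs⁺ G eb })
      (≤-trans (≤-reflexive (length-nbrs G w)) d2)))

  one-neighbour : ∀ {w a y} → deg G w ≤ 1 → adj G w a ≡ true → adj G w y ≡ true → y ≡ a
  one-neighbour {w} {a} {y} d1 ea ey with y ≟ a
  ... | yes e = e
  ... | no y≢a = ⊥-elim (<-irrefl refl (≤-trans
      (⊆-length {xs = y ∷ a ∷ []} {nbrs G w} ((y≢a ∷ []) ∷ [] ∷ [])
        λ { (here refl) → nbrs⁺ G ey ; (there (here refl)) → nbrs⁺ G ea })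
      (≤-trans (≤-reflexive (length-nbrs G w)) d1)))

  delete : Fin n → Graph n
  delete w = record
    { adj = λ u v → adj G u v ∧ (not (w == u) ∧ not (w == v))
    ; sym = λ u v → cong₂ _∧_ (sym G u v) (Boolₚ.∧-comm (not (w == u)) (not (w == v)))
    ; irrefl = λ u → cong (_∧ (not (w == u) ∧ not (w == u))) (irrefl G u)
    }

  delete⁺ : ∀ {w u v} → u ≢ w → v ≢ w → adj G u v ≡ true → adj (delete w) u v ≡ true
  delete⁺ {w} {u} {v} nu nv e
    rewrite e | ≢⇒== (λ w≡u → nu (≡-sym w≡u)) | ≢⇒== (λ w≡v → nv (≡-sym w≡v)) = refl

  delete⁻ : ∀ {w u v} → adj (delete w) u v ≡ true → adj G u v ≡ true × u ≢ w
  delete⁻ {w} {u} {v} e with adj G u v | w ≟ u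
  ... | true | no ne = refl , λ p → ne (≡-sym p)

  -- The entries of the adjacency matrix that vanish are the row and the column of `w`; they are
  -- counted independently because the diagonal is empty.
  degSum-delete : ∀ w → degSum (delete w) + 2 * deg G w ≤ degSum G
  degSum-delete w = linear 0 (+-mono-≤ total (+-mono-≤ rows cols))
    (arith (degSum (delete w)) (deg G w) (degSum G) (sumOver (λ u → sumOver (row u) all) all) (sumOver (λ u → sumOver (col u) all) all))
    where
    all = allFin n
    b2n : Bool → ℕ
    b2n b = if b then 1 else 0
    row col : Fin n → Fin n → ℕ
    row u v = if w == u then b2n (adj G u v) else 0
    col u v = if w == v then b2n (adj G u v) else 0
    pointwise : ∀ u v → b2n (adj (delete w) u v) + (row u v + col u v) ≤ b2n (adj G u v)
    pointwise u v with w ≟ u | w ≟ v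
    ... | no _ | no _ = ≤-reflexive (trans (+-identityʳ _) (cong b2n (Boolₚ.∧-identityʳ (adj G u v))))
    ... | yes refl | yes refl rewrite irrefl G w = z≤n
    ... | yes refl | no _ rewrite Boolₚ.∧-zeroʳ (adj G w v) = ≤-reflexive (+-identityʳ _)
    ... | no _ | yes refl rewrite Boolₚ.∧-zeroʳ (adj G u w) = ≤-refl
    total : degSum (delete w) + (sumOver (λ u → sumOver (row u) all) all + sumOver (λ u → sumOver (col u) all) all) ≤ degSum G
    total = begin
      degSum (delete w) + (sumOver (λ u → sumOver (row u) all) all + sumOver (λ u → sumOver (col u) all) all)
        ≡⟨ cong (degSum (delete w) +_) (sumOver-+ _ _ all) ⟨
      degSum (delete w) + sumOver (λ u → sumOver (row u) all + sumOver (col u) all) all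
        ≡⟨ sumOver-+ _ _ all ⟨
      sumOver (λ u → deg (delete w) u + (sumOver (row u) all + sumOver (col u) all)) all
        ≤⟨ sumOver-mono all (λ {u} _ → ≤-trans (≤-reflexive (trans
             (cong (deg (delete w) u +_) (≡-sym (sumOver-+ (row u) (col u) all)))
             (≡-sym (sumOver-+ _ _ all)))) (sumOver-mono all λ {v} _ → pointwise u v)) ⟩
      degSum G ∎
      where open ≤-Reasoning
    b2n-here : ∀ v → row w v ≡ b2n (adj G w v)
    b2n-here v rewrite ==-refl w = refl
    b2n-here′ : ∀ u → col u w ≡ b2n (adj G w u)
    b2n-here′ u rewrite ==-refl w = cong b2n (sym G u w)
    rows : deg G w ≤ sumOver (λ u → sumOver (row u) all) all
    rows = ≤-trans (≤-reflexive (≡-sym (sumOver-cong all b2n-here))) (term≤sumOver (λ u → sumOver (row u) all) (∈-all w))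
    cols : deg G w ≤ sumOver (λ u → sumOver (col u) all) all
    cols = ≤-trans (≤-reflexive (≡-sym (sumOver-cong all b2n-here′)))
      (≤-trans (term≤sumOver (λ v → sumOver (λ u → col u v) all) (∈-all w)) (≤-reflexive (≡-sym (sumOver-swap col all all))))
    arith : ∀ d e g r s → d + 2 * e + (g + (r + s)) + 0 ≡ g + (d + (r + s) + (e + e))
    arith = solve-∀

  addEdge : ∀ a b → a ≢ b → Graph n
  addEdge a b a≢b = record
    { adj = λ u v → adj G u v ∨ ((a == u) ∧ (b == v) ∨ (b == u) ∧ (a == v))
    ; sym = λ u v → cong₂ _∨_ (sym G u v) (trans (Boolₚ.∨-comm ((a == u) ∧ (b == v)) _)
              (cong₂ _∨_ (Boolₚ.∧-comm (b == u) (a == v)) (Boolₚ.∧-comm (a == u) (b == v))))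
    ; irrefl = loopless
    }
    where
    loopless : ∀ u → adj G u u ∨ ((a == u) ∧ (b == u) ∨ (b == u) ∧ (a == u)) ≡ false
    loopless u rewrite irrefl G u with a ≟ u | b ≟ u
    ... | yes p | yes q = ⊥-elim (a≢b (trans p (≡-sym q)))
    ... | yes _ | no _ = refl
    ... | no _ | yes _ = refl
    ... | no _ | no _ = refl

  module _ {a b : Fin n} (a≢b : a ≢ b) where

    addEdge⁺ : ∀ {u v} → adj G u v ≡ true → adj (addEdge a b a≢b) u v ≡ true
    addEdge⁺ e rewrite e = refl

    addEdge-new : adj (addEdge a b a≢b) a b ≡ true
    addEdge-new rewrite ==-refl a | ==-refl b = Boolₚ.∨-zeroʳ (adj G a b)

    addEdge⁻ : ∀ {u v} → adj (addEdge a b a≢b) u v ≡ true → adj G u v ≡ true ⊎ (u ≡ a ⊎ u ≡ b)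
    addEdge⁻ {u} {v} e with adj G u v | a ≟ u | b ≟ u
    ... | true | _ | _ = inj₁ refl
    ... | false | yes p | _ = inj₂ (inj₁ (≡-sym p))
    ... | false | no _ | yes p = inj₂ (inj₂ (≡-sym p))

    -- An inequality, since `a` and `b` may already be adjacent in `G`.
    degSum-addEdge : degSum (addEdge a b a≢b) ≤ degSum G + 2
    degSum-addEdge = begin
      degSum (addEdge a b a≢b)
        ≤⟨ sumOver-mono all (λ {u} _ → ≤-trans (sumOver-mono all λ {v} _ → pointwise (adj G u v) ((a == u) ∧ (b == v)) ((b == u) ∧ (a == v)))
             (≤-reflexive (trans (sumOver-+ _ _ all) (cong (deg G u +_) (sumOver-+ _ _ all))))) ⟩
      sumOver (λ u → deg G u + (sumOver (indicator a b u) all + sumOver (indicator b a u) all)) all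
        ≡⟨ trans (sumOver-+ _ _ all) (cong (degSum G +_) (sumOver-+ _ _ all)) ⟩
      degSum G + (sumOver (λ u → sumOver (indicator a b u) all) all + sumOver (λ u → sumOver (indicator b a u) all) all)
        ≤⟨ +-monoʳ-≤ (degSum G) (+-mono-≤ (single a b) (single b a)) ⟩
      degSum G + 2 ∎
      where
      open ≤-Reasoning
      all = allFin n
      pointwise : ∀ p q r → (if p ∨ (q ∨ r) then 1 else 0) ≤ (if p then 1 else 0) + ((if q then 1 else 0) + (if r then 1 else 0))
      pointwise true q r = s≤s z≤n
      pointwise false true r = s≤s z≤n
      pointwise false false true = ≤-refl
      pointwise false false false = ≤-refl
      single : ∀ a b → sumOver (λ u → sumOver (indicator a b u) all) all ≤ 1
      single a b = ≤-trans (sumOver-mono all λ {u} _ → inner u) (≤-reflexive (cnt-single a (∈-all a) Unique-all))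
        where
        inner : ∀ u → sumOver (indicator a b u) all ≤ (if a == u then 1 else 0)
        inner u with a ≟ u
        ... | yes _ = ≤-reflexive (cnt-single b (∈-all b) Unique-all)
        ... | no _ = ≤-reflexive (trans (sumOver-const 0 all) (*-zeroʳ (length all)))

Reachable-trans : ∀ {n} {G : Graph n} {u v w} → Reachable G u v → Reachable G v w → Reachable G u w
Reachable-trans here q = q
Reachable-trans (step e p) q = step e (Reachable-trans p q)

-- A walk in G that passes through w is rerouted in H through r.
reroute : ∀ {n} {G H : Graph n} {w r} →
  (∀ {u v} → u ≢ w → v ≢ w → adj G u v ≡ true → adj H u v ≡ true) →
  (∀ {u} → adj G u w ≡ true → Reachable H u r) →
  (∀ {u} → adj G w u ≡ true → Reachable H r u) →
  ∀ {u v} → Reachable G u v → v ≢ w → (u ≢ w → Reachable H u v) × (u ≡ w → Reachable H r v)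
reroute keep into out here v≢w = (λ _ → here) , λ e → ⊥-elim (v≢w e)
reroute {G = G} {H} {w} {r} keep into out {v = v} (step {u} {x} e p) v≢w with x ≟ w | reroute {G = G} {H} keep into out p v≢w
... | yes refl | _ , p₂ = (λ _ → Reachable-trans (into e) (p₂ refl)) , λ { refl → p₂ refl }
... | no x≢w | p₁ , _ = (λ u≢w → step (keep u≢w x≢w e) (p₁ x≢w)) , λ { refl → Reachable-trans (out e) (p₁ x≢w) }

sumOver-sel : ∀ {A : Set} (p : A → Bool) (f : A → ℕ) xs → sumOver f (sel p xs) ≡ sumOver (λ x → if p x then f x else 0) xs
sumOver-sel p f [] = refl
sumOver-sel p f (x ∷ xs) with p x
... | true = cong (f x +_) (sumOver-sel p f xs)
... | false = sumOver-sel p f xs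

module Suspended {n} (G : Graph n) (isB : Fin n → Bool) where

  -- A simple path from v to its first vertex in B; the list records the vertices before that hit.
  data PathToB : Fin n → List (Fin n) → Set where
    hit : ∀ {b} → isB b ≡ true → PathToB b []
    go : ∀ {v w us} → isB v ≡ false → adj G v w ≡ true → PathToB w us → v ∉ us → PathToB v (v ∷ us)

  suffix : ∀ {v us u} → PathToB v us → u ∈ us → ∃ λ us′ → PathToB u us′
  suffix p@(go _ _ _ _) (here refl) = _ , p
  suffix (go _ _ p _) (there i) = suffix p i

  -- Loop erasure: if `u` already lies on the path found for the rest of the walk, the part before
  -- it is dropped.
  pathToB : ∀ {u b} → Reachable G u b → isB b ≡ true → ∃ λ us → PathToB u us
  pathToB here e = [] , hit e
  pathToB {u} (step e r) eb with isB u in eu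
  ... | true = [] , hit eu
  ... | false with us , p ← pathToB r eb with u ∈? us
  ...   | yes i = suffix p i
  ...   | no u∉ = u ∷ us , go eu e p u∉

  path-Unique : ∀ {v us} → PathToB v us → Unique us
  path-Unique (hit _) = []
  path-Unique (go _ _ p v∉) = Unique-∷ v∉ (path-Unique p)

  path-∉B : ∀ {v us u} → PathToB v us → u ∈ us → isB u ≡ false × (Σ (Fin n) λ w → adj G u w ≡ true)
  path-∉B (go e a p _) (here refl) = e , _ , a
  path-∉B (go _ _ p _) (there i) = path-∉B p i

  path-linked : ∀ {v us} → PathToB v us → Linked (λ u w → adj G u w ≡ true) us
  path-linked (hit _) = []
  path-linked (go _ _ (hit _) _) = [-]
  path-linked (go _ e p@(go _ _ _ _) _) = e ∷ path-linked p

  module Walk (deg≤2 : ∀ {v} → isB v ≡ false → deg G v ≤ 2) where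

    -- The continuation of a walk that enters a vertex of degree 2 from `p`. The value `x` is a
    -- default for a vertex with no second neighbour.
    other : Fin n → Fin n → Fin n
    other x p with sel (λ y → adj G x y ∧ not (p == y)) (allFin n)
    ... | [] = x
    ... | y ∷ _ = y

    other≡ : ∀ {x p v} → isB x ≡ false → adj G x p ≡ true → adj G x v ≡ true → p ≢ v → other x p ≡ v
    other≡ {x} {p} {v} ex ep ev ne with sel (λ y → adj G x y ∧ not (p == y)) (allFin n) in eq
    ... | [] with () ← subst (v ∈_) eq (sel⁺ {p = λ y → adj G x y ∧ not (p == y)} (∈-all v) (cong₂ _∧_ ev (cong not (≢⇒== ne))))
    ... | y ∷ _ with _ , e ← sel⁻ {p = λ y → adj G x y ∧ not (p == y)} {xs = allFin n} (subst (y ∈_) (≡-sym eq) (here refl))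
      with adj G x y in ey | p ≟ y
    ...   | true | no p≢y = [ (λ y≡p → ⊥-elim (p≢y (≡-sym y≡p))) , id ]′ (two-neighbours G (deg≤2 ex) ep ev ne ey)

    walk : ℕ → Fin n × Fin n → Fin n × Fin n
    walk zero s = s
    walk (suc i) s = let p , x = walk i s in x , other x p

    halfEdges : List (Fin n × Fin n)
    halfEdges = concatMap (λ b → map (b ,_) (nbrs G b)) (sel isB (allFin n))

    -- B together with the first `h` vertices met along each half-edge leaving B. Outside B a walk
    -- never has a choice, so the number of half-edges controls the number of vertices near B.
    near : ℕ → List (Fin n)
    near h = sel isB (allFin n) ++ concatMap (λ s → map (λ i → proj₂ (walk i s)) (upTo h)) halfEdges

    -- The path to B is traversed backwards, starting with the half-edge at its hit. Simplicity of
    -- the path guarantees that the vertex behind and the vertex ahead differ, as `other≡` requires.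
    walk-back : ∀ {v us w} → isB v ≡ false → adj G v w ≡ true → PathToB w us → v ∉ us →
      ∃ λ s → s ∈ halfEdges × walk (length us) s ≡ (w , v)
    walk-back {v} {w = w} ev a (hit e) v∉ = (w , v) ,
      ∈-concatMap (λ b → map (b ,_) (nbrs G b)) (sel⁺ {p = isB} (∈-all w) e) (∈-map⁺ (w ,_) (nbrs⁺ G (adj-sym G a))) , refl
    walk-back {v} {w = w} ev a (go {w = x} {us} ew a′ p w∉) v∉ with s , i , e ← walk-back ew a′ p w∉ =
      s , i , trans (cong (λ (q , y) → y , other y q) e) (cong (w ,_) (other≡ ew a′ (adj-sym G a) (ne p)))
      where
      ne : PathToB x us → x ≢ v
      ne (hit eb) refl = true≢false eb ev
      ne (go _ _ _ _) refl = v∉ (there (here refl))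

    path-near : ∀ {v us} h → PathToB v us → length us ≤ h → v ∈ near h
    path-near h (hit e) le = ∈-++⁺ˡ (sel⁺ {p = isB} (∈-all _) e)
    path-near h (go {v} {us = us} ev a p v∉) le with s , i , e ← walk-back ev a p v∉ =
      ∈-++⁺ʳ (sel isB (allFin n)) (∈-concatMap (λ s → map (λ i → proj₂ (walk i s)) (upTo h)) i
        (subst (_∈ map (λ i → proj₂ (walk i s)) (upTo h)) (cong proj₂ e) (∈-map⁺ (λ i → proj₂ (walk i s)) (∈-upTo⁺ le))))

    length-near : ∀ h → length (near h) ≡ cnt isB (allFin n) + sumOver (deg G) (sel isB (allFin n)) * h
    length-near h = trans (length-++ (sel isB (allFin n))) (cong₂ _+_ (length-sel isB (allFin n))
      (trans (length-concatMap _ halfEdges) (trans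
        (sumOver-cong halfEdges λ s → trans (length-map (λ i → proj₂ (walk i s)) (upTo h)) (length-upTo h))
        (trans (sumOver-const h halfEdges) (cong (_* h) (trans (length-concatMap _ (sel isB (allFin n)))
          (sumOver-cong (sel isB (allFin n)) λ b → trans (length-map (b ,_) (nbrs G b)) (length-nbrs G b))))))))

module _ {n} (G : Graph n) (As : List (Fin n)) (uAs : Unique As)
  (closed : ∀ {u v} → adj G u v ≡ true → u ∈ As) (minDeg : ∀ {u} → u ∈ As → 2 ≤ deg G u)
  (ℓ : ℕ) (sparse : degSum G ≤ 2 * length As + 2 * ℓ) where

  -- On `As` the truncated difference is exact by `minDeg`, so each live vertex accounts for 2 of
  -- the degree sum besides its excess.
  excess-bound : sumOver (λ v → deg G v ∸ 2) (allFin n) ≤ 2 * ℓ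
  excess-bound = linear 0 (+-mono-≤ (+-mono-≤ total sparse) (*-monoʳ-≤ 2 alive))
    (arith (sumOver (λ v → deg G v ∸ 2) (allFin n)) (cnt (mem As) (allFin n)) (degSum G) (length As) ℓ)
    where
    alive : length As ≤ cnt (mem As) (allFin n)
    alive = ≤-trans (⊆-length uAs λ {x} i → sel⁺ {p = mem As} (∈-all x) (mem⁺ i)) (≤-reflexive (length-sel (mem As) (allFin n)))
    pointwise : ∀ v → (deg G v ∸ 2) + 2 * (if mem As v then 1 else 0) ≤ deg G v
    pointwise v with v ∈? As
    ... | yes i = ≤-reflexive (m∸n+n≡m (minDeg i))
    ... | no _ = ≤-trans (≤-reflexive (+-identityʳ _)) (m∸n≤m (deg G v) 2)
    total : sumOver (λ v → deg G v ∸ 2) (allFin n) + 2 * cnt (mem As) (allFin n) ≤ degSum G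
    total = ≤-trans (≤-reflexive (trans (cong (sumOver (λ v → deg G v ∸ 2) (allFin n) +_) (≡-sym (sumOver-* 2 _ (allFin n))))
              (≡-sym (sumOver-+ _ _ (allFin n))))) (sumOver-mono (allFin n) λ {v} _ → pointwise v)
    arith : ∀ x c g a l → x + (g + (2 * a + 2 * l) + 2 * c) + 0 ≡ 2 * l + (x + 2 * c + g + 2 * a)
    arith = solve-∀

  -- Every live vertex has a simple path to B. If all these paths have at most `h` vertices before
  -- B, then `As` is contained in `near h`; a longer one consists of vertices of degree at most 2
  -- and is the suspended path wanted.
  suspended⊎small : ∀ {v₀} → v₀ ∈ As → (∀ {u v} → u ∈ As → v ∈ As → Reachable G u v) → ∀ h →
    (length As ≤ 2 * ℓ + 1 + (6 * ℓ + 2) * h) ⊎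
    (Σ (List (Fin n)) λ us → Unique us × Linked (λ u w → adj G u w ≡ true) us × (∀ {u} → u ∈ us → deg G u ≤ 2 × u ∈ As) ×
      h < length us)
  suspended⊎small {v₀} v₀∈ conn h = [ (λ all-near → inj₁ (bound all-near)) , inj₂ ]′ (∃⊎∀ As test)
    where
    isB : Fin n → Bool
    -- A cycle has no vertex of degree 3, so `v₀` is added to keep B non-empty. It costs the 1 in 2ℓ
    -- + 1 and the 2 in 6ℓ + 2.
    isB v = (2 <ᵇ deg G v) ∨ (v₀ == v)
    deg≤2 : ∀ {v} → isB v ≡ false → deg G v ≤ 2
    deg≤2 {v} e = ≮⇒≥ λ lt → true≢false (cong (_∨ (v₀ == v)) (<ᵇ-true lt)) e
    open Suspended G isB
    open Walk deg≤2
    v₀-B : isB v₀ ≡ true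
    v₀-B rewrite ==-refl v₀ = Boolₚ.∨-zeroʳ (2 <ᵇ deg G v₀)
    test : ∀ v → v ∈ As → v ∈ near h ⊎
      (Σ (List (Fin n)) λ us → Unique us × Linked (λ u w → adj G u w ≡ true) us × (∀ {u} → u ∈ us → deg G u ≤ 2 × u ∈ As) ×
        h < length us)
    test v i with us , p ← pathToB (conn i v₀∈) v₀-B with length us ≤? h
    ... | yes le = inj₁ (path-near h p le)
    ... | no gt = inj₂ (us , path-Unique p , path-linked p ,
                    (λ j → let e , _ , a = path-∉B p j in deg≤2 e , closed a) , ≰⇒> gt)
    countB : cnt isB (allFin n) ≤ 2 * ℓ + 1
    countB = ≤-trans (sumOver-mono (allFin n) λ {v} _ → pointwise (deg G v) (v₀ == v))
      (≤-trans (≤-reflexive (sumOver-+ _ _ (allFin n)))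
        (+-mono-≤ excess-bound (≤-reflexive (cnt-single v₀ (∈-all v₀) Unique-all))))
      where
      pointwise : ∀ d b → (if (2 <ᵇ d) ∨ b then 1 else 0) ≤ (d ∸ 2) + (if b then 1 else 0)
      pointwise (suc (suc (suc d))) b = s≤s z≤n
      pointwise zero b = ≤-refl
      pointwise (suc zero) b = ≤-refl
      pointwise (suc (suc zero)) b = ≤-refl
    -- A degree d ≥ 3 is at most 3(d - 2), and the excesses sum to at most 2ℓ; a `v₀` of degree 2
    -- contributes its own 2.
    degB : sumOver (deg G) (sel isB (allFin n)) ≤ 6 * ℓ + 2
    degB = ≤-trans (≤-reflexive (sumOver-sel isB (deg G) (allFin n)))
      (≤-trans (sumOver-mono (allFin n) λ {v} _ → pointwise (deg G v) (v₀ == v))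
        (≤-trans (≤-reflexive (trans (sumOver-+ _ _ (allFin n)) (cong₂ _+_ (sumOver-* 3 _ (allFin n)) (sumOver-* 2 _ (allFin n)))))
          (+-mono-≤ (≤-trans (*-monoʳ-≤ 3 excess-bound) (≤-reflexive (arith ℓ)))
            (≤-reflexive (cong (2 *_) (cnt-single v₀ (∈-all v₀) Unique-all))))))
      where
      arith : ∀ l → 3 * (2 * l) ≡ 6 * l
      arith = solve-∀
      arith′ : ∀ d → 3 * suc d ≡ suc (suc (suc d)) + 2 * d
      arith′ = solve-∀
      pointwise : ∀ d b → (if (2 <ᵇ d) ∨ b then d else 0) ≤ 3 * (d ∸ 2) + 2 * (if b then 1 else 0)
      pointwise (suc (suc (suc d))) b = ≤-trans (m≤m+n _ (2 * d)) (≤-trans (≤-reflexive (≡-sym (arith′ d))) (m≤m+n _ _))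
      pointwise zero b = subst (_≤ 2 * (if b then 1 else 0)) (zero-if b) z≤n
        where
        zero-if : ∀ b → 0 ≡ (if b then 0 else 0)
        zero-if true = refl
        zero-if false = refl
      pointwise (suc zero) true = s≤s z≤n
      pointwise (suc zero) false = z≤n
      pointwise (suc (suc zero)) true = ≤-refl
      pointwise (suc (suc zero)) false = z≤n
    bound : (∀ v → v ∈ As → v ∈ near h) → length As ≤ 2 * ℓ + 1 + (6 * ℓ + 2) * h
    bound all-near = ≤-trans (⊆-length uAs (λ {v} → all-near v)) (≤-trans (≤-reflexive (length-near h))
      (+-mono-≤ countB (*-monoˡ-≤ h degB)))

-- The first red clique

argmax : ∀ {A : Set} (g : A → ℕ) x xs → Σ A λ y → y ∈ x ∷ xs × (∀ {z} → z ∈ x ∷ xs → g z ≤ g y)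
argmax g x [] = x , here refl , λ { (here refl) → ≤-refl }
argmax g x (x′ ∷ xs) with y , i , h ← argmax g x′ xs with g x ≤? g y
... | yes le = y , there i , λ { (here refl) → le ; (there j) → h j }
... | no gt = x , here refl , λ { (here refl) → ≤-refl ; (there j) → ≤-trans (h j) (<⇒≤ (≰⇒> gt)) }

Triple-∈ : ∀ {A : Set} {p a s : A} {xs} → Triple p a s xs → a ∈ xs
Triple-∈ here = there (here refl)
Triple-∈ (there t) = there (Triple-∈ t)

Triple-≢ : ∀ {A : Set} {p a s : A} {xs} → Unique xs → Triple p a s xs → p ≢ s
Triple-≢ u here refl = Unique-head u (there (here refl))
Triple-≢ u (there t) = Triple-≢ (Unique-tail u) t

module Ambient {N : ℕ} (c : Colouring N) (c-sym : SymmetricColouring c) (k : ℕ) (W : List (Fin N))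
  (uW : Unique W) (ff : Host.Fan.FanFree c c-sym k W) (y₀ : Fin N) (y₀∈W : y₀ ∈ W) where
  open Host c c-sym
  open Fan k

  Embeds : ∀ {n} → Graph n → List (Fin n) → Set
  Embeds {n} G As = Σ (Fin n → Fin N) λ f → Emb G As f × (∀ {u} → u ∈ As → f u ∈ W)

  -- Let d be the largest blue degree in `W` and `Q` the clique in that blue neighbourhood. If `Q`
  -- cannot hold all of `As`, then d < b + 2k. If d ≤ 4k, plain greedy works by `room₁`. Otherwise
  -- `v` is high when (deg v - 2)d > 4ℓ. The excesses sum to at most 2ℓ, so at most d/2 vertices are
  -- high, and `Q` can hold them since d > 4k. Every other vertex has deg v · d ≤ 2d + 4ℓ, which
  -- `room₂` accommodates.
  embed-small : ∀ {n} (G : Graph n) (As : List (Fin n)) → Unique As → (∀ {u v} → adj G u v ≡ true → u ∈ As) →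
    ∀ ℓ → sumOver (λ v → deg G v ∸ 2) (allFin n) ≤ 2 * ℓ →
    length As * (4 * k) + length As ≤ length W → 3 * length As + 4 * k + 4 * ℓ ≤ length W → Embeds G As
  embed-small {n} G As uAs closed ℓ excess room₁ room₂ = cases (clique-at y∈W)
    where
    b = length As
    bd : Fin N → ℕ
    bd y = cnt (blue y) W
    maximum : ∀ W → y₀ ∈ W → Σ (Fin N) λ y → y ∈ W × (∀ {z} → z ∈ W → cnt (blue z) W ≤ cnt (blue y) W)
    maximum (w ∷ W) _ = argmax (λ y → cnt (blue y) (w ∷ W)) w W
    y = proj₁ (maximum W y₀∈W)
    y∈W : y ∈ W
    y∈W = proj₁ (proj₂ (maximum W y₀∈W))
    bd≤ : ∀ {z} → z ∈ W → bd z ≤ bd y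
    bd≤ = proj₂ (proj₂ (maximum W y₀∈W))
    clique-at : y ∈ W → LargeClique (sel (blue y) W) k
    clique-at i = blue-nbhd-clique ff i (sel-Unique (blue y) uW) (proj₁ ∘ sel⁻ {p = blue y})
      λ j → let e , ne = blue⁻ (proj₂ (sel⁻ {p = blue y} {xs = W} j)) in (λ p → ne (≡-sym p)) , e
    deg≤b : ∀ v → deg G v ≤ b
    deg≤b v = cnt≤ Unique-all λ _ e → closed (adj-sym G e)
    d = bd y
    hi : Fin n → Bool
    hi v = 4 * ℓ <ᵇ (deg G v ∸ 2) * d
    Hi = sel hi (allFin n)
    hi⁻ : ∀ {v} → v ∈ Hi → 4 * ℓ < (deg G v ∸ 2) * d
    hi⁻ {v} i = <ᵇ-true⁻ {4 * ℓ} {(deg G v ∸ 2) * d} (proj₂ (sel⁻ {p = hi} {xs = allFin n} i))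
    Hi⊆ : ∀ {v} → v ∈ Hi → v ∈ As
    Hi⊆ {v} i with deg G v in eq | hi⁻ i
    ... | zero | ()
    ... | suc m | _ with x , _ , e , _ ← pick-cnt {p = adj G v} [] Unique-all (subst (0 <_) (≡-sym eq) (s≤s z≤n)) = closed e
    Hi-weight : length Hi * suc (4 * ℓ) ≤ 2 * ℓ * d
    Hi-weight = begin
      length Hi * suc (4 * ℓ) ≡⟨ sumOver-const (suc (4 * ℓ)) Hi ⟨
      sumOver (λ _ → suc (4 * ℓ)) Hi ≤⟨ sumOver-mono Hi hi⁻ ⟩
      sumOver (λ v → (deg G v ∸ 2) * d) Hi ≡⟨ sumOver-sel hi _ (allFin n) ⟩
      sumOver (λ v → if hi v then (deg G v ∸ 2) * d else 0) (allFin n)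
        ≤⟨ sumOver-mono (allFin n) (λ {v} _ → drop-if (hi v)) ⟩
      sumOver (λ v → (deg G v ∸ 2) * d) (allFin n)
        ≡⟨ trans (sumOver-cong (allFin n) λ v → *-comm (deg G v ∸ 2) d) (sumOver-* d _ (allFin n)) ⟩
      d * sumOver (λ v → deg G v ∸ 2) (allFin n) ≤⟨ *-monoʳ-≤ d excess ⟩
      d * (2 * ℓ) ≡⟨ *-comm d (2 * ℓ) ⟩
      2 * ℓ * d ∎
      where
      open ≤-Reasoning
      drop-if : ∀ β {m} → (if β then m else 0) ≤ m
      drop-if true = ≤-refl
      drop-if false = z≤n
    Hi-few : 2 * length Hi ≤ d
    Hi-few = ≮⇒≥ λ lt → <-irrefl refl (linear {l = 1} {r = 0} (d + 4 * ℓ)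
      (+-mono-≤ (*-monoˡ-≤ (suc (4 * ℓ)) lt) (*-monoʳ-≤ 2 Hi-weight)) (arith (length Hi) d ℓ))
      where
      arith : ∀ h d l → 1 + (2 * h * suc (4 * l) + 2 * (2 * l * d)) + (d + 4 * l) ≡ 0 + (suc d * suc (4 * l) + 2 * (h * suc (4 * l)))
      arith = solve-∀
    low-degree : ∀ {v} → v ∉ Hi → deg G v * d ≤ 2 * d + 4 * ℓ
    low-degree {v} v∉ = ≤-trans (*-monoˡ-≤ d (m≤n+m∸n (deg G v) 2)) (≤-trans (≤-reflexive (*-distribʳ-+ d 2 (deg G v ∸ 2)))
      (+-monoʳ-≤ (2 * d) (≮⇒≥ λ lt → v∉ (sel⁺ {p = hi} (∈-all v) (<ᵇ-true lt)))))
    cases : LargeClique (sel (blue y) W) k → Embeds G As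
    cases (Q , uQ , Q⊆ , rcl , len) with b + 2 * k ≤? d + 2
    ... | yes le = let f , E , f∈ = place-in-clique y₀ rcl uQ uAs b≤Q in f , E , proj₁ ∘ sel⁻ {p = blue y} ∘ Q⊆ ∘ f∈
      where
      arith : ∀ b k d q → b + (d + 2 + (q + 2 * k)) + 0 ≡ q + (b + 2 * k + (d + 2))
      arith = solve-∀
      b≤Q : b ≤ length Q
      b≤Q = linear 0 (+-mono-≤ le (≤-trans (≤-reflexive (cong (_+ 2) (≡-sym (length-sel (blue y) W)))) len)) (arith b k d (length Q))
    ... | no gt with d ≤? 4 * k
    ...   | yes small =
      let f , qs , E , _ , sub , f∈ = greedy {G = G} uW bd≤ As (Emb-[] (λ _ → y₀)) [] (λ ()) uAs (λ _ ())
            (λ {v} _ → ≤-trans (+-monoˡ-≤ b (*-mono-≤ (deg≤b v) small)) room₁)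
      in f , Emb-⊆ sub E , f∈ ∘ sub
    ...   | no large =
      let f , E , f∈ = place-in-clique y₀ rcl uQ (sel-Unique hi Unique-all) Hi≤Q
          f′ , qs , E′ , sub , sub′ , f′∈ = greedy {G = G} uW bd≤ (As ∖ Hi) E (sel-Unique hi Unique-all)
            (proj₁ ∘ sel⁻ {p = blue y} ∘ Q⊆ ∘ f∈) (∖-Unique Hi uAs) (proj₂ ∘ ∖⁻ As)
            (λ {v} i → budget (proj₂ (∖⁻ As i)))
          covers : ∀ {v} → v ∈ As → v ∈ qs
          covers {v} i = [ sub , (λ v∉ → sub′ (∖⁺ i v∉)) ]′ (split v)
      in f′ , Emb-⊆ covers E′ , f′∈ ∘ covers
      where
      split : ∀ v → v ∈ Hi ⊎ v ∉ Hi
      split v with v ∈? Hi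
      ... | yes i = inj₁ i
      ... | no i = inj₂ i
      arith : ∀ h q d k → 2 * h + (d + (d + (2 * (q + 2 * k)))) + 5 ≡ 2 * q + (2 * h + (suc (4 * k) + 2 * (d + 2)))
      arith = solve-∀
      Hi≤Q : length Hi ≤ length Q
      Hi≤Q = *-cancelˡ-≤ 2 (linear 5 (+-mono-≤ Hi-few (+-mono-≤ (≰⇒> large)
        (*-monoʳ-≤ 2 (≤-trans (≤-reflexive (cong (_+ 2) (≡-sym (length-sel (blue y) W)))) len)))) (arith (length Hi) (length Q) d k))
      arith′ : ∀ x d l b h r k w → x + (h + r) + ((2 * d + 4 * l) + (b + (2 * (b + 2 * k) + w))) + 6 ≡
        w + (x + ((r + h) + (2 * suc (d + 2) + (3 * b + 4 * k + 4 * l))))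
      arith′ = solve-∀
      budget : ∀ {v} → v ∉ Hi → deg G v * d + (length Hi + length (As ∖ Hi)) ≤ length W
      budget {v} v∉ = linear 6 (+-mono-≤ (low-degree v∉) (+-mono-≤ (∖-length′ uAs (sel-Unique hi Unique-all) Hi⊆)
        (+-mono-≤ (*-monoʳ-≤ 2 (≰⇒> gt)) room₂))) (arith′ (deg G v * d) d ℓ b (length Hi) (length (As ∖ Hi)) k (length W))

-- Undoing leaf deletions and path contractions

module Reduction {N : ℕ} (c : Colouring N) (c-sym : SymmetricColouring c) (k : ℕ) (W : List (Fin N))
  (uW : Unique W) (ff : Host.Fan.FanFree c c-sym k W) (y₀ : Fin N) (y₀∈W : y₀ ∈ W)
  {n : ℕ} (ℓ b : ℕ) (b≡ : b ≡ 2 * ℓ + 1 + (6 * ℓ + 2) * (4 * k * k + 2))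
  (room₁ : b * (4 * k) + b ≤ length W) (room₂ : 3 * b + 4 * k + 4 * ℓ ≤ length W) where
  open Host c c-sym
  open Fan k
  open Ambient c c-sym k W uW ff y₀ y₀∈W

  -- A step that cannot be undone has used at most n - 1 vertices of `W`, and the others form a red
  -- clique up to 2(k - 1) of them: |Q| ≥ |W| - (n - 1) - 2(k - 1).
  BigClique : Set
  BigClique = Σ (List (Fin N)) λ Q → Unique Q × (∀ {x} → x ∈ Q → x ∈ W) × RedClique Q ×
    length W + 3 ≤ length Q + 2 * k + n

  big-clique : ∀ {Bs : List (Fin n)} {f} → length Bs < n → LargeClique (W ∖ map f Bs) k → BigClique
  big-clique {Bs} {f} lt (Q , uQ , Q⊆ , rcl , len) = Q , uQ , proj₁ ∘ ∖⁻ W ∘ Q⊆ , rcl ,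
    linear 0 (+-mono-≤ len (+-mono-≤ (≤-trans (∖-length (map f Bs) uW) (≤-reflexive (cong (length (W ∖ map f Bs) +_) (length-map f Bs)))) lt))
      (arith (length W) (length (W ∖ map f Bs)) (length Q) k n (length Bs))
    where
    arith : ∀ w o q k n m → w + 3 + (q + 2 * k + (o + m + n)) + 0 ≡ q + 2 * k + n + (o + 2 + (w + suc m))
    arith = solve-∀

  -- `sparse` holds with one fixed ℓ throughout: deleting a leaf removes a vertex and an edge, and a
  -- contraction removes a vertex and two edges and adds at most one edge.
  record Reduced (G : Graph n) (As : List (Fin n)) (m : ℕ) : Set where
    field
      unique : Unique As
      size : length As ≡ m
      closed : ∀ {u v} → adj G u v ≡ true → u ∈ As
      connected : ∀ {u v} → u ∈ As → v ∈ As → Reachable G u v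
      sparse : degSum G ≤ 2 * m + 2 * ℓ
  open Reduced

  size-∖ : ∀ {As : List (Fin n)} {v m} → Unique As → length As ≡ suc m → v ∈ As → length (As ∖ (v ∷ [])) ≡ m
  size-∖ {As} {v} u e i = suc-injective (trans (≡-sym (+-comm (length (As ∖ (v ∷ []))) 1)) (trans (≤-antisym
    (∖-length′ {ys = v ∷ []} u ([] ∷ []) λ { (here refl) → i })
    (∖-length (v ∷ []) u)) e))

  ∉[]⇒≢ : ∀ {u v : Fin n} → u ∉ v ∷ [] → u ≢ v
  ∉[]⇒≢ u∉ e = u∉ (here e)

  ≢⇒∉[] : ∀ {u v : Fin n} → u ≢ v → u ∉ v ∷ []
  ≢⇒∉[] ne (here e) = ne e

  delete-leaf : ∀ {G As m v p} → Reduced G As (suc m) → v ∈ As → deg G v ≤ 1 → adj G v p ≡ true →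
    Reduced (delete G v) (As ∖ (v ∷ [])) m
  delete-leaf {G} {As} {m} {v} {p} R v∈ d1 vp = record
    { unique = ∖-Unique (v ∷ []) (unique R)
    ; size = size-∖ (unique R) (size R) v∈
    ; closed = λ e → let e′ , ne = delete⁻ G e in ∖⁺ (closed R e′) (≢⇒∉[] ne)
    ; connected = λ i j →
        let i′ , u≢ = ∖⁻ As i ; j′ , w≢ = ∖⁻ As j
        in proj₁ (reroute {G = G} {delete G v} {v} {p} (delete⁺ G)
             (λ e → subst (λ x → Reachable (delete G v) x p) (≡-sym (one-neighbour G d1 vp (adj-sym G e))) here)
             (λ e → subst (Reachable (delete G v) p) (≡-sym (one-neighbour G d1 vp e)) here)
             (connected R i′ j′) (∉[]⇒≢ w≢)) (∉[]⇒≢ u≢)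
    ; sparse = linear 0 (+-mono-≤ (degSum-delete G v) (+-mono-≤ (sparse R) (*-monoʳ-≤ 2 d≥1)))
        (arith (degSum (delete G v)) (deg G v) (degSum G) m ℓ)
    }
    where
    d≥1 : 1 ≤ deg G v
    d≥1 = subst (1 ≤_) (length-nbrs G v) (⊆-length {xs = p ∷ []} ([] ∷ []) λ { (here refl) → nbrs⁺ G vp })
    arith : ∀ d e g m l → d + (g + (2 * suc m + 2 * l + 2 * e)) + 0 ≡ 2 * m + 2 * l + (d + 2 * e + (g + 2 * 1))
    arith = solve-∀

  attach-leaf : ∀ {G As m v p} → Reduced G As (suc m) → suc m ≤ n → v ∈ As → deg G v ≤ 1 → adj G v p ≡ true →
    Embeds (delete G v) (As ∖ (v ∷ [])) → Embeds G As ⊎ BigClique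
  attach-leaf {G} {As} {m} {v} {p} R m<n v∈ d1 vp (f , E , f∈) =
    [ (λ all-blue → inj₂ (big-clique {f = f} (subst (_< n) (≡-sym (size-∖ (unique R) (size R) v∈)) m<n)
        (blue-nbhd-clique ff (f∈ p∈) (∖-Unique (map f Bs) uW) (proj₁ ∘ ∖⁻ W)
          λ {x} i → (λ e → proj₂ (∖⁻ W i) (subst (_∈ map f Bs) (≡-sym e) (∈-map⁺ f p∈))) , all-blue x i))) , inj₁ ]′
    (∃⊎∀ {P = λ y → c (f p) y ≡ false} (W ∖ map f Bs) test)
    where
    Bs = As ∖ (v ∷ [])
    p≢v : p ≢ v
    p≢v e = adj-≢ G vp (≡-sym e)
    p∈ : p ∈ Bs
    p∈ = ∖⁺ (closed R (adj-sym G vp)) (≢⇒∉[] p≢v)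
    Bs≢ : ∀ {u} → u ∈ Bs → u ≢ v
    Bs≢ i = ∉[]⇒≢ (proj₂ (∖⁻ As i))
    E′ : Emb G Bs f
    E′ = record { inj = inj E ; hom = λ i j e → hom E i j (delete⁺ G (Bs≢ i) (Bs≢ j) e) }
    v∉ : v ∉ Bs
    v∉ i = Bs≢ i refl
    test : ∀ y → y ∈ W ∖ map f Bs → c (f p) y ≡ false ⊎ Embeds G As
    test y i with c (f p) y in eq
    ... | false = inj₁ refl
    ... | true = inj₂ (upd f v y , Emb-⊆ sub (extend E′ v∉ fresh red) , λ j → in-W (sub j))
      where
      fresh : ∀ {u} → u ∈ Bs → f u ≢ y
      fresh j e = proj₂ (∖⁻ W i) (subst (_∈ map f Bs) e (∈-map⁺ f j))
      red : ∀ {u} → u ∈ Bs → adj G u v ≡ true → c (f u) y ≡ true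
      red j e = subst (λ u → c (f u) y ≡ true) (≡-sym (one-neighbour G d1 vp (adj-sym G e))) eq
      sub : ∀ {u} → u ∈ As → u ∈ v ∷ Bs
      sub {u} j with u ≟ v
      ... | yes e = here e
      ... | no ne = there (∖⁺ j (≢⇒∉[] ne))
      in-W : ∀ {u} → u ∈ v ∷ Bs → upd f v y u ∈ W
      in-W (here refl) rewrite upd-same f v y = proj₁ (∖⁻ W i)
      in-W (there j) rewrite upd-on f y v∉ j = f∈ j

  module Contract {G : Graph n} {As : List (Fin n)} {m : ℕ} (R : Reduced G As (suc m)) (m<n : suc m ≤ n)
    {w₀ w₁ w₂ : Fin n} {ws : List (Fin n)} (uq : Unique (w₀ ∷ w₁ ∷ w₂ ∷ ws))
    (linked : Linked (λ u w → adj G u w ≡ true) (w₀ ∷ w₁ ∷ w₂ ∷ ws))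
    (deg2 : ∀ {u} → u ∈ w₀ ∷ w₁ ∷ w₂ ∷ ws → deg G u ≤ 2 × u ∈ As) (w₁-deg : 2 ≤ deg G w₁) where

    w₀≢w₂ : w₀ ≢ w₂
    w₀≢w₂ refl = Unique-head uq (there (here refl))

    H : Graph n
    H = addEdge (delete G w₁) w₀ w₂ w₀≢w₂

    Bs : List (Fin n)
    Bs = As ∖ (w₁ ∷ [])

    w₁∉ : w₁ ∉ w₀ ∷ w₂ ∷ ws
    w₁∉ (here refl) = Unique-head uq (here refl)
    w₁∉ (there i) = Unique-head (Unique-tail uq) i

    skip : ∀ {u} → u ∈ w₀ ∷ w₂ ∷ ws → u ∈ As
    skip (here e) = proj₂ (deg2 (here e))
    skip (there i) = proj₂ (deg2 (there (there i)))

    ends∈ : ∀ {u} → u ∈ w₀ ∷ w₂ ∷ ws → u ∈ Bs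
    ends∈ i = ∖⁺ (skip i) (≢⇒∉[] λ { refl → w₁∉ i })

    keep : ∀ {u v} → u ≢ w₁ → v ≢ w₁ → adj G u v ≡ true → adj H u v ≡ true
    keep nu nv e = addEdge⁺ (delete G w₁) w₀≢w₂ (delete⁺ G nu nv e)

    interior : ∀ {p a s} → Triple p a s (w₀ ∷ w₁ ∷ w₂ ∷ ws) → ∀ {b} → adj G a b ≡ true → b ≡ p ⊎ b ≡ s
    interior t = let pa , as = Triple-linked t linked in
      two-neighbours G (proj₁ (deg2 (Triple-∈ t))) (adj-sym G pa) as (Triple-≢ uq t)

    new-edge : Reachable H w₀ w₂
    new-edge = step (addEdge-new (delete G w₁) w₀≢w₂) here

    new-edge′ : Reachable H w₂ w₀
    new-edge′ = step (adj-sym H (addEdge-new (delete G w₁) w₀≢w₂)) here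

    reduced : Reduced H Bs m
    reduced = record
      { unique = ∖-Unique (w₁ ∷ []) (unique R)
      ; size = size-∖ (unique R) (size R) (proj₂ (deg2 (there (here refl))))
      ; closed = λ e → [ (λ e′ → let e″ , ne = delete⁻ G e′ in ∖⁺ (closed R e″) (≢⇒∉[] ne)) ,
                         [ (λ { refl → ends∈ (here refl) }) , (λ { refl → ends∈ (there (here refl)) }) ]′ ]′
                         (addEdge⁻ (delete G w₁) w₀≢w₂ e)
      ; connected = λ i j →
          let i′ , u≢ = ∖⁻ As i ; j′ , w≢ = ∖⁻ As j
          in proj₁ (reroute {G = G} {H} {w₁} {w₀} keep
               (λ e → [ (λ { refl → here }) , (λ { refl → new-edge′ }) ]′ (interior here (adj-sym G e)))
               (λ e → [ (λ { refl → here }) , (λ { refl → new-edge }) ]′ (interior here e))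
               (connected R i′ j′) (∉[]⇒≢ w≢)) (∉[]⇒≢ u≢)
      ; sparse = linear 0 (+-mono-≤ (degSum-addEdge (delete G w₁) w₀≢w₂) (+-mono-≤ (degSum-delete G w₁)
          (+-mono-≤ (sparse R) (*-monoʳ-≤ 2 w₁-deg))))
          (arith (degSum H) (degSum (delete G w₁)) (deg G w₁) (degSum G) m ℓ)
      }
      where
      arith : ∀ h d e g m l → h + (d + 2 + (g + (2 * suc m + 2 * l + 2 * e))) + 0 ≡
        2 * m + 2 * l + (h + (d + 2 * e + (g + 2 * 2)))
      arith = solve-∀

    expand : 4 * k * k < length (w₂ ∷ ws) → Embeds H Bs → Embeds G As ⊎ BigClique
    expand long (f , E , f∈) =
      [ inj₁ , (λ q → inj₂ (big-clique {f = f} (subst (_< n) (≡-sym (size reduced)) m<n) q)) ]′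
      (Lengthen.lengthen c c-sym {G = G} {H} {As} {Bs} uq interior (λ i ne → ∖⁺ i (≢⇒∉[] ne)) keep skip E
        k uW ff f∈ linked′ long)
      where
      linked-H : ∀ u us → w₁ ∉ u ∷ us → Linked (λ u w → adj G u w ≡ true) (u ∷ us) → Linked (λ u w → adj H u w ≡ true) (u ∷ us)
      linked-H u [] _ _ = [-]
      linked-H u (v ∷ us) ∉us (e ∷ l) =
        keep (λ { refl → ∉us (here refl) }) (λ { refl → ∉us (there (here refl)) }) e ∷ linked-H v us (∉us ∘ there) l
      linked′ : Linked (λ u w → adj H u w ≡ true) (w₀ ∷ w₂ ∷ ws)
      linked′ = addEdge-new (delete G w₁) w₀≢w₂ ∷ linked-H w₂ ws (w₁∉ ∘ there) (tail (tail linked))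

  -- Leaves are treated before paths, so that minimum degree 2 is available when suspended paths are
  -- sought; a live part with neither a leaf nor a long suspended path is small enough for
  -- `embed-small`. The bound m ≤ n ensures that a failed step has used fewer than n vertices.
  embed⊎clique : ∀ m G As → Reduced G As m → m ≤ n → Embeds G As ⊎ BigClique
  embed⊎clique zero G [] R m≤n = inj₁ ((λ _ → y₀) , Emb-[] _ , λ ())
  embed⊎clique zero G (_ ∷ _) R m≤n with () ← size R
  embed⊎clique (suc m) G As R m<n = [ no-leaf , (λ (v , i , d1) → leaf v i d1) ]′ (∃⊎∀ {P = λ v → 2 ≤ deg G v} As test)
    where
    test : ∀ v → v ∈ As → 2 ≤ deg G v ⊎ (Σ (Fin n) λ v → v ∈ As × deg G v ≤ 1)
    test v i with 2 ≤? deg G v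
    ... | yes le = inj₁ le
    ... | no gt = inj₂ (v , i , ≤-pred (≰⇒> gt))
    single : ∀ {As : List (Fin n)} {u v} → length As ≤ 1 → u ∈ As → v ∈ As → u ≡ v
    single {_ ∷ []} _ (here refl) (here refl) = refl
    single {_ ∷ _ ∷ _} (s≤s ()) _ _
    leaf : ∀ v → v ∈ As → deg G v ≤ 1 → Embeds G As ⊎ BigClique
    leaf v i d1 with length As ≤? 1
    ... | yes le = inj₁ ((λ _ → y₀) , record
            { inj = λ i j _ → single le i j ; hom = λ i j e → ⊥-elim (adj-≢ G e (single le i j)) } , λ _ → y₀∈W)
    ... | no gt with u , j , u∉ ← pick (v ∷ []) (unique R) (≰⇒> gt) with connected R i j
    ...   | here = ⊥-elim (u∉ (here refl))
    ...   | step {v = p} vp _ with embed⊎clique m (delete G v) (As ∖ (v ∷ [])) (delete-leaf R i d1 vp) (<⇒≤ m<n)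
    ...     | inj₂ q = inj₂ q
    ...     | inj₁ emb = attach-leaf R m<n i d1 vp emb
    first : ∀ {As : List (Fin n)} → length As ≡ suc m → Σ (Fin n) (_∈ As)
    first {v ∷ _} _ = v , here refl
    suspended : ∀ us → Unique us → Linked (λ u w → adj G u w ≡ true) us → (∀ {u} → u ∈ us → deg G u ≤ 2 × u ∈ As) →
      4 * k * k + 2 < length us → (∀ v → v ∈ As → 2 ≤ deg G v) → Embeds G As ⊎ BigClique
    suspended (w₀ ∷ w₁ ∷ w₂ ∷ ws) uq linked deg2 long minDeg
      with embed⊎clique m (Contract.H R m<n uq linked deg2 (minDeg _ (proj₂ (deg2 (there (here refl)))))) _
             (Contract.reduced R m<n uq linked deg2 (minDeg _ (proj₂ (deg2 (there (here refl)))))) (<⇒≤ m<n)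
    ... | inj₂ q = inj₂ q
    ... | inj₁ emb = Contract.expand R m<n uq linked deg2 (minDeg _ (proj₂ (deg2 (there (here refl)))))
            (+-cancelʳ-≤ 2 _ _ (≤-trans long (≤-reflexive (+-comm 2 (length (w₂ ∷ ws)))))) emb
    suspended [] _ _ _ () _
    suspended (_ ∷ []) _ _ _ long _ = ⊥-elim (<⇒≱ long (≤-trans (s≤s z≤n) (m≤n+m 2 (4 * k * k))))
    suspended (_ ∷ _ ∷ []) _ _ _ long _ = ⊥-elim (<⇒≱ long (m≤n+m 2 (4 * k * k)))
    no-leaf : (∀ v → v ∈ As → 2 ≤ deg G v) → Embeds G As ⊎ BigClique
    -- The 2 beyond 4k² pays for `w₀` and `w₁`, since `lengthen` asks for more than 4k² vertices
    -- from `w₂` on.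
    no-leaf minDeg with suspended⊎small G As (unique R) (closed R) (λ {u} → minDeg u) ℓ
                          (subst (λ s → degSum G ≤ 2 * s + 2 * ℓ) (≡-sym (size R)) (sparse R))
                          (proj₂ (first (size R))) (connected R) (4 * k * k + 2)
    ... | inj₂ (us , uq , linked , deg2 , long) = suspended us uq linked deg2 long minDeg
    ... | inj₁ small = inj₁ (embed-small G As (unique R) (closed R) ℓ
            (excess-bound G As (unique R) (closed R) (λ {u} → minDeg u) ℓ
              (subst (λ s → degSum G ≤ 2 * s + 2 * ℓ) (≡-sym (size R)) (sparse R)))
            (≤-trans (+-mono-≤ (*-monoˡ-≤ (4 * k) As≤b) As≤b) room₁)
            (≤-trans (+-monoˡ-≤ (4 * ℓ) (+-monoˡ-≤ (4 * k) (*-monoʳ-≤ 3 As≤b))) room₂))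
      where
      As≤b : length As ≤ b
      As≤b = subst (length As ≤_) (≡-sym b≡) small

-- The second red clique

++-split : ∀ {A : Set} (as bs : List A) {xs ys} → length as ≡ length xs → as ++ bs ≡ xs ++ ys → as ≡ xs × bs ≡ ys
++-split [] bs {[]} _ e = refl , e
++-split (a ∷ as) bs {x ∷ xs} len e with e₁ , e₂ ← ∷-injective e
  with e₃ , e₄ ← ++-split as bs {xs} (suc-injective len) e₂ = cong₂ _∷_ e₁ e₃ , e₄

take-⊆ : ∀ {A : Set} m {xs : List A} {x} → x ∈ take m xs → x ∈ xs
take-⊆ (suc m) {_ ∷ xs} (here e) = here e
take-⊆ (suc m) {_ ∷ xs} (there i) = there (take-⊆ m i)

length-take≤ : ∀ {A : Set} m (xs : List A) → m ≤ length xs → length (take m xs) ≡ m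
length-take≤ m xs le = trans (length-take m xs) (m≤n⇒m⊓n≡m le)

-- Every chosen vertex rules out at most `K` members of `S`, itself included.
greedy-independent : ∀ {n} (conf : Fin n → Fin n → Bool) (S : List (Fin n)) → Unique S → ∀ K →
  (∀ {u} → u ∈ S → cnt (conf u) S ≤ K) → (∀ u → conf u u ≡ true) → ∀ m → m * K < length S →
  Σ (List (Fin n)) λ U → length U ≡ m × Unique U × (∀ {u} → u ∈ U → u ∈ S) × AllPairs (λ u v → conf v u ≡ false) U
greedy-independent conf S uS K few rfl zero lt = [] , refl , [] , (λ ()) , []
greedy-independent {n} conf S uS K few rfl (suc m) lt
  with U , len , uU , U⊆ , ap ← greedy-independent conf S uS K few rfl m (≤-trans (s≤s (m≤n+m (m * K) K)) lt)
  = add (pick (concatMap conflicts U) uS bound)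
  where
  conflicts : Fin n → List (Fin n)
  conflicts u = sel (conf u) S
  bound : length (concatMap conflicts U) < length S
  bound = ≤-trans (s≤s (≤-trans (≤-reflexive (length-concatMap conflicts U))
    (≤-trans (sumOver-bound _ K U λ {u} i → ≤-trans (≤-reflexive (length-sel (conf u) S)) (few (U⊆ i)))
      (≤-trans (≤-reflexive (cong (_* K) len)) (m≤n+m (m * K) K))))) lt
  add : (∃ λ x → x ∈ S × x ∉ concatMap conflicts U) →
    Σ (List (Fin n)) λ U → length U ≡ suc m × Unique U × (∀ {u} → u ∈ U → u ∈ S) × AllPairs (λ u v → conf v u ≡ false) U
  add (x , x∈ , x∉) = x ∷ U , cong suc len , Unique-∷ (λ i → true≢false (rfl x) (free i)) uU ,
    (λ { (here refl) → x∈ ; (there i) → U⊆ i }) , All.tabulate free ∷ ap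
    where
    free : ∀ {u} → u ∈ U → conf u x ≡ false
    free {u} i = ¬true⇒false λ e → x∉ (∈-concatMap conflicts i (sel⁺ {p = conf u} x∈ e))

-- For distinct vertices this is distance at least 3, that is, disjoint closed neighbourhoods.
Far : ∀ {n} → Graph n → Fin n → Fin n → Set
Far G u v = adj G v u ≡ false × (∀ {w} → adj G v w ≡ true → adj G u w ≡ true → ⊥)

module Completion {N : ℕ} (c : Colouring N) (c-sym : SymmetricColouring c) (y₀ : Fin N)
  {Q : List (Fin N)} (rcl : Host.RedClique c c-sym Q) (uQ : Unique Q) {n : ℕ} (G : Graph n) where
  open Host c c-sym

  -- All pairs between `X` and `Y` are red, so any bijections from `U` to `X` and from `NU` to `Y`
  -- will do. The vertices of `U` take no place in `Q`, which makes up for the size that `Q` lacks.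
  -- The cases used are leaves with their common neighbour, and an independent set with its whole
  -- neighbourhood.
  complete-common : ∀ {U NU X Y} → Unique U → Unique NU → (∀ {u} → u ∈ U → u ∉ NU) →
    (∀ {u v} → u ∈ U → adj G u v ≡ true → v ∈ NU) → Unique X → Unique Y → length U ≡ length X → length NU ≡ length Y →
    (∀ {x} → x ∈ X → x ∉ Q) → (∀ {y} → y ∈ Y → y ∈ Q) → (∀ {x y} → x ∈ X → y ∈ Y → c x y ≡ true) →
    n ≤ length Q + length U → ContainsCopy c true G
  complete-common {U} {NU} {X} {Y} uU uNU dis nb uX uY lX lY X∩Q Y⊆Q red len =
    complete {G = G} {Q} {ps} {f} rcl uQ uq (record { inj = Unique-map-injective f (subst Unique (≡-sym f-all) uXY) ; hom = hom′ }) closed Y usedY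
      (linear 0 len arith)
    where
    ps = U ++ NU
    uq : Unique ps
    uq = Uniqueₚ.++⁺ uU uNU λ (i , j) → dis i j
    uXY : Unique (X ++ Y)
    uXY = Uniqueₚ.++⁺ uX uY λ (i , j) → X∩Q i (Y⊆Q j)
    f : Fin n → Fin N
    f = assign (λ _ → y₀) ps (X ++ Y)
    f-all : map f ps ≡ X ++ Y
    f-all = assign-map (λ _ → y₀) ps (X ++ Y) uq (trans (length-++ U) (trans (cong₂ _+_ lX lY) (≡-sym (length-++ X))))
    parts = ++-split (map f U) (map f NU) (trans (length-map f U) lX) (trans (≡-sym (map-++ f U NU)) f-all)
    fU : ∀ {u} → u ∈ U → f u ∈ X
    fU {u} i = subst (f u ∈_) (proj₁ parts) (∈-map⁺ f i)
    fNU : ∀ {u} → u ∈ NU → f u ∈ Y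
    fNU {u} i = subst (f u ∈_) (proj₂ parts) (∈-map⁺ f i)
    usedY : ∀ {u} → u ∈ ps → f u ∈ Q → f u ∈ Y
    usedY i q with ∈-++⁻ U i
    ... | inj₁ j = ⊥-elim (X∩Q (fU j) q)
    ... | inj₂ j = fNU j
    closed : ∀ {u} → u ∈ ps → f u ∈ Q ⊎ (∀ {v} → adj G u v ≡ true → v ∈ ps)
    closed i with ∈-++⁻ U i
    ... | inj₁ j = inj₂ λ e → ∈-++⁺ʳ U (nb j e)
    ... | inj₂ j = inj₁ (Y⊆Q (fNU j))
    hom′ : ∀ {u v} → u ∈ ps → v ∈ ps → adj G u v ≡ true → c (f u) (f v) ≡ true
    hom′ {u} {v} i j e with ∈-++⁻ U i | ∈-++⁻ U j
    ... | inj₁ a | inj₁ b = ⊥-elim (dis b (nb a e))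
    ... | inj₁ a | inj₂ b = red (fU a) (fNU b)
    ... | inj₂ a | inj₁ b = trans (c-sym (f u) (f v)) (red (fU b) (fNU a))
    ... | inj₂ a | inj₂ b = rcl (Y⊆Q (fNU a)) (Y⊆Q (fNU b))
            λ e′ → adj-≢ G e (Unique-map-injective f (subst Unique (≡-sym f-all) uXY) i j e′)
    arith : length Y + n + (length Q + length U) + 0 ≡ length Q + length ps + n
    arith rewrite length-++ U {NU} | lY = arith′ (length Y) n (length Q) (length U)
      where
      arith′ : ∀ y n q u → y + n + (q + u) + 0 ≡ q + (u + y) + n
      arith′ = solve-∀

  -- `size` says that every placed vertex outside `us` costs one place in `Q`. `origin` and `target`
  -- show that the next far vertex and its neighbours are still unplaced and that its image is free.
  record Placed (us : List (Fin n)) (xs : List (Fin N)) : Set where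
    field
      ps : List (Fin n)
      f : Fin n → Fin N
      used : List (Fin N)
      emb : Emb G ps f
      unique : Unique ps
      closed : ∀ {u} → u ∈ ps → f u ∈ Q ⊎ (∀ {v} → adj G u v ≡ true → v ∈ ps)
      uses : ∀ {u} → u ∈ ps → f u ∈ Q → f u ∈ used
      size : length ps ≡ length used + length us
      few : length used ≤ 2 * length us
      origin : ∀ {p} → p ∈ ps → p ∈ us ⊎ (Σ (Fin n) λ u → u ∈ us × adj G u p ≡ true)
      target : ∀ {p} → p ∈ ps → f p ∈ Q ⊎ f p ∈ xs

  place-neighbours : ∀ {u x} ns {ps f used} → Emb G ps f → Unique ps → u ∈ ps → f u ≡ x →
    (∀ {p} → p ∈ ps → p ≡ u ⊎ (f p ∈ Q ⊎ (∀ {v} → adj G p v ≡ true → v ∈ ps))) →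
    (∀ {p} → p ∈ ps → f p ∈ Q → f p ∈ used) → Unique ns → (∀ {w} → w ∈ ns → w ∉ ps × adj G u w ≡ true) →
    x ∉ Q → length used + length ns ≤ cnt (c x) Q →
    Σ (List (Fin n)) λ ps′ → Σ (Fin n → Fin N) λ f′ → Σ (List (Fin N)) λ used′ →
      Emb G ps′ f′ × Unique ps′ × (∀ {p} → p ∈ ps → p ∈ ps′ × f′ p ≡ f p) × (∀ {w} → w ∈ ns → w ∈ ps′) ×
      (∀ {p} → p ∈ ps′ → p ∈ ps ⊎ (p ∈ ns × f′ p ∈ Q)) × (∀ {p} → p ∈ ps′ → f′ p ∈ Q → f′ p ∈ used′) ×
      length used′ ≡ length used + length ns × length ps′ ≡ length ps + length ns
  place-neighbours [] {ps} {f} {used} E ups u∈ fu closed uses uns h x∉Q le =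
    ps , f , used , E , ups , (λ i → i , refl) , (λ ()) , inj₁ , uses , ≡-sym (+-identityʳ _) , ≡-sym (+-identityʳ _)
  place-neighbours {u} {x} (w ∷ ns) {ps} {f} {used} E ups u∈ fu closed uses uns h x∉Q le =
    let ps′ , f′ , used′ , E′ , ups′ , old , new , org , uses′ , l₁ , l₂ =
          place-neighbours {u} {x} ns {w ∷ ps} {upd f w y} {y ∷ used} (extend E w∉ fresh red) (Unique-∷ w∉ ups) (there u∈)
            (trans (on u∈) fu) closed₁ uses₁ (Unique-tail uns) h₁ x∉Q (≤-trans (≤-reflexive (≡-sym (+-suc _ _))) le)
    in ps′ , f′ , used′ , E′ , ups′ ,
       (λ i → proj₁ (old (there i)) , trans (proj₂ (old (there i))) (on i)) ,
       (λ { (here refl) → proj₁ (old (here refl)) ; (there i) → new i }) ,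
       (λ i → [ (λ { (here refl) → inj₂ (here refl , subst (_∈ Q) (≡-sym (trans (proj₂ (old (here refl))) (upd-same f w y))) y∈Q)
                   ; (there j) → inj₁ j })
              , (λ (j , q) → inj₂ (there j , q)) ]′ (org i)) ,
       uses′ , trans l₁ (≡-sym (+-suc _ _)) , trans l₂ (≡-sym (+-suc _ _))
    where
    w∉ : w ∉ ps
    w∉ = proj₁ (h (here refl))
    picked = pick-cnt {p = c x} used uQ (≤-trans (≤-trans (≤-reflexive (+-comm 1 (length used))) (+-monoʳ-≤ (length used) (s≤s z≤n))) le)
    y : Fin N
    y = proj₁ picked
    y∈Q : y ∈ Q
    y∈Q = proj₁ (proj₂ picked)
    xy : c x y ≡ true
    xy = proj₁ (proj₂ (proj₂ picked))
    y∉ : y ∉ used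
    y∉ = proj₂ (proj₂ (proj₂ picked))
    on : ∀ {p} → p ∈ ps → upd f w y p ≡ f p
    on = upd-on f y w∉
    fresh : ∀ {p} → p ∈ ps → f p ≢ y
    fresh i e = y∉ (subst (_∈ used) e (uses i (subst (_∈ Q) (≡-sym e) y∈Q)))
    red : ∀ {p} → p ∈ ps → adj G p w ≡ true → c (f p) y ≡ true
    red i e with closed i
    ... | inj₁ refl = subst (λ z → c z y ≡ true) (≡-sym fu) xy
    ... | inj₂ (inj₁ q) = rcl q y∈Q (fresh i)
    ... | inj₂ (inj₂ cl) = ⊥-elim (w∉ (cl e))
    closed₁ : ∀ {p} → p ∈ w ∷ ps → p ≡ u ⊎ (upd f w y p ∈ Q ⊎ (∀ {v} → adj G p v ≡ true → v ∈ w ∷ ps))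
    closed₁ (here refl) rewrite upd-same f w y = inj₂ (inj₁ y∈Q)
    closed₁ (there i) rewrite on i with closed i
    ... | inj₁ e = inj₁ e
    ... | inj₂ (inj₁ q) = inj₂ (inj₁ q)
    ... | inj₂ (inj₂ cl) = inj₂ (inj₂ (there ∘ cl))
    uses₁ : ∀ {p} → p ∈ w ∷ ps → upd f w y p ∈ Q → upd f w y p ∈ y ∷ used
    uses₁ (here refl) _ rewrite upd-same f w y = here refl
    uses₁ (there i) q rewrite on i = there (uses i q)
    h₁ : ∀ {v} → v ∈ ns → v ∉ w ∷ ps × adj G u v ≡ true
    h₁ i = (λ { (here refl) → Unique-head uns i ; (there j) → proj₁ (h (there i)) j }) , proj₂ (h (there i))

  -- Distance at least 3 keeps the closed neighbourhoods apart, so they are placed independently.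
  -- They occupy at most two places of `Q` per vertex of `us`; hence 2|us| red neighbours in `Q` are
  -- enough for each `x`.
  place-far : ∀ us xs → length us ≡ length xs → Unique us → AllPairs (Far G) us → (∀ {u} → u ∈ us → deg G u ≤ 2) →
    Unique xs → (∀ {x} → x ∈ xs → x ∉ Q × 2 * length us ≤ cnt (c x) Q) → Placed us xs
  place-far [] [] _ _ _ _ _ _ = record
    { ps = [] ; f = λ _ → y₀ ; used = [] ; emb = Emb-[] (λ _ → y₀) ; unique = [] ; closed = λ () ; uses = λ ()
    ; size = refl ; few = z≤n ; origin = λ () ; target = λ () }
  place-far (u ∷ us) (x ∷ xs) len uus (far ∷ fars) d2 uxs h = record
    { ps = ps′ ; f = f′ ; used = used′ ; emb = E′ ; unique = ups′ ; closed = closed′ ; uses = uses′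
    ; size = trans l₂ (trans (cong (λ m → suc m + length ns) P.size) (trans (arith (length P.used) (length us) (length ns)) (cong (_+ suc (length us)) (≡-sym l₁))))
    ; few = ≤-trans (≤-reflexive l₁) used+ns≤
    ; origin = origin′ ; target = target′ }
    where
    module P = Placed (place-far us xs (suc-injective len) (Unique-tail uus) fars (d2 ∘ there) (Unique-tail uxs)
      λ i → proj₁ (h (there i)) , ≤-trans (*-monoʳ-≤ 2 (n≤1+n _)) (proj₂ (h (there i))))
    arith : ∀ a b d → suc (a + b) + d ≡ a + d + suc b
    arith = solve-∀
    u∉ : u ∉ P.ps
    u∉ i with P.origin i
    ... | inj₁ j = Unique-head uus j
    ... | inj₂ (v , j , e) = true≢false e (proj₁ (All.lookup far j))
    x∉Q : x ∉ Q
    x∉Q = proj₁ (h (here refl))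
    fresh : ∀ {p} → p ∈ P.ps → P.f p ≢ x
    fresh i e with P.target i
    ... | inj₁ q = x∉Q (subst (_∈ Q) e q)
    ... | inj₂ q = Unique-head uxs (subst (_∈ xs) e q)
    no-nbr : ∀ {p} → p ∈ P.ps → adj G p u ≡ true → ⊥
    no-nbr i e with P.origin i
    ... | inj₁ j = true≢false e (proj₁ (All.lookup far j))
    ... | inj₂ (v , j , e′) = proj₂ (All.lookup far j) e′ (adj-sym G e)
    ns : List (Fin n)
    ns = nbrs G u
    f₁ : Fin n → Fin N
    f₁ = upd P.f u x
    on : ∀ {p} → p ∈ P.ps → f₁ p ≡ P.f p
    on = upd-on P.f x u∉
    closed₁ : ∀ {p} → p ∈ u ∷ P.ps → p ≡ u ⊎ (f₁ p ∈ Q ⊎ (∀ {v} → adj G p v ≡ true → v ∈ u ∷ P.ps))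
    closed₁ (here e) = inj₁ e
    closed₁ (there i) rewrite on i with P.closed i
    ... | inj₁ q = inj₂ (inj₁ q)
    ... | inj₂ cl = inj₂ (inj₂ (there ∘ cl))
    uses₁ : ∀ {p} → p ∈ u ∷ P.ps → f₁ p ∈ Q → f₁ p ∈ P.used
    uses₁ (here refl) q rewrite upd-same P.f u x = ⊥-elim (x∉Q q)
    uses₁ (there i) q rewrite on i = P.uses i q
    ns-new : ∀ {w} → w ∈ ns → w ∉ u ∷ P.ps × adj G u w ≡ true
    ns-new {w} i = w∉ , nbrs⁻ G i
      where
      w∉ : w ∉ u ∷ P.ps
      w∉ (here e) = adj-≢ G (nbrs⁻ G i) (≡-sym e)
      w∉ (there j) = no-nbr j (adj-sym G (nbrs⁻ G i))
    used+ns≤ : length P.used + length ns ≤ 2 * suc (length us)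
    used+ns≤ = ≤-trans (+-mono-≤ P.few (≤-trans (≤-reflexive (length-nbrs G u)) (d2 (here refl))))
      (≤-reflexive (trans (+-comm (2 * length us) 2) (≡-sym (*-suc 2 (length us)))))
    R = place-neighbours {u} {x} ns (extend P.emb u∉ fresh (λ i e → ⊥-elim (no-nbr i e))) (Unique-∷ u∉ P.unique) (here refl)
      (upd-same P.f u x) closed₁ uses₁ (Unique-nbrs G u) ns-new x∉Q (≤-trans used+ns≤ (proj₂ (h (here refl))))
    ps′ = proj₁ R
    f′ = proj₁ (proj₂ R)
    used′ = proj₁ (proj₂ (proj₂ R))
    E′ = proj₁ (proj₂ (proj₂ (proj₂ R)))
    ups′ = proj₁ (proj₂ (proj₂ (proj₂ (proj₂ R))))
    old : ∀ {p} → p ∈ u ∷ P.ps → p ∈ ps′ × f′ p ≡ f₁ p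
    old = proj₁ (proj₂ (proj₂ (proj₂ (proj₂ (proj₂ R)))))
    new : ∀ {w} → w ∈ ns → w ∈ ps′
    new = proj₁ (proj₂ (proj₂ (proj₂ (proj₂ (proj₂ (proj₂ R))))))
    org : ∀ {p} → p ∈ ps′ → p ∈ u ∷ P.ps ⊎ (p ∈ ns × f′ p ∈ Q)
    org = proj₁ (proj₂ (proj₂ (proj₂ (proj₂ (proj₂ (proj₂ (proj₂ R)))))))
    uses′ : ∀ {p} → p ∈ ps′ → f′ p ∈ Q → f′ p ∈ used′
    uses′ = proj₁ (proj₂ (proj₂ (proj₂ (proj₂ (proj₂ (proj₂ (proj₂ (proj₂ R))))))))
    l₁ = proj₁ (proj₂ (proj₂ (proj₂ (proj₂ (proj₂ (proj₂ (proj₂ (proj₂ (proj₂ R)))))))))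
    l₂ = proj₂ (proj₂ (proj₂ (proj₂ (proj₂ (proj₂ (proj₂ (proj₂ (proj₂ (proj₂ R)))))))))
    closed′ : ∀ {p} → p ∈ ps′ → f′ p ∈ Q ⊎ (∀ {v} → adj G p v ≡ true → v ∈ ps′)
    closed′ i with org i
    ... | inj₂ (_ , q) = inj₁ q
    ... | inj₁ (here refl) = inj₂ (new ∘ nbrs⁺ G)
    ... | inj₁ (there j) with P.closed j
    ...   | inj₁ q = inj₁ (subst (_∈ Q) (≡-sym (trans (proj₂ (old (there j))) (on j))) q)
    ...   | inj₂ cl = inj₂ λ e → proj₁ (old (there (cl e)))
    origin′ : ∀ {p} → p ∈ ps′ → p ∈ u ∷ us ⊎ (Σ (Fin n) λ v → v ∈ u ∷ us × adj G v p ≡ true)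
    origin′ i with org i
    ... | inj₂ (j , _) = inj₂ (u , here refl , nbrs⁻ G j)
    ... | inj₁ (here e) = inj₁ (here e)
    ... | inj₁ (there j) with P.origin j
    ...   | inj₁ l = inj₁ (there l)
    ...   | inj₂ (v , l , e) = inj₂ (v , there l , e)
    target′ : ∀ {p} → p ∈ ps′ → f′ p ∈ Q ⊎ f′ p ∈ x ∷ xs
    target′ i with org i
    ... | inj₂ (_ , q) = inj₁ q
    ... | inj₁ (here refl) = inj₂ (here (trans (proj₂ (old (here refl))) (upd-same P.f u x)))
    ... | inj₁ (there j) rewrite trans (proj₂ (old (there j))) (on j) with P.target j
    ...   | inj₁ q = inj₁ q
    ...   | inj₂ l = inj₂ (there l)

  complete-far : ∀ us xs → length us ≡ length xs → Unique us → AllPairs (Far G) us → (∀ {u} → u ∈ us → deg G u ≤ 2) →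
    Unique xs → (∀ {x} → x ∈ xs → x ∉ Q × 2 * length us ≤ cnt (c x) Q) → n ≤ length Q + length us → ContainsCopy c true G
  complete-far us xs len uus far d2 uxs h le = complete rcl uQ P.unique P.emb P.closed P.used P.uses
    (≤-trans (+-monoʳ-≤ (length P.used) le) (≤-reflexive (trans (arith (length P.used) (length Q) (length us)) (cong (length Q +_) (≡-sym P.size)))))
    where
    module P = Placed (place-far us xs len uus far d2 uxs h)
    arith : ∀ a q u → a + (q + u) ≡ q + (a + u)
    arith = solve-∀

∧-true : ∀ {a b} → a ∧ b ≡ true → a ≡ true × b ≡ true
∧-true {true} e = refl , e

AllPairs-lookup : ∀ {A : Set} {R : A → A → Set} {xs u v} → AllPairs R xs → u ∈ xs → v ∈ xs → u ≢ v → R u v ⊎ R v u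
AllPairs-lookup (r ∷ ap) (here refl) (here refl) ne = ⊥-elim (ne refl)
AllPairs-lookup (r ∷ ap) (here refl) (there j) ne = inj₁ (All.lookup r j)
AllPairs-lookup (r ∷ ap) (there i) (here refl) ne = inj₂ (All.lookup r i)
AllPairs-lookup (r ∷ ap) (there i) (there j) ne = AllPairs-lookup ap i j ne

-- Independent sets, leaves and distant vertices in sparse graphs

module Sparse {n} (G : Graph n) (ℓ : ℕ) (sparse : degSum G ≤ 2 * n + 2 * ℓ) where

  private
    all = allFin n

  -- Vertices of degree at least 4 use up the degree sum 2n + 2ℓ, so at least (n - ℓ)/2 vertices
  -- have degree at most 3. Each of these conflicts with at most 4 of them: itself and its
  -- neighbours.
  independent-deg≤3 : ∀ m → 8 * m + ℓ < n →
    Σ (List (Fin n)) λ U → length U ≡ m × Unique U × (∀ {u} → u ∈ U → deg G u ≤ 3) ×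
      (∀ {u v} → u ∈ U → v ∈ U → adj G u v ≡ true → ⊥)
  independent-deg≤3 m lt =
    let U , len , uU , U⊆ , ap = greedy-independent conf S (sel-Unique low Unique-all) 4 few rfl m enough
    in U , len , uU , (λ i → low⁻ (U⊆ i)) , λ i j e →
         [ (λ q → clash (adj-sym G e) q) , (λ q → clash e q) ]′ (AllPairs-lookup ap i j (adj-≢ G e))
    where
    low : Fin n → Bool
    low v = deg G v <ᵇ 4
    S = sel low all
    conf : Fin n → Fin n → Bool
    conf u v = (u == v) ∨ adj G u v
    clash : ∀ {u v} → adj G u v ≡ true → conf u v ≡ false → ⊥
    clash {u} {v} e q rewrite e = true≢false (Boolₚ.∨-zeroʳ (u == v)) q
    rfl : ∀ u → conf u u ≡ true
    rfl u rewrite ==-refl u = refl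
    low⁻ : ∀ {v} → v ∈ S → deg G v ≤ 3
    low⁻ {v} i = ≤-pred (<ᵇ-true⁻ {deg G v} {4} (proj₂ (sel⁻ {p = low} {xs = all} i)))
    few : ∀ {u} → u ∈ S → cnt (conf u) S ≤ 4
    few {u} i = ≤-trans (cnt-∨ (u ==_) (adj G u) S)
      (+-mono-≤ (≤-reflexive (cnt-single u i (sel-Unique low Unique-all)))
        (≤-trans (cnt-adj≤deg G u (sel-Unique low Unique-all)) (low⁻ i)))
    pointwise : ∀ d → 4 ≤ d + 4 * (if d <ᵇ 4 then 1 else 0)
    pointwise 0 = ≤-refl
    pointwise 1 = n≤1+n 4
    pointwise 2 = m≤n+m 4 2
    pointwise 3 = m≤n+m 4 3
    pointwise (suc (suc (suc (suc d)))) = m≤m+n 4 (d + 0)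
    count : n * 4 ≤ degSum G + 4 * cnt low all
    count = ≤-trans (≤-reflexive (trans (cong (_* 4) (≡-sym (length-allFin {n}))) (≡-sym (sumOver-const 4 all))))
      (≤-trans (sumOver-mono all λ {v} _ → pointwise (deg G v))
        (≤-reflexive (trans (sumOver-+ (deg G) _ all) (cong (degSum G +_) (sumOver-* 4 (λ v → if low v then 1 else 0) all)))))
    arith : ∀ m n l g s → 2 * suc (2 * (m * 4)) + (g + 4 * s + (2 * n + 2 * l + 2 * n)) + 0 ≡
      2 * (2 * s) + (n * 4 + (g + 2 * suc (8 * m + l)))
    arith = solve-∀
    enough : m * 4 < length S
    enough = subst (m * 4 <_) (≡-sym (length-sel low all)) (*-cancelˡ-< 2 (m * 4) (cnt low all) (*-cancelˡ-≤ 2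
      (linear 0 (+-mono-≤ count (+-mono-≤ sparse (*-monoʳ-≤ 2 lt))) (arith m n ℓ (degSum G) (cnt low all)))))

  leafNbr : Fin n → Fin n → Bool
  leafNbr g v = adj G g v ∧ (deg G v <ᵇ 2)

  module _ (minDeg : ∀ v → 1 ≤ deg G v) where

    private
      big : Fin n → Bool
      big v = 2 <ᵇ deg G v
      bigNbr : Fin n → Fin n → Bool
      bigNbr v w = adj G v w ∧ big w
      -- Leaves, and vertices of degree 2 without a neighbour of degree 3 or more. Thus a light
      -- vertex next to a vertex of high degree is a leaf.
      light : Fin n → Bool
      light v = (deg G v <ᵇ 2) ∨ ((deg G v <ᵇ 3) ∧ (cnt (bigNbr v) all <ᵇ 1))
      S : List (Fin n)
      S = sel light all
      excess : ℕ
      excess = sumOver (λ v → deg G v ∸ 2) all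

    -- Without minimum degree 2 each leaf allows the others one more unit of excess, and leaves are
    -- light.
    excess≤ : excess ≤ 2 * ℓ + cnt light all
    excess≤ = linear 0 (+-mono-≤ (+-mono-≤ total sparse) leaves) (arith excess (cnt (λ v → deg G v <ᵇ 2) all) (degSum G) n ℓ (cnt light all))
      where
      leaves : cnt (λ v → deg G v <ᵇ 2) all ≤ cnt light all
      leaves = cnt-mono all λ {v} _ e → cong (_∨ ((deg G v <ᵇ 3) ∧ (cnt (bigNbr v) all <ᵇ 1))) e
      pointwise : ∀ d → 1 ≤ d → (d ∸ 2) + 2 ≤ d + (if d <ᵇ 2 then 1 else 0)
      pointwise (suc zero) _ = ≤-refl
      pointwise (suc (suc d)) _ = ≤-reflexive (trans (+-comm d 2) (≡-sym (+-identityʳ _)))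
      total : excess + n * 2 ≤ degSum G + cnt (λ v → deg G v <ᵇ 2) all
      total = ≤-trans (≤-reflexive (trans (cong (λ z → excess + z * 2) (≡-sym (length-allFin {n})))
                (trans (cong (excess +_) (≡-sym (sumOver-const 2 all))) (≡-sym (sumOver-+ _ _ all)))))
              (≤-trans (sumOver-mono all λ {v} _ → pointwise (deg G v) (minDeg v)) (≤-reflexive (sumOver-+ (deg G) _ all)))
      arith : ∀ x λ′ g n l s → x + (g + λ′ + (2 * n + 2 * l) + s) + 0 ≡ 2 * l + s + (x + n * 2 + g + λ′)
      arith = solve-∀

    -- A vertex that is not light is big or adjacent to a big one. Charged to the big vertices,
    -- these number at most the sum of 1 + d ≤ 4(d - 2), hence at most 4 · excess; `excess≤` then
    -- gives n ≤ s + 4(2ℓ + s) for s light vertices.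
    many-light : n ≤ 5 * cnt light all + 8 * ℓ
    many-light = linear 0 (+-mono-≤ total (+-mono-≤ weight (*-monoʳ-≤ 4 excess≤))) (arith n (cnt light all) heavy excess ℓ)
      where
      heavy : ℕ
      heavy = sumOver (λ v → (if big v then 1 else 0) + cnt (bigNbr v) all) all
      pointwise : ∀ d h → 1 ≤ (if (d <ᵇ 2) ∨ ((d <ᵇ 3) ∧ (h <ᵇ 1)) then 1 else 0) + ((if 2 <ᵇ d then 1 else 0) + h)
      pointwise 0 h = s≤s z≤n
      pointwise 1 h = s≤s z≤n
      pointwise 2 zero = s≤s z≤n
      pointwise 2 (suc h) = s≤s z≤n
      pointwise (suc (suc (suc d))) h = s≤s z≤n
      total : n ≤ cnt light all + heavy
      total = ≤-trans (≤-reflexive (trans (≡-sym (length-allFin {n})) (trans (≡-sym (*-identityʳ _)) (≡-sym (sumOver-const 1 all)))))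
        (≤-trans (sumOver-mono all λ {v} _ → pointwise (deg G v) (cnt (bigNbr v) all)) (≤-reflexive (sumOver-+ _ _ all)))
      column : ∀ w → sumOver (λ v → if bigNbr v w then 1 else 0) all ≡ (if big w then deg G w else 0)
      column w with big w
      ... | true = sumOver-cong all λ v → cong (λ z → if z then 1 else 0) (trans (Boolₚ.∧-identityʳ (adj G v w)) (sym G v w))
      ... | false = trans (sumOver-cong all λ v → cong (λ z → if z then 1 else 0) (Boolₚ.∧-zeroʳ (adj G v w)))
                      (trans (sumOver-const 0 all) (*-zeroʳ (length all)))
      pointwise′ : ∀ d → (if 2 <ᵇ d then 1 else 0) + (if 2 <ᵇ d then d else 0) ≤ 4 * (d ∸ 2)
      pointwise′ 0 = z≤n
      pointwise′ 1 = z≤n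
      pointwise′ 2 = z≤n
      pointwise′ (suc (suc (suc d))) = ≤-trans (m≤m+n (4 + d) (3 * d)) (≤-reflexive (arith d))
        where
        arith : ∀ d → 4 + d + 3 * d ≡ 4 * suc d
        arith = solve-∀
      weight : heavy ≤ 4 * excess
      weight = ≤-trans (≤-reflexive (trans (sumOver-+ _ _ all) (trans (cong (cnt big all +_)
                 (trans (sumOver-swap (λ v w → if bigNbr v w then 1 else 0) all all) (sumOver-cong all column)))
                 (≡-sym (sumOver-+ _ _ all)))))
               (≤-trans (sumOver-mono all λ {v} _ → pointwise′ (deg G v)) (≤-reflexive (sumOver-* 4 _ all)))
      arith : ∀ n s h x l → n + (s + h + (4 * x + 4 * (2 * l + s))) + 0 ≡ 5 * s + 8 * l + (n + (h + 4 * x))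
      arith = solve-∀

    -- If no vertex has m leaves, then any vertex has at most m + 1 light neighbours: one of degree
    -- at least 3 meets light vertices only in leaves. So the ball of radius 2 around a light vertex
    -- contains at most 1 + 2 + 2(m + 1) = 2m + 5 light vertices, and light vertices far apart can
    -- be chosen greedily.
    leaves⊎far : ∀ m → 5 * (m * (2 * m + 5)) + 8 * ℓ < n →
      (Σ (Fin n) λ g → m ≤ cnt (leafNbr g) all) ⊎
      (Σ (List (Fin n)) λ U → length U ≡ m × Unique U × (∀ {u} → u ∈ U → deg G u ≤ 2) × AllPairs (Far G) U)
    leaves⊎far m lt = [ (λ few → inj₂ (far few)) , inj₁ ]′ (∃⊎∀ {P = λ g → cnt (leafNbr g) all < m} all test)
      where
      test : ∀ g → g ∈ all → cnt (leafNbr g) all < m ⊎ (Σ (Fin n) λ g → m ≤ cnt (leafNbr g) all)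
      test g _ with m ≤? cnt (leafNbr g) all
      ... | yes le = inj₂ (g , le)
      ... | no gt = inj₁ (≰⇒> gt)
      uS : Unique S
      uS = sel-Unique light Unique-all
      light⁻ : ∀ {v} → v ∈ S → light v ≡ true
      light⁻ i = proj₂ (sel⁻ {p = light} {xs = all} i)
      S-deg : ∀ {v} → v ∈ S → deg G v ≤ 2
      S-deg {v} i with deg G v <ᵇ 2 in e₁ | deg G v <ᵇ 3 in e₂ | light⁻ i
      ... | true | _ | _ = <⇒≤ (<ᵇ-true⁻ {deg G v} {2} e₁)
      ... | false | true | _ = ≤-pred (<ᵇ-true⁻ {deg G v} {3} e₂)
      leaf-or-small : ∀ {v w} → v ∈ S → adj G w v ≡ true → 2 < deg G w → leafNbr w v ≡ true
      leaf-or-small {v} {w} i e b with deg G v <ᵇ 2 | light⁻ i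
      ... | true | _ = trans (Boolₚ.∧-identityʳ (adj G w v)) e
      ... | false | q = ⊥-elim (<⇒≱ (<ᵇ-true⁻ {cnt (bigNbr v) all} {1} (proj₂ (∧-true {deg G v <ᵇ 3} q)))
              (≤-trans (≤-reflexive (cong (λ z → if z then 1 else 0) (≡-sym (cong₂ _∧_ (adj-sym G e) (<ᵇ-true b)))))
                (term≤sumOver (λ w → if bigNbr v w then 1 else 0) (∈-all w))))
      ball : Fin n → List (Fin n)
      ball u = u ∷ nbrs G u ++ concatMap (nbrs G) (nbrs G u)
      conf : Fin n → Fin n → Bool
      conf u v = mem (ball u) v
      module _ (few : ∀ g → g ∈ all → cnt (leafNbr g) all < m) where
        in-S : ∀ w → cnt (adj G w) S ≤ m + 1
        in-S w with deg G w ≤? 2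
        ... | yes d2 = ≤-trans (cnt-adj≤deg G w uS) (≤-trans d2 (+-monoˡ-≤ 1 (≤-trans (s≤s z≤n) (few w (∈-all w)))))
        ... | no d3 = ≤-trans (cnt≤ {ys = sel (leafNbr w) all} uS λ {v} i e →
                          sel⁺ {p = leafNbr w} (∈-all v) (leaf-or-small i e (≰⇒> d3)))
                        (≤-trans (≤-reflexive (length-sel (leafNbr w) all)) (≤-trans (<⇒≤ (few w (∈-all w))) (m≤m+n m 1)))
        few-conf : ∀ {u} → u ∈ S → cnt (conf u) S ≤ 2 * m + 5
        few-conf {u} i = ≤-trans (cnt≤ {ys = u ∷ nbrs G u ++ concatMap (λ w → sel (adj G w) S) (nbrs G u)} uS λ {v} j e → locate j (mem⁻ e))
          (≤-trans (s≤s (≤-trans (≤-reflexive (trans (length-++ (nbrs G u)) (cong₂ _+_ (length-nbrs G u) (length-concatMap _ (nbrs G u)))))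
            (+-mono-≤ (S-deg i) (≤-trans (sumOver-bound _ (m + 1) (nbrs G u) λ {w} _ → ≤-trans (≤-reflexive (length-sel (adj G w) S)) (in-S w))
              (*-monoˡ-≤ (m + 1) (≤-trans (≤-reflexive (length-nbrs G u)) (S-deg i)))))))
            (≤-reflexive (arith m)))
          where
          arith : ∀ m → suc (2 + 2 * (m + 1)) ≡ 2 * m + 5
          arith = solve-∀
          locate : ∀ {v} → v ∈ S → v ∈ ball u → v ∈ u ∷ nbrs G u ++ concatMap (λ w → sel (adj G w) S) (nbrs G u)
          locate _ (here e) = here e
          locate {v} j (there l) with ∈-++⁻ (nbrs G u) l
          ... | inj₁ a = there (∈-++⁺ˡ a)
          ... | inj₂ b with w , w∈ , v∈ ← find (∈-concatMap⁻ (nbrs G) {xs = nbrs G u} b) =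
            there (∈-++⁺ʳ (nbrs G u) (∈-concatMap (λ w → sel (adj G w) S) w∈ (sel⁺ {p = adj G w} j (nbrs⁻ G v∈))))
        enough : m * (2 * m + 5) < length S
        enough = subst (m * (2 * m + 5) <_) (≡-sym (length-sel light all)) (*-cancelˡ-< 5 _ _
          (linear 0 (+-mono-≤ lt many-light) (arith (m * (2 * m + 5)) (cnt light all) ℓ n)))
          where
          arith : ∀ x s l n → suc (5 * x) + (n + (5 * s + 8 * l)) + 0 ≡ 5 * s + (suc (5 * x + 8 * l) + n)
          arith = solve-∀
        conf⇒far : ∀ {u v} → conf v u ≡ false → Far G u v
        conf⇒far {u} {v} q = ¬true⇒false (λ e → true≢false (mem⁺ (there (∈-++⁺ˡ (nbrs⁺ G e)))) q) ,
          λ vw uw → true≢false (mem⁺ (there (∈-++⁺ʳ (nbrs G v) (∈-concatMap (nbrs G) (nbrs⁺ G vw) (nbrs⁺ G (adj-sym G uw)))))) q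
        far : Σ (List (Fin n)) λ U → length U ≡ m × Unique U × (∀ {u} → u ∈ U → deg G u ≤ 2) × AllPairs (Far G) U
        far = let U , len , uU , U⊆ , ap = greedy-independent conf S uS (2 * m + 5) few-conf (λ u → mem⁺ {xs = ball u} {u} (here refl)) m enough
              in U , len , uU , S-deg ∘ U⊆ , AllPairs-map conf⇒far ap

module Cliques {N : ℕ} (c : Colouring N) (c-sym : SymmetricColouring c) (k : ℕ) (y₀ : Fin N)
  {n : ℕ} (G : Graph n) (noRed : ¬ ContainsCopy c true G) (ℓ : ℕ) (sparse : degSum G ≤ 2 * n + 2 * ℓ)
  (minDeg : ∀ v → 1 ≤ deg G v) where
  open Host c c-sym
  open Fan k
  open Sparse G ℓ sparse

  -- Otherwise `g` goes to `q`, m of its leaves go to red neighbours of `q` in `O`, and `Q` holds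
  -- the rest of `G`.
  few-red : ∀ {Q O} → RedClique Q → Unique Q → Unique O → (∀ {x} → x ∈ O → x ∉ Q) → ∀ {m g} → n ≤ length Q + m →
    m ≤ cnt (leafNbr g) (allFin n) → ∀ {q} → q ∈ Q → cnt (c q) O < m
  few-red {Q} {O} rcl uQ uO O∩Q {m} {g} len le {q} q∈ = ≰⇒> λ red →
    noRed (Completion.complete-common c c-sym y₀ rcl uQ G {U} {g ∷ []} {X} {q ∷ []}
      (Uniqueₚ.take⁺ m (sel-Unique (leafNbr g) Unique-all)) ([] ∷ []) (λ { i (here refl) → adj-≢ G (U-adj i) refl })
      (λ {u} {v} i e → here (one-neighbour G (≤-pred (<ᵇ-true⁻ {deg G u} {2} (proj₂ (leaf i)))) (adj-sym G (U-adj i)) e))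
      (Uniqueₚ.take⁺ m (sel-Unique (c q) uO)) ([] ∷ []) (trans lenU (≡-sym (lenX red))) refl
      (λ i → O∩Q (proj₁ (X⁻ i))) (λ { (here refl) → q∈ }) (λ { {x} i (here refl) → trans (c-sym x q) (proj₂ (X⁻ i)) })
      (subst (λ z → n ≤ length Q + z) (≡-sym lenU) len))
    where
    U = take m (sel (leafNbr g) (allFin n))
    X = take m (sel (c q) O)
    lenU : length U ≡ m
    lenU = length-take≤ m _ (subst (m ≤_) (≡-sym (length-sel (leafNbr g) (allFin n))) le)
    lenX : m ≤ cnt (c q) O → length X ≡ m
    lenX red = length-take≤ m _ (subst (m ≤_) (≡-sym (length-sel (c q) O)) red)
    leaf : ∀ {u} → u ∈ U → adj G g u ≡ true × (deg G u <ᵇ 2) ≡ true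
    leaf i = ∧-true (proj₂ (sel⁻ {p = leafNbr g} {xs = allFin n} (take-⊆ m i)))
    U-adj : ∀ {u} → u ∈ U → adj G g u ≡ true
    U-adj i = proj₁ (leaf i)
    X⁻ : ∀ {x} → x ∈ X → x ∈ O × c q x ≡ true
    X⁻ i = sel⁻ {p = c q} {xs = O} (take-⊆ m i)

  -- Otherwise the m vertices of `U` go to m rich vertices, each with enough red neighbours in `Q`
  -- for `complete-far`.
  few-rich : ∀ {Q O} → RedClique Q → Unique Q → Unique O → (∀ {x} → x ∈ O → x ∉ Q) → ∀ {m U} → n ≤ length Q + m →
    length U ≡ m → Unique U → (∀ {u} → u ∈ U → deg G u ≤ 2) → AllPairs (Far G) U →
    cnt (λ x → not (cnt (c x) Q <ᵇ 2 * m)) O < m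
  few-rich {Q} {O} rcl uQ uO O∩Q {m} {U} len lenU uU d2 far = ≰⇒> λ rich →
    noRed (Completion.complete-far c c-sym y₀ rcl uQ G U X (trans lenU (≡-sym (lenX rich))) uU far d2
      (Uniqueₚ.take⁺ m (sel-Unique isRich uO))
      (λ {x} i → O∩Q (proj₁ (X⁻ i)) , subst (λ z → 2 * z ≤ cnt (c x) Q) (≡-sym lenU) (proj₂ (X⁻ i)))
      (subst (λ z → n ≤ length Q + z) (≡-sym lenU) len))
    where
    isRich : Fin N → Bool
    isRich x = not (cnt (c x) Q <ᵇ 2 * m)
    X = take m (sel isRich O)
    lenX : m ≤ cnt isRich O → length X ≡ m
    lenX rich = length-take≤ m _ (subst (m ≤_) (≡-sym (length-sel isRich O)) rich)
    X⁻ : ∀ {x} → x ∈ X → x ∈ O × 2 * m ≤ cnt (c x) Q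
    X⁻ {x} i = let j , e = sel⁻ {p = isRich} {xs = O} (take-⊆ m i) in
      j , ≮⇒≥ λ lt → true≢false e (cong not (<ᵇ-true lt))

  -- `crossing` is one-sided, and the side depends on which structure `G` offers: m leaves bound the
  -- red degrees of vertices of `Q`, far vertices those of vertices outside. Either side suffices
  -- later, because the two cliques can be interchanged.
  record SecondClique (W Q : List (Fin N)) (m : ℕ) : Set where
    field
      Q₂ : List (Fin N)
      unique : Unique Q₂
      apart : ∀ {x} → x ∈ Q₂ → x ∉ Q
      clique : RedClique Q₂
      large : length W + 2 ≤ length Q₂ + length Q + m + 2 * k
      crossing : (∀ {q} → q ∈ Q → cnt (c q) Q₂ ≤ 2 * m) ⊎ (∀ {x} → x ∈ Q₂ → cnt (c x) Q ≤ 2 * m)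

  -- With m leaves at one vertex, any q in `Q` is blue to all but fewer than m vertices of `O`, and
  -- fan-freeness at q yields the clique. With far vertices, all but fewer than m vertices of `O`
  -- are poor; k disjoint blue edges among poor vertices would have a common blue neighbour in `Q`,
  -- since their 2k ends exclude at most 2k · 2m vertices.
  second-clique : ∀ {W Q} → Unique W → FanFree W → RedClique Q → Unique Q → (∀ {x} → x ∈ Q → x ∈ W) → ∀ {m} →
    n ≤ length Q + m → 5 * (m * (2 * m + 5)) + 8 * ℓ < n → 2 * k * (2 * m) < length Q → SecondClique W Q m
  second-clique {W} {Q} uW ff rcl uQ Q⊆W {m} len sparse-enough big = [ star , distant ]′ (leaves⊎far minDeg m sparse-enough)
    where
    O = W ∖ Q
    uO : Unique O
    uO = ∖-Unique Q uW
    O∩Q : ∀ {x} → x ∈ O → x ∉ Q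
    O∩Q i = proj₂ (∖⁻ W i)
    arith : ∀ w o q p z m k → w + 2 + (o + q + (p + m + (z + 2 * k))) + 0 ≡ z + q + m + 2 * k + (w + (o + (p + 2)))
    arith = solve-∀
    sizes : ∀ P {p} → length O ≤ length P + m → length P + 2 ≤ p + 2 * k →
      length W + 2 ≤ p + length Q + m + 2 * k
    sizes P {p} lP l = linear 0 (+-mono-≤ (∖-length Q uW) (+-mono-≤ lP l)) (arith (length W) (length O) (length Q) (length P) p m k)
    mono : ∀ {P : List (Fin N)} {p : Fin N → Bool} {Z} → Unique Z → (∀ {x} → x ∈ Z → x ∈ P) → cnt p Z ≤ cnt p P
    mono {P} {p} {Z} uZ sub = ≤-trans (cnt≤ {ys = sel p P} uZ λ i e → sel⁺ {p = p} (sub i) e) (≤-reflexive (length-sel p P))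
    star : (Σ (Fin n) λ g → m ≤ cnt (leafNbr g) (allFin n)) → SecondClique W Q m
    star (g , le) with pick [] uQ (≤-trans (s≤s z≤n) big)
    ... | q , q∈ , _ with blue-nbhd-clique {v = q} {A = sel (not ∘ c q) O} ff (Q⊆W q∈) (sel-Unique (not ∘ c q) uO)
            (proj₁ ∘ ∖⁻ W ∘ proj₁ ∘ sel⁻ {p = not ∘ c q})
            (λ {x} i → let j , e = sel⁻ {p = not ∘ c q} {xs = O} i in
               (λ { refl → O∩Q j q∈ }) , ¬true⇒false λ e′ → true≢false e (cong not e′))
    ...   | (Z , uZ , Z⊆ , rclZ , l) = record
      { Q₂ = Z ; unique = uZ ; apart = O∩Q ∘ Z⊆O ; clique = rclZ
      ; large = sizes (sel (not ∘ c q) O) {length Z} (≤-trans (≤-reflexive (trans (≡-sym (cnt-not (c q) O)) (+-comm (cnt (c q) O) _)))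
                  (+-mono-≤ (≤-reflexive (≡-sym (length-sel (not ∘ c q) O))) (<⇒≤ (few q∈)))) l
      ; crossing = inj₁ λ {q′} i → ≤-trans (mono {p = c q′} uZ Z⊆O) (≤-trans (<⇒≤ (few i)) (m≤m+n m (m + 0)))
      }
      where
      few : ∀ {q} → q ∈ Q → cnt (c q) O < m
      few = few-red rcl uQ uO O∩Q len le
      Z⊆O : ∀ {x} → x ∈ Z → x ∈ O
      Z⊆O i = proj₁ (sel⁻ {p = not ∘ c q} {xs = O} (Z⊆ i))
    distant : (Σ (List (Fin n)) λ U → length U ≡ m × Unique U × (∀ {u} → u ∈ U → deg G u ≤ 2) × AllPairs (Far G) U) →
      SecondClique W Q m
    distant (U , lenU , uU , d2 , far) = [ (λ M → ⊥-elim (no-matching M)) , finish ]′ (matching⊎clique k P uP)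
      where
      isPoor : Fin N → Bool
      isPoor x = cnt (c x) Q <ᵇ 2 * m
      P = sel isPoor O
      uP : Unique P
      uP = sel-Unique isPoor uO
      P⁻ : ∀ {x} → x ∈ P → x ∈ O × cnt (c x) Q ≤ 2 * m
      P⁻ {x} i = let j , e = sel⁻ {p = isPoor} {xs = O} i in j , <⇒≤ (<ᵇ-true⁻ {cnt (c x) Q} {2 * m} e)
      no-matching : (Σ (List (Fin N × Fin N)) λ es → length es ≡ k × BlueMatching es × (∀ {x} → x ∈ pairVertices es → x ∈ P)) → ⊥
      no-matching (es , lenE , bm , sub)
        with q , q∈ , q∉ ← pick (concatMap (λ x → sel (c x) Q) (pairVertices es)) uQ
          (≤-trans (s≤s (≤-trans (≤-reflexive (length-concatMap (λ x → sel (c x) Q) (pairVertices es)))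
            (≤-trans (sumOver-bound _ (2 * m) (pairVertices es) λ {x} i →
                ≤-trans (≤-reflexive (length-sel (c x) Q)) (proj₂ (P⁻ (sub i))))
              (≤-reflexive (cong (_* (2 * m)) (trans (length-pairVertices es) (cong (2 *_) lenE))))))) big)
        = matching-fan ff (Q⊆W q∈) (proj₁ ∘ ∖⁻ W ∘ proj₁ ∘ P⁻ ∘ sub) lenE bm
            λ {x} i → (λ { refl → O∩Q (proj₁ (P⁻ (sub i))) q∈ }) ,
              ¬true⇒false λ e → q∉ (∈-concatMap (λ x → sel (c x) Q) i (sel⁺ {p = c x} q∈ (trans (c-sym x q) e)))
      finish : LargeClique P k → SecondClique W Q m
      finish (Z , uZ , Z⊆ , rclZ , l) = record
        { Q₂ = Z ; unique = uZ ; apart = O∩Q ∘ proj₁ ∘ P⁻ ∘ Z⊆ ; clique = rclZ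
        ; large = sizes P {length Z} (≤-trans (≤-reflexive (≡-sym (cnt-not isPoor O)))
                    (+-mono-≤ (≤-reflexive (≡-sym (length-sel isPoor O))) (<⇒≤ (few-rich rcl uQ uO O∩Q len lenU uU d2 far)))) l
        ; crossing = inj₂ (proj₂ ∘ P⁻ ∘ Z⊆)
        }

  -- As |V| ≥ |Q| + m, m vertices of `V` lie outside `Q`. Together they are blue to at most mτ
  -- vertices of `Q`, and `room₂` leaves 3m others for the neighbours of m independent vertices of
  -- degree at most 3.
  absorb : ∀ {Q V} → RedClique Q → Unique Q → Unique V → ∀ {m τ} → (∀ {v} → v ∈ V → cnt (blue v) Q ≤ τ) → n ≤ length V →
    length Q + m ≡ n → 8 * m + ℓ < n → m * τ + 3 * m ≤ length Q → ⊥
  absorb {Q} {V} rcl uQ uV {m} {τ} few nV len room₁ room₂ with independent-deg≤3 m room₁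
  ... | U , lenU , uU , d3 , ind = noRed (Completion.complete-common c c-sym y₀ rcl uQ G {U} {NU} {X} {Y}
      uU (sel-Unique isNbr Unique-all)
      (λ i j → let u , u∈ , e = NU⁻ j in ind u∈ i e)
      (λ {u} {v} i e → sel⁺ {p = isNbr} (∈-all v) (mem⁺ (∈-concatMap (nbrs G) i (nbrs⁺ G e))))
      (Uniqueₚ.take⁺ m (∖-Unique Q uV)) (Uniqueₚ.take⁺ (length NU) (∖-Unique forbidden uQ))
      (trans lenU (≡-sym lenX)) (≡-sym lenY) (λ i → proj₂ (∖⁻ V (take-⊆ m i))) (λ i → proj₁ (Y⁻ i)) red
      (≤-reflexive (trans (≡-sym len) (cong (length Q +_) (≡-sym lenU)))))
    where
    isNbr : Fin n → Bool
    isNbr v = mem (concatMap (nbrs G) U) v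
    NU = sel isNbr (allFin n)
    NU⁻ : ∀ {v} → v ∈ NU → Σ (Fin n) λ u → u ∈ U × adj G u v ≡ true
    NU⁻ {v} i with u , u∈ , e ← find (∈-concatMap⁻ (nbrs G) {xs = U} (mem⁻ (proj₂ (sel⁻ {p = isNbr} {xs = allFin n} i)))) =
      u , u∈ , nbrs⁻ G e
    X = take m (V ∖ Q)
    lenX : length X ≡ m
    lenX = length-take≤ m _ (linear 0 (+-mono-≤ (≤-reflexive len) (+-mono-≤ nV (∖-length Q uV))) (arith m (length (V ∖ Q)) n (length V) (length Q)))
      where
      arith : ∀ m x n v q → m + (n + (v + (x + q))) + 0 ≡ x + (q + m + (n + v))
      arith = solve-∀
    blueTo : Fin N → List (Fin N)
    blueTo x = sel (blue x) Q
    forbidden = concatMap blueTo X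
    lenF : length forbidden ≤ m * τ
    lenF = ≤-trans (≤-reflexive (length-concatMap blueTo X)) (≤-trans (sumOver-bound _ τ X λ {x} i →
      ≤-trans (≤-reflexive (length-sel (blue x) Q)) (few (proj₁ (∖⁻ V (take-⊆ m i))))) (≤-reflexive (cong (_* τ) lenX)))
    lenNU : length NU ≤ 3 * m
    lenNU = ≤-trans (⊆-length {ys = concatMap (nbrs G) U} (sel-Unique isNbr Unique-all) λ i → mem⁻ (proj₂ (sel⁻ {p = isNbr} {xs = allFin n} i)))
      (≤-trans (≤-reflexive (length-concatMap (nbrs G) U)) (≤-trans (sumOver-bound _ 3 U λ {u} i →
        ≤-trans (≤-reflexive (length-nbrs G u)) (d3 i)) (≤-reflexive (trans (cong (_* 3) lenU) (*-comm m 3)))))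
    Y = take (length NU) (Q ∖ forbidden)
    lenY : length Y ≡ length NU
    lenY = length-take≤ (length NU) _ (linear 0 (+-mono-≤ lenNU (+-mono-≤ room₂ (+-mono-≤ (∖-length forbidden uQ) lenF)))
      (arith (length NU) (length (Q ∖ forbidden)) m (m * τ) (length Q) (length forbidden)))
      where
      arith : ∀ x y m z q f → x + (3 * m + (q + (y + f + z))) + 0 ≡ y + (x + (z + 3 * m + (q + f)))
      arith = solve-∀
    Y⁻ : ∀ {y} → y ∈ Y → y ∈ Q × y ∉ forbidden
    Y⁻ i = ∖⁻ Q (take-⊆ (length NU) i)
    red : ∀ {x y} → x ∈ X → y ∈ Y → c x y ≡ true
    red {x} {y} i j = ¬blue⇒red (λ b → proj₂ (Y⁻ j) (∈-concatMap blueTo i (sel⁺ {p = blue x} (proj₁ (Y⁻ j)) b)))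
      λ e → proj₂ (∖⁻ V (take-⊆ m i)) (subst (_∈ Q) (≡-sym e) (proj₁ (Y⁻ j)))

-- Families of disjoint blue fans

module Fans {N : ℕ} (c : Colouring N) (c-sym : SymmetricColouring c) (k : ℕ) where
  open Host c c-sym
  open Fan k

  fanVertices : Fin N × List (Fin N × Fin N) → List (Fin N)
  fanVertices (v , es) = v ∷ pairVertices es

  DisjointFans : ℕ → Set
  DisjointFans t = Σ (List (Fin N × List (Fin N × Fin N))) λ fans → length fans ≡ t ×
    All (λ (v , es) → IsFan v es) fans × Unique (concatMap fanVertices fans)

  length-fan : ∀ {v es} → IsFan v es → length (fanVertices (v , es)) ≡ suc (2 * k)
  length-fan {es = es} (len , _) = cong suc (trans (length-pairVertices es) (cong (2 *_) len))

  length-fans : ∀ {fans} → All (λ (v , es) → IsFan v es) fans → length (concatMap fanVertices fans) ≡ length fans * suc (2 * k)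
  length-fans [] = refl
  length-fans {(v , es) ∷ fans} (h ∷ hs) = trans (length-++ (fanVertices (v , es))) (cong₂ _+_ (length-fan h) (length-fans hs))

  -- Adding fans one at a time must stop before t fans, leaving a fan-free complement.
  fan-free-complement : ∀ t → ¬ DisjointFans (suc t) → (∀ U → length U ≤ t * suc (2 * k) → FanFree (allFin N ∖ U) → ⊥) → ⊥
  fan-free-complement t none cont = loop (suc t) ≤-refl
    (subst DisjointFans (≡-sym (n∸n≡0 t)) ([] , refl , [] , []))
    where
    loop : ∀ r → r ≤ suc t → DisjointFans (suc t ∸ r) → ⊥
    loop zero _ F = none F
    loop (suc r) r≤t (fans , len , isFans , uq) = cont (concatMap fanVertices fans)
      (≤-trans (≤-reflexive (trans (length-fans isFans) (cong (_* suc (2 * k)) len))) (*-monoˡ-≤ (suc (2 * k)) (m∸n≤m t r)))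
      λ v es isFan sub → loop r (<⇒≤ r≤t) (((v , es) ∷ fans) , trans (cong suc len) (≡-sym (+-∸-assoc 1 (≤-pred r≤t))) , isFan ∷ isFans ,
        Uniqueₚ.++⁺ (proj₂ (proj₂ (proj₂ isFan))) uq λ (i , j) → proj₂ (∖⁻ (allFin N) (sub i)) j)

  module Special {Q₁ Q₂ : List (Fin N)} (u₁ : Unique Q₁) (u₂ : Unique Q₂) (apart : ∀ {x} → x ∈ Q₂ → x ∉ Q₁)
    {δ τ : ℕ} (crossing : ∀ {q} → q ∈ Q₁ → cnt (c q) Q₂ ≤ δ) where

    IsSpecial : Fin N → Set
    IsSpecial s = τ ≤ cnt (blue s) Q₁ × τ ≤ cnt (blue s) Q₂

    -- Each edge joins a q in `Q₁` to an x in `Q₂`, both blue to `s`. Besides the vertices to avoid,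
    -- x only has to miss the at most δ red neighbours of q.
    matching-at : ∀ {s} → IsSpecial s → ∀ m avoid → length avoid + 2 * m + δ ≤ τ →
      Σ (List (Fin N × Fin N)) λ es → length es ≡ m × BlueMatching es ×
        (∀ {x} → x ∈ pairVertices es → c s x ≡ false × x ∉ avoid)
    matching-at sp zero avoid le = [] , refl , ([] , []) , λ ()
    matching-at {s} sp (suc m) avoid le =
      let es , len , bm , h = matching-at sp m avoid (≤-trans (+-monoˡ-≤ δ (+-monoʳ-≤ (length avoid) (*-monoʳ-≤ 2 (n≤1+n m)))) le)
      in add es len bm h
      where
      add : ∀ es → length es ≡ m → BlueMatching es → (∀ {x} → x ∈ pairVertices es → c s x ≡ false × x ∉ avoid) →
        Σ (List (Fin N × Fin N)) λ es → length es ≡ suc m × BlueMatching es ×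
          (∀ {x} → x ∈ pairVertices es → c s x ≡ false × x ∉ avoid)
      add es len (bs , ues) h = (q , x) ∷ es , cong suc len ,
        (qx ∷ bs , Unique-∷ q∉′ (Unique-∷ (λ i → x∉ (∈-++⁺ˡ (∈-++⁺ʳ avoid i))) ues)) ,
        λ { (here refl) → proj₁ (blue⁻ qb) , q∉ ∘ ∈-++⁺ˡ
          ; (there (here refl)) → proj₁ (blue⁻ xb) , x∉ ∘ ∈-++⁺ˡ ∘ ∈-++⁺ˡ
          ; (there (there i)) → h i }
        where
        avoid′ : List (Fin N)
        avoid′ = avoid ++ pairVertices es
        lenU : length avoid′ ≡ length avoid + 2 * m
        lenU = trans (length-++ avoid) (cong (length avoid +_) (trans (length-pairVertices es) (cong (2 *_) len)))
        arith₁ : ∀ a m d t → suc (a + 2 * m) + t + suc d ≡ t + (a + 2 * suc m + d)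
        arith₁ = solve-∀
        picked₁ = pick-cnt {p = blue s} avoid′ u₁
          (≤-trans (subst (_< τ) (≡-sym lenU) (linear (suc δ) le (arith₁ (length avoid) m δ τ))) (proj₁ sp))
        q : Fin N
        q = proj₁ picked₁
        q∈ : q ∈ Q₁
        q∈ = proj₁ (proj₂ picked₁)
        qb : blue s q ≡ true
        qb = proj₁ (proj₂ (proj₂ picked₁))
        q∉ : q ∉ avoid′
        q∉ = proj₂ (proj₂ (proj₂ picked₁))
        arith₂ : ∀ a m d e t → suc (a + 2 * m + e) + (t + d) + 1 ≡ t + (a + 2 * suc m + d + e)
        arith₂ = solve-∀
        picked₂ = pick-cnt {p = blue s} (avoid′ ++ sel (c q) Q₂) u₂ (≤-trans
          (subst (_< τ) (≡-sym (trans (length-++ avoid′) (cong₂ _+_ lenU (length-sel (c q) Q₂))))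
            (linear 1 (+-mono-≤ le (crossing q∈)) (arith₂ (length avoid) m δ (cnt (c q) Q₂) τ))) (proj₂ sp))
        x : Fin N
        x = proj₁ picked₂
        x∈ : x ∈ Q₂
        x∈ = proj₁ (proj₂ picked₂)
        xb : blue s x ≡ true
        xb = proj₁ (proj₂ (proj₂ picked₂))
        x∉ : x ∉ avoid′ ++ sel (c q) Q₂
        x∉ = proj₂ (proj₂ (proj₂ picked₂))
        qx : c q x ≡ false
        qx = ¬true⇒false λ e → x∉ (∈-++⁺ʳ avoid′ (sel⁺ {p = c q} x∈ e))
        q∉′ : q ∉ x ∷ pairVertices es
        q∉′ (here e) = apart x∈ (subst (_∈ Q₁) e q∈)
        q∉′ (there i) = q∉ (∈-++⁺ʳ avoid i)

    -- `avoid` contains all remaining centres from the start, so no fan uses the centre of a later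
    -- one; the vertices of each new fan are added to it. The final clause is what makes the fans
    -- disjoint.
    fans-at : ∀ ss avoid → Unique ss → (∀ {s} → s ∈ ss → s ∈ avoid × IsSpecial s) →
      length avoid + length ss * (2 * k) + δ ≤ τ →
      Σ (List (Fin N × List (Fin N × Fin N))) λ fans → length fans ≡ length ss × All (λ (v , es) → IsFan v es) fans ×
        Unique (concatMap fanVertices fans) × (∀ {x} → x ∈ concatMap fanVertices fans → x ∈ ss ⊎ x ∉ avoid)
    fans-at [] avoid uss h le = [] , refl , [] , [] , λ ()
    fans-at (s ∷ ss) avoid uss h le
      with es , lenE , (bs , ues) , hE ← matching-at (proj₂ (h (here refl))) k avoid
        (≤-trans (+-monoˡ-≤ δ (+-monoʳ-≤ (length avoid) (m≤m+n (2 * k) (length ss * (2 * k))))) le)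
      with fans , lenF , isFans , uF , hF ← fans-at ss (avoid ++ pairVertices es) (Unique-tail uss)
        (λ i → ∈-++⁺ˡ (proj₁ (h (there i))) , proj₂ (h (there i)))
        (≤-trans (≤-reflexive (trans (cong (λ z → z + length ss * (2 * k) + δ) (trans (length-++ avoid)
          (cong (length avoid +_) (trans (length-pairVertices es) (cong (2 *_) lenE)))))
          (cong (_+ δ) (+-assoc (length avoid) (2 * k) (length ss * (2 * k)))))) le)
      = (s , es) ∷ fans , cong suc lenF ,
        (lenE , bs , All.tabulate (proj₁ ∘ hE) , us) ∷ isFans , Uniqueₚ.++⁺ us uF (λ (i , j) → disjoint i j) , origin
      where
      s∈ : s ∈ avoid
      s∈ = proj₁ (h (here refl))
      us : Unique (s ∷ pairVertices es)
      us = Unique-∷ (λ i → proj₂ (hE i) s∈) ues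
      disjoint : ∀ {x} → x ∈ s ∷ pairVertices es → x ∈ concatMap fanVertices fans → ⊥
      disjoint (here refl) j = [ Unique-head uss , (λ x∉ → x∉ (∈-++⁺ˡ s∈)) ]′ (hF j)
      disjoint (there i) j = [ (λ l → proj₂ (hE i) (proj₁ (h (there l)))) , (λ x∉ → x∉ (∈-++⁺ʳ avoid i)) ]′ (hF j)
      origin : ∀ {x} → x ∈ (s ∷ pairVertices es) ++ concatMap fanVertices fans → x ∈ s ∷ ss ⊎ x ∉ avoid
      origin i with ∈-++⁻ (s ∷ pairVertices es) i
      ... | inj₁ (here e) = inj₁ (here e)
      ... | inj₁ (there j) = inj₂ (proj₂ (hE j))
      ... | inj₂ j with hF j
      ...   | inj₁ l = inj₁ (there l)
      ...   | inj₂ x∉ = inj₂ (x∉ ∘ ∈-++⁺ˡ)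

    special-fans : ∀ {ss} → Unique ss → (∀ {s} → s ∈ ss → IsSpecial s) → length ss * suc (2 * k) + δ ≤ τ → DisjointFans (length ss)
    special-fans {ss} uss h le = let fans , len , isFans , uq , _ = fans-at ss ss uss (λ i → i , h i)
                                       (≤-trans (≤-reflexive (cong (_+ δ) (≡-sym (*-suc (length ss) (2 * k))))) le)
                                 in fans , len , isFans , uq

-- The numerical bounds

-- The record type shields the unary numerals from being normalised wherever these bounds are in scope.
record Bounds (k t n ℓ : ℕ) : Set where
  field
    1≤k : 1 ≤ k
    1≤t : 1 ≤ t
    n-large : 161 * t ^ 2 * k ^ 4 ≤ n
    ℓ-small : ℓ * (204 * t * k ^ 3 + 147 * t * k ^ 2) ≤ n

module Numbers {k t n ℓ : ℕ} (bounds : Bounds k t n ℓ) where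
  open Bounds bounds

  -- `M` = t²k⁴ and `X` = ℓk³ are the quantities that the hypotheses compare with n; the other
  -- monomials are reduced to these and to `K` and `C`.
  K M C X : ℕ
  K = k * t
  M = K * K * (k * k)
  C = k * k * k
  X = ℓ * C

  inflate : ∀ a {b} → 1 ≤ b → a ≤ a * b
  inflate a {suc b} _ = m≤m*n a (suc b)

  1≤K : 1 ≤ K
  1≤K = *-mono-≤ 1≤k 1≤t

  t≤K : t ≤ K
  t≤K = ≤-trans (inflate t 1≤k) (≤-reflexive (*-comm t k))

  k≤K : k ≤ K
  k≤K = inflate k 1≤t

  1≤kk : 1 ≤ k * k
  1≤kk = *-mono-≤ 1≤k 1≤k

  K²≤M : K * K ≤ M
  K²≤M = inflate (K * K) 1≤kk

  K≤M : K ≤ M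
  K≤M = ≤-trans (inflate K 1≤K) K²≤M

  kK≤M : k * K ≤ M
  kK≤M = ≤-trans (*-monoˡ-≤ K k≤K) K²≤M

  C≤M : C ≤ M
  C≤M = ≤-trans (≤-reflexive (*-comm (k * k) k)) (*-monoˡ-≤ (k * k) (≤-trans k≤K (inflate K 1≤K)))

  1≤C : 1 ≤ C
  1≤C = *-mono-≤ 1≤kk 1≤k

  k≤C : k ≤ C
  k≤C = ≤-trans (inflate k 1≤kk) (≤-reflexive (*-comm k (k * k)))

  kk≤C : k * k ≤ C
  kk≤C = inflate (k * k) 1≤k

  161M≤n : 161 * M ≤ n
  161M≤n = ≤-trans (≤-reflexive (arith k t)) n-large
    where
    arith : ∀ k t → 161 * (k * t * (k * t) * (k * k)) ≡ 161 * (t * (t * 1)) * (k * (k * (k * (k * 1))))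
    arith = solve-∀

  204X≤n : 204 * X ≤ n
  204X≤n = ≤-trans (inflate (204 * X) 1≤t) (≤-trans (≤-trans (m≤m+n _ (147 * (ℓ * t * (k * k)))) (≤-reflexive (arith ℓ k t))) ℓ-small)
    where
    arith : ∀ l k t → 204 * (l * (k * k * k)) * t + 147 * (l * t * (k * k)) ≡
      l * (204 * t * (k * (k * (k * 1))) + 147 * t * (k * (k * 1)))
    arith = solve-∀

  ℓ≤X : ℓ ≤ X
  ℓ≤X = inflate ℓ 1≤C

  -- The size bound of `suspended⊎small` for h = 4k² + 2; expanded, 24ℓk² + 14ℓ + 8k² + 5.
  b : ℕ
  b = 2 * ℓ + 1 + (6 * ℓ + 2) * (4 * k * k + 2)

  -- Expanded, b · 4k + b is 96ℓk³ + 24ℓk² + 56ℓk + 14ℓ + 32k³ + 8k² + 20k + 5. Raising every power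
  -- of k to k³ gives 190X + 65C; the term 2K is what `W` may lack from 2n.
  capacity : 190 * X + 65 * C + 2 * K ≤ 2 * n
  capacity = linear (14 * X + 94 * M) (+-mono-≤ 204X≤n (+-mono-≤ 161M≤n (+-mono-≤ (*-monoʳ-≤ 65 C≤M) (*-monoʳ-≤ 2 K≤M)))) (arith X C K M n)
    where
    arith : ∀ x c k m n → 190 * x + 65 * c + 2 * k + (n + (n + (65 * m + 2 * m))) + (14 * x + 94 * m) ≡ 2 * n + (204 * x + (161 * m + (65 * c + 2 * k)))
    arith = solve-∀

  module _ {w : ℕ} (w-large : 2 * n ≤ w + 2 * K) where

    fits : 190 * X + 65 * C ≤ w
    fits = +-cancelʳ-≤ (2 * K) _ _ (≤-trans capacity w-large)

    nonempty : 0 < w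
    nonempty = ≤-trans 1≤C (≤-trans (≤-trans (m≤n*m C 65) (m≤n+m (65 * C) (190 * X))) fits)

    room₁ : b * (4 * k) + b ≤ w
    room₁ = ≤-trans (linear 0 (+-mono-≤ (+-mono-≤ (*-monoʳ-≤ 24 (*-monoʳ-≤ ℓ kk≤C)) (+-mono-≤ (*-monoʳ-≤ 56 (*-monoʳ-≤ ℓ k≤C)) (*-monoʳ-≤ 14 ℓ≤X)))
                      (+-mono-≤ (*-monoʳ-≤ 8 kk≤C) (+-mono-≤ (*-monoʳ-≤ 20 k≤C) (*-monoʳ-≤ 5 1≤C)))) (arith ℓ k)) fits
      where
      arith : ∀ l k → (2 * l + 1 + (6 * l + 2) * (4 * k * k + 2)) * (4 * k) + (2 * l + 1 + (6 * l + 2) * (4 * k * k + 2)) +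
        (24 * (l * (k * k * k)) + (56 * (l * (k * k * k)) + 14 * (l * (k * k * k))) + (8 * (k * k * k) + (20 * (k * k * k) + 5 * (k * k * k)))) + 0 ≡
        190 * (l * (k * k * k)) + 65 * (k * k * k) + (24 * (l * (k * k)) + (56 * (l * k) + 14 * l) + (8 * (k * k) + (20 * k + 5 * 1)))
      arith = solve-∀

    room₂ : 3 * b + 4 * k + 4 * ℓ ≤ w
    room₂ = ≤-trans (linear (72 * X + 22 * C) (+-mono-≤ (+-mono-≤ (*-monoʳ-≤ 72 (*-monoʳ-≤ ℓ kk≤C)) (*-monoʳ-≤ 46 ℓ≤X))
                      (+-mono-≤ (*-monoʳ-≤ 24 kk≤C) (+-mono-≤ (*-monoʳ-≤ 4 k≤C) (*-monoʳ-≤ 15 1≤C)))) (arith ℓ k)) fits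
      where
      arith : ∀ l k → 3 * (2 * l + 1 + (6 * l + 2) * (4 * k * k + 2)) + 4 * k + 4 * l +
        (72 * (l * (k * k * k)) + 46 * (l * (k * k * k)) + (24 * (k * k * k) + (4 * (k * k * k) + 15 * (k * k * k)))) +
        (72 * (l * (k * k * k)) + 22 * (k * k * k)) ≡
        190 * (l * (k * k * k)) + 65 * (k * k * k) + (72 * (l * (k * k)) + 46 * l + (24 * (k * k) + (4 * k + 15 * 1)))
      arith = solve-∀

  1≤M : 1 ≤ M
  1≤M = ≤-trans 1≤K K≤M

  2≤n : 2 ≤ n
  2≤n = linear 159 (+-mono-≤ 161M≤n (*-monoʳ-≤ 161 1≤M)) (arith n M)
    where
    arith : ∀ n m → 2 + (n + 161 * m) + 159 ≡ n + (161 * m + 161 * 1)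
    arith = solve-∀

  t≤n : t ≤ n
  t≤n = ≤-trans t≤K (≤-trans K≤M (≤-trans (m≤n*m M 161) 161M≤n))

  module _ {m : ℕ} (m≤ : m ≤ 2 * K) where

    m²≤ : m * m ≤ 4 * M
    m²≤ = ≤-trans (*-mono-≤ m≤ m≤) (≤-trans (≤-reflexive (arith K)) (*-monoʳ-≤ 4 K²≤M))
      where
      arith : ∀ k → 2 * k * (2 * k) ≡ 4 * (k * k)
      arith = solve-∀

    m≤2M : m ≤ 2 * M
    m≤2M = ≤-trans m≤ (*-monoʳ-≤ 2 K≤M)

    far-room : 5 * (m * (2 * m + 5)) + 8 * ℓ < n
    far-room = *-cancelˡ-≤ 3 (linear (49 * M + 180 * X) (+-mono-≤ (*-monoʳ-≤ 3 (+-mono-≤ (*-monoʳ-≤ 10 m²≤) (*-monoʳ-≤ 25 m≤2M)))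
        (+-mono-≤ (*-monoʳ-≤ 24 ℓ≤X) (+-mono-≤ 204X≤n (+-mono-≤ (*-monoʳ-≤ 2 161M≤n) (*-monoʳ-≤ 3 1≤M))))) (arith m ℓ n M X))
      where
      arith : ∀ m l n M x → 3 * suc (5 * (m * (2 * m + 5)) + 8 * l) + (3 * (10 * (4 * M) + 25 * (2 * M)) + (24 * x + (n + (2 * n + 3 * M)))) + (49 * M + 180 * x) ≡
        3 * n + (3 * (10 * (m * m) + 25 * m) + (24 * l + (204 * x + (2 * (161 * M) + 3 * 1))))
      arith = solve-∀

    absorb-room₁ : 8 * m + ℓ < n
    absorb-room₁ = *-cancelˡ-≤ 2 (linear (127 * M + 202 * X) (+-mono-≤ (*-monoʳ-≤ 16 m≤2M) (+-mono-≤ (*-monoʳ-≤ 2 ℓ≤X) (+-mono-≤ 204X≤n (+-mono-≤ 161M≤n (*-monoʳ-≤ 2 1≤M))))) (arith m ℓ n M X))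
      where
      arith : ∀ m l n M x → 2 * suc (8 * m + l) + (16 * (2 * M) + (2 * x + (n + (n + 2 * M)))) + (127 * M + 202 * x) ≡
        2 * n + (16 * m + (2 * l + (204 * x + (161 * M + 2 * 1))))
      arith = solve-∀

    module _ {q : ℕ} (q+m≡n : q + m ≡ n) where

      common-room : 2 * k * (2 * m) < q
      common-room = linear (150 * M) (+-mono-≤ (*-monoʳ-≤ (4 * k) m≤) (+-mono-≤ (≤-reflexive (≡-sym q+m≡n)) (+-mono-≤ m≤2M (+-mono-≤ 161M≤n (+-mono-≤ (*-monoʳ-≤ 8 kK≤M) 1≤M))))) (arith m k K n q M)
        where
        arith : ∀ m k K n q M → suc (2 * k * (2 * m)) + (4 * k * (2 * K) + ((q + m) + (2 * M + (n + (8 * M + M))))) + 150 * M ≡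
          q + (4 * k * m + (n + (m + (161 * M + (8 * (k * K) + 1)))))
        arith = solve-∀

      absorb-room₂ : ∀ {τ} → τ ≤ 7 * K → m * τ + 3 * m ≤ q
      absorb-room₂ {τ} τ≤ = linear (139 * M) (+-mono-≤ (*-mono-≤ m≤ τ≤) (+-mono-≤ (*-monoʳ-≤ 14 K²≤M) (+-mono-≤ (≤-reflexive (≡-sym q+m≡n)) (+-mono-≤ (*-monoʳ-≤ 4 m≤2M) 161M≤n)))) (arith m τ K n q M)
        where
        arith : ∀ m s K n q M → m * s + 3 * m + (2 * K * (7 * K) + (14 * M + ((q + m) + (4 * (2 * M) + n)))) + 139 * M ≡
          q + (m * s + (14 * (K * K) + (n + (4 * m + 161 * M))))
        arith = solve-∀

  special-room : ∀ {m′} → m′ ≤ 2 * K → t * suc (2 * k) + 2 * m′ ≤ 7 * K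
  special-room {m′} m′≤ = linear 0 (+-mono-≤ t≤K (*-monoʳ-≤ 2 m′≤)) (arith t k m′)
    where
    arith : ∀ t k m → t * suc (2 * k) + 2 * m + (k * t + 2 * (2 * (k * t))) + 0 ≡ 7 * (k * t) + (t + 2 * m)
    arith = solve-∀

-- The upper bound

connected⇒1≤deg : ∀ {n} (G : Graph n) → Connected G → 2 ≤ n → ∀ v → 1 ≤ deg G v
connected⇒1≤deg {n} G conn 2≤n v
  with u , _ , u∉ ← pick (v ∷ []) (Unique-all {n}) (subst (2 ≤_) (≡-sym length-allFin) 2≤n) with conn v u
... | here = ⊥-elim (u∉ (here refl))
... | step {v = p} e _ = subst (1 ≤_) (length-nbrs G v) (⊆-length {xs = p ∷ []} ([] ∷ []) λ { (here refl) → nbrs⁺ G e })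

module Upper {N : ℕ} (c : Colouring N) (c-sym : SymmetricColouring c) (k t′ n : ℕ) (G : Graph n) (ℓ : ℕ) (bounds : Bounds k (suc t′) n ℓ)
  (conn : Connected G) (sparse : degSum G ≤ 2 * n + 2 * ℓ) (N≡ : N + 1 ≡ 2 * n + t′)
  (noRed : ¬ ContainsCopy c true G) (noFans : ¬ Fans.DisjointFans c c-sym k (suc t′)) where
  open Host c c-sym
  open Fan k
  open Fans c c-sym k
  open Bounds bounds using (1≤k)
  open Numbers bounds

  minDeg : ∀ v → 1 ≤ deg G v
  minDeg = connected⇒1≤deg G conn 2≤n

  y₀ : Fin N
  y₀ = proj₁ (pick [] (Unique-all {N}) (subst (1 ≤_) (≡-sym length-allFin) 1≤N))
    where
    arith : ∀ N n t → 1 + (N + 1 + 2 * n) + (2 + t) ≡ N + (2 * n + t + 2 * 2)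
    arith = solve-∀
    1≤N : 1 ≤ N
    1≤N = linear (2 + t′) (+-mono-≤ (≤-reflexive (≡-sym N≡)) (*-monoʳ-≤ 2 2≤n)) (arith N n t′)

  open Cliques c c-sym k y₀ G noRed ℓ sparse minDeg

  short : ∀ {Q} → RedClique Q → Unique Q → length Q < n
  short {Q} rcl uQ = ≰⇒> λ le → noRed (clique-copy {G = G} {Q} y₀ rcl uQ le)

  deficit : ∀ {q} → q < n → Σ ℕ λ m → q + m ≡ n
  deficit {q} q<n = n ∸ q , m+[n∸m]≡n (<⇒≤ q<n)

  deficit≤ : ∀ {q m} → q + m ≡ n → n ≤ q + 2 * K → m ≤ 2 * K
  deficit≤ {q} {m} e le = +-cancelˡ-≤ q m (2 * K) (≤-trans (≤-reflexive e) le)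

  -- Every vertex that is not special is blue to few vertices of Q₁ or of Q₂; fewer than t vertices are
  -- special, so one of the two cliques can be completed to n vertices.
  two-cliques : ∀ {Q₁ Q₂ m} → RedClique Q₁ → RedClique Q₂ → Unique Q₁ → Unique Q₂ → (∀ {x} → x ∈ Q₂ → x ∉ Q₁) →
    n ≤ length Q₁ + 2 * K → n ≤ length Q₂ + 2 * K → m ≤ 2 * K → (∀ {q} → q ∈ Q₁ → cnt (c q) Q₂ ≤ 2 * m) → ⊥
  two-cliques {Q₁} {Q₂} {m} rcl₁ rcl₂ u₁ u₂ apart len₁ len₂ m≤ crossing =
    [ many , (λ few → [ finish rcl₁ u₁ len₁ , finish rcl₂ u₂ len₂ ]′ (one-large few)) ]′ (≤-<-connex (suc t′) (cnt isSpecial (allFin N)))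
    where
    τ : ℕ
    -- Room for t disjoint fans with 2k + 1 vertices each, plus the at most 2m vertices of `Q₂` red
    -- to a given vertex of `Q₁`.
    τ = suc t′ * suc (2 * k) + 2 * m
    low : List (Fin N) → Fin N → Bool
    low Q v = cnt (blue v) Q <ᵇ τ
    isSpecial : Fin N → Bool
    isSpecial v = not (low Q₁ v) ∧ not (low Q₂ v)
    open Special u₁ u₂ apart {2 * m} {τ} crossing
    S : List (Fin N)
    S = take (suc t′) (sel isSpecial (allFin N))
    high : ∀ Q v → not (low Q v) ≡ true → τ ≤ cnt (blue v) Q
    high Q v e = ≮⇒≥ λ lt → true≢false e (cong not (<ᵇ-true lt))
    S-special : ∀ {s} → s ∈ S → IsSpecial s
    S-special {s} i = let e₁ , e₂ = ∧-true {not (low Q₁ s)} (proj₂ (sel⁻ {p = isSpecial} {xs = allFin N} (take-⊆ (suc t′) i))) in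
      high Q₁ s e₁ , high Q₂ s e₂
    many : suc t′ ≤ cnt isSpecial (allFin N) → ⊥
    many le = noFans (subst DisjointFans lenS (special-fans (Uniqueₚ.take⁺ (suc t′) (sel-Unique isSpecial Unique-all)) S-special
                (≤-reflexive (cong (λ z → z * suc (2 * k) + 2 * m) lenS))))
      where
      lenS : length S ≡ suc t′
      lenS = length-take≤ (suc t′) (sel isSpecial (allFin N)) (subst (suc t′ ≤_) (≡-sym (length-sel isSpecial (allFin N))) le)
    finish : ∀ {Q} → RedClique Q → Unique Q → n ≤ length Q + 2 * K → n ≤ cnt (low Q) (allFin N) → ⊥
    finish {Q} rcl uQ len le =
      let d , e = deficit (short rcl uQ)
          d≤ = deficit≤ e len
      in absorb {V = sel (low Q) (allFin N)} rcl uQ (sel-Unique (low Q) Unique-all)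
           (λ {v} i → <⇒≤ (<ᵇ-true⁻ {cnt (blue v) Q} {τ} (proj₂ (sel⁻ {p = low Q} {xs = allFin N} i))))
           (subst (n ≤_) (≡-sym (length-sel (low Q) (allFin N))) le) e (absorb-room₁ d≤) (absorb-room₂ d≤ e (special-room m≤))
    pointwise : ∀ a b → 1 ≤ (if not a ∧ not b then 1 else 0) + ((if a then 1 else 0) + (if b then 1 else 0))
    pointwise true b = s≤s z≤n
    pointwise false true = s≤s z≤n
    pointwise false false = s≤s z≤n
    covered : N ≤ cnt isSpecial (allFin N) + (cnt (low Q₁) (allFin N) + cnt (low Q₂) (allFin N))
    covered = ≤-trans (≤-reflexive (trans (≡-sym (length-allFin {N})) (trans (≡-sym (*-identityʳ _)) (≡-sym (sumOver-const 1 (allFin N))))))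
      (≤-trans (sumOver-mono (allFin N) λ {v} _ → pointwise (low Q₁ v) (low Q₂ v))
        (≤-reflexive (trans (sumOver-+ _ _ (allFin N)) (cong (cnt isSpecial (allFin N) +_) (sumOver-+ _ _ (allFin N))))))
    one-large : cnt isSpecial (allFin N) < suc t′ → n ≤ cnt (low Q₁) (allFin N) ⊎ n ≤ cnt (low Q₂) (allFin N)
    one-large few with n ≤? cnt (low Q₁) (allFin N) | n ≤? cnt (low Q₂) (allFin N)
    ... | yes le | _ = inj₁ le
    ... | no _ | yes le = inj₂ le
    -- The exact count: (n - 1) + (n - 1) + (t - 1) is one less than N, so some vertex would belong
    -- to none of the three sets.
    ... | no g₁ | no g₂ = ⊥-elim (<-irrefl refl (linear {l = 1} {r = 0} 0
            (+-mono-≤ (+-mono-≤ (≰⇒> g₁) (≰⇒> g₂)) (+-mono-≤ (≤-pred few) (+-mono-≤ covered (≤-reflexive (≡-sym N≡)))))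
            (arith (cnt (low Q₁) (allFin N)) (cnt (low Q₂) (allFin N)) (cnt isSpecial (allFin N)) n N t′)))
      where
      arith : ∀ a b s n N t → 1 + (n + n + (t + (s + (a + b) + (N + 1)))) + 0 ≡ 0 + (suc a + suc b + (s + (N + (2 * n + t))))
      arith = solve-∀

  first-clique : ∀ {W} → Unique W → FanFree W → ∀ {y} → y ∈ W → b * (4 * k) + b ≤ length W → 3 * b + 4 * k + 4 * ℓ ≤ length W →
    Σ (List (Fin N)) λ Q → Unique Q × (∀ {x} → x ∈ Q → x ∈ W) × RedClique Q × length W + 3 ≤ length Q + 2 * k + n
  first-clique {W} uW ff {y} y∈ room₁ room₂ = [ (λ (f , E , _) → ⊥-elim (noRed (copy E ∈-all))) , id ]′
    (embed⊎clique n G (allFin n) reduced ≤-refl)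
    where
    open Reduction c c-sym k W uW ff y y∈ {n} ℓ b refl room₁ room₂
    reduced : Reduced G (allFin n) n
    reduced = record { unique = Unique-all ; size = length-allFin ; closed = λ {u} _ → ∈-all u ; connected = λ {u} {v} _ _ → conn u v ; sparse = sparse }

  clique-contradiction : ∀ {W Q m} → 2 * n ≤ length W + 1 + 2 * k * t′ → Unique W → FanFree W →
    Unique Q → (∀ {x} → x ∈ Q → x ∈ W) → RedClique Q → length W + 3 ≤ length Q + 2 * k + n → length Q + m ≡ n → ⊥
  clique-contradiction {W} {Q} {m} lenW uW ff uQ Q⊆ rcl len e =
    from-second (second-clique uW ff rcl uQ Q⊆ (≤-reflexive (≡-sym e)) (far-room m≤) (common-room m≤ e))
    where
    n≤Q : n ≤ length Q + 2 * K
    n≤Q = linear 2 (+-mono-≤ len lenW) (arith n (length Q) (length W) k t′)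
      where
      arith : ∀ n q w k t → n + (q + 2 * k + n + (w + 1 + 2 * k * t)) + 2 ≡ q + 2 * (k * suc t) + (w + 3 + 2 * n)
      arith = solve-∀
    m≤ : m ≤ 2 * K
    m≤ = deficit≤ e n≤Q
    from-second : SecondClique W Q m → ⊥
    from-second S = [ two-cliques {m = m} rcl clique uQ unique apart n≤Q n≤Q₂ m≤
                    , two-cliques {m = m} clique rcl unique uQ (λ i j → apart j i) n≤Q₂ n≤Q m≤ ]′ crossing
      where
      open SecondClique S
      n≤Q₂ : n ≤ length Q₂ + 2 * K
      n≤Q₂ = linear 1 (+-mono-≤ (≤-reflexive e) (+-mono-≤ large lenW)) (arith n (length Q₂) (length Q) m (length W) k t′)
        where
        arith : ∀ n z q m w k t → n + (n + (z + q + m + 2 * k + (w + 1 + 2 * k * t))) + 1 ≡ z + 2 * (k * suc t) + (q + m + (w + 2 + 2 * n))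
        arith = solve-∀

  fan-free-contradiction : ∀ U → length U ≤ t′ * suc (2 * k) → FanFree (allFin N ∖ U) → ⊥
  fan-free-contradiction U lenU ff =
    let y , y∈ , _ = pick [] uW 0<W
        Q , uQ , Q⊆ , rcl , len = first-clique uW ff y∈ (room₁ lenW′) (room₂ lenW′)
    in clique-contradiction lenW uW ff uQ Q⊆ rcl len (proj₂ (deficit (short rcl uQ)))
    where
    W : List (Fin N)
    W = allFin N ∖ U
    uW : Unique W
    uW = ∖-Unique U Unique-all
    lenW : 2 * n ≤ length W + 1 + 2 * k * t′
    lenW = linear 0 (+-mono-≤ lenU (+-mono-≤ (≤-trans (≤-reflexive (≡-sym (length-allFin {N}))) (∖-length U Unique-all)) (≤-reflexive (≡-sym N≡))))
      (arith n (length W) (length U) N k t′)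
      where
      arith : ∀ n w u N k t → 2 * n + (t * suc (2 * k) + (w + u + (N + 1))) + 0 ≡ w + 1 + 2 * k * t + (u + (N + (2 * n + t)))
      arith = solve-∀
    lenW′ : 2 * n ≤ length W + 2 * K
    lenW′ = linear 0 (+-mono-≤ lenW (≤-trans 1≤k (m≤m+n k (k + 0)))) (arith n (length W) k t′)
      where
      arith : ∀ n w k t → 2 * n + (w + 1 + 2 * k * t + 2 * k) + 0 ≡ w + 2 * (k * suc t) + (2 * n + 1)
      arith = solve-∀
    0<W : 0 < length W
    0<W = nonempty lenW′

  impossible : ⊥
  impossible = fan-free-complement t′ noFans fan-free-contradiction

-- `edgeCount` sees a pair only with its smaller index first; the pairs in the opposite order are
-- counted by the transposed sum.
degSum≤2edges : ∀ {n} (G : Graph n) → degSum G ≤ 2 * edgeCount G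
degSum≤2edges {n} G = ≤-trans (sumOver-mono all λ {u} _ → ≤-trans (sumOver-mono all λ {v} _ → pointwise u v) (≤-reflexive (sumOver-+ _ _ all)))
  (≤-reflexive (trans (sumOver-+ _ _ all) (cong (edgeCount G +_) (trans (sumOver-swap down all all)
    (trans (sumOver-cong all (λ v → sumOver-cong all λ u → cong (λ z → if (toℕ v <ᵇ toℕ u) ∧ z then 1 else 0) (sym G u v))) (≡-sym (+-identityʳ _)))))))
  where
  all = allFin n
  down : Fin n → Fin n → ℕ
  down u v = if (toℕ v <ᵇ toℕ u) ∧ adj G u v then 1 else 0
  pointwise : ∀ u v → (if adj G u v then 1 else 0) ≤ (if (toℕ u <ᵇ toℕ v) ∧ adj G u v then 1 else 0) + down u v
  pointwise u v with adj G u v in e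
  ... | false = z≤n
  ... | true with <-cmp (toℕ u) (toℕ v)
  ...   | tri< lt _ _ rewrite <ᵇ-true lt = s≤s z≤n
  ...   | tri≈ _ eq _ = ⊥-elim (adj-≢ G e (toℕ-injective eq))
  ...   | tri> _ _ gt rewrite <ᵇ-true gt = m≤n+m 1 _

-- Deciding containment, and copies of `tFan` from disjoint fans

function-exists? : ∀ {N} m (P : (Fin m → Fin N) → Set) → (∀ f → Dec (P f)) →
  (∀ {f g} → (∀ i → f i ≡ g i) → P f → P g) → Dec (Σ (Fin m → Fin N) P)
function-exists? zero P P? ext with P? (λ ())
... | yes p = yes (_ , p)
... | no ¬p = no λ (f , p) → ¬p (ext (λ ()) p)
function-exists? {N} (suc m) P P? ext
  with any? (λ a → function-exists? m (λ g → P (cons a g)) (λ g → P? (cons a g)) λ h → ext λ { zero → refl ; (suc i) → h i })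
  where
  cons : Fin N → (Fin m → Fin N) → Fin (suc m) → Fin N
  cons a g zero = a
  cons a g (suc i) = g i
... | yes (a , g , p) = yes (_ , p)
-- `f` is only pointwise equal to the function rebuilt from its value at `zero` and its restriction,
-- hence the extensionality assumption on `P`.
... | no none = no λ (f , p) → none (f zero , f ∘ suc , ext (λ { zero → refl ; (suc i) → refl }) p)

-- The upper bound refutes the absence of both copies. Exhaustive search over the finitely many maps
-- turns this refutation into an actual copy.
containsCopy? : ∀ {N m} (c : Colouring N) b (H : Graph m) → Dec (ContainsCopy c b H)
containsCopy? c b H = function-exists? _ _
  (λ f → map′ (λ h {u} {v} → h u v) (λ h u v → h {u} {v}) (all? λ u → all? λ v → (f u ≟ f v) →-dec (u ≟ v))
    ×-dec (all? λ u → all? λ v → (adj H u v Boolₚ.≟ true) →-dec (c (f u) (f v) Boolₚ.≟ b)))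
  λ h (inj , hom) → (λ {u} {v} e → inj (trans (h u) (trans e (≡-sym (h v))))) ,
    λ u v e → trans (≡-sym (cong₂ c (h u) (h v))) (hom u v e)

-- Positions are plain numbers because the vertices of `tFan` are addressed by quotients and
-- remainders.
data At {A : Set} : List A → ℕ → A → Set where
  here : ∀ {x xs} → At (x ∷ xs) 0 x
  there : ∀ {x y xs i} → At xs i x → At (y ∷ xs) (suc i) x

At-∈ : ∀ {A : Set} {xs : List A} {i x} → At xs i x → x ∈ xs
At-∈ here = here refl
At-∈ (there a) = there (At-∈ a)

At-total : ∀ {A : Set} (xs : List A) i → i < length xs → Σ A (At xs i)
At-total (x ∷ xs) zero _ = x , here
At-total (x ∷ xs) (suc i) (s≤s lt) = let y , a = At-total xs i lt in y , there a

At-functional : ∀ {A : Set} {xs : List A} {i x y} → At xs i x → At xs i y → x ≡ y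
At-functional here here = refl
At-functional (there a) (there b) = At-functional a b

At-injective : ∀ {A : Set} {xs : List A} {i j x} → Unique xs → At xs i x → At xs j x → i ≡ j
At-injective u here here = refl
At-injective u here (there b) = ⊥-elim (Unique-head u (At-∈ b))
At-injective u (there a) here = ⊥-elim (Unique-head u (At-∈ a))
At-injective u (there a) (there b) = cong suc (At-injective (Unique-tail u) a b)

At-++ˡ : ∀ {A : Set} (xs : List A) {ys i x} → i < length xs → At (xs ++ ys) i x → At xs i x
At-++ˡ (x ∷ xs) lt here = here
At-++ˡ (x ∷ xs) (s≤s lt) (there a) = there (At-++ˡ xs lt a)

At-++ʳ : ∀ {A : Set} (xs : List A) {ys i x} → At (xs ++ ys) (length xs + i) x → At ys i x
At-++ʳ [] a = a
At-++ʳ (x ∷ xs) (there a) = At-++ʳ xs a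

≡ᵇ-true : ∀ {a b} → (a ≡ᵇ b) ≡ true → a ≡ b
≡ᵇ-true {a} {b} e = ≡ᵇ⇒≡ a b (subst T (≡-sym e) _)

half-suc : ∀ i → suc (suc i) / 2 ≡ suc (i / 2)
half-suc i = m/n≡1+[m∸n]/n {suc (suc i)} {2} (s≤s (s≤s z≤n))

module FanCopy {N : ℕ} (c : Colouring N) (c-sym : SymmetricColouring c) (k : ℕ) where
  open Host c c-sym
  open Fan k
  open Fans c c-sym k

  -- `pairVertices` puts the ends of the i-th pair at positions 2i and 2i + 1. This is the pairing
  -- of `fanAdjℕ`, which subtracts 1 for the centre before halving.
  pair-blue : ∀ es {i j x y} → All (λ (a , b) → c a b ≡ false) es → At (pairVertices es) i x → At (pairVertices es) j y →
    i / 2 ≡ j / 2 → i ≢ j → c x y ≡ false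
  pair-blue (_ ∷ _) _ here here _ ne = ⊥-elim (ne refl)
  pair-blue (_ ∷ _) (b ∷ _) here (there here) _ _ = b
  pair-blue (_ ∷ _) (b ∷ _) here (there (there {i = j} _)) e _ with () ← trans e (half-suc j)
  pair-blue ((x , y) ∷ _) (b ∷ _) (there here) here _ _ = trans (c-sym y x) b
  pair-blue (_ ∷ _) _ (there here) (there here) _ ne = ⊥-elim (ne refl)
  pair-blue (_ ∷ _) _ (there here) (there (there {i = j} _)) e _ with () ← trans e (half-suc j)
  pair-blue (_ ∷ _) _ (there (there {i = i} _)) here e _ with () ← trans (≡-sym e) (half-suc i)
  pair-blue (_ ∷ _) _ (there (there {i = i} _)) (there here) e _ with () ← trans (≡-sym e) (half-suc i)
  pair-blue (_ ∷ es) (_ ∷ bs) (there (there {i = i} p)) (there (there {i = j} q)) e ne = pair-blue es bs p q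
    (suc-injective (trans (≡-sym (half-suc i)) (trans e (half-suc j)))) (λ e′ → ne (cong (2 +_) e′))

  fan-blue : ∀ {v es i j x y} → IsFan v es → At (fanVertices (v , es)) i x → At (fanVertices (v , es)) j y →
    fanAdjℕ i j ≡ true → c x y ≡ false
  fan-blue _ here here ()
  fan-blue (_ , _ , vb , _) here (there q) _ = All.lookup vb (At-∈ q)
  fan-blue {v} {x = x} (_ , _ , vb , _) (there p) here _ = trans (c-sym x v) (All.lookup vb (At-∈ p))
  fan-blue {es = es} (_ , bs , _ , _) (there {i = i} p) (there {i = j} q) e =
    let ne , half = ∧-true e in
    pair-blue es bs p q (≡ᵇ-true half) λ i≡j → true≢false ne (cong not (subst (λ z → (i ≡ᵇ z) ≡ true) i≡j (≡ᵇ-refl i)))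

  -- Every fan occupies a block of exactly 2k + 1 positions, so quotient and remainder are the
  -- number of the fan and the position inside it.
  locate : ∀ {fans} q {r x} → All (λ (v , es) → IsFan v es) fans → r < suc (2 * k) →
    At (concatMap fanVertices fans) (r + q * suc (2 * k)) x →
    Σ (Fin N × List (Fin N × Fin N)) λ F → At fans q F × At (fanVertices F) r x
  locate {F ∷ fans} zero {r} {x} (h ∷ hs) r< a = F , here ,
    At-++ˡ (fanVertices F) (subst (r <_) (≡-sym (length-fan h)) r<) (subst (λ z → At (concatMap fanVertices (F ∷ fans)) z x) (+-identityʳ r) a)
  locate {F ∷ fans} (suc q) {r} {x} (h ∷ hs) r< a =
    let F′ , p , p′ = locate q hs r< (At-++ʳ (fanVertices F) (subst (λ z → At (concatMap fanVertices (F ∷ fans)) z x) shuffle a))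
    in F′ , there p , p′
    where
    shuffle : r + (suc (2 * k) + q * suc (2 * k)) ≡ length (fanVertices F) + (r + q * suc (2 * k))
    shuffle = trans (arith r (suc (2 * k)) (q * suc (2 * k))) (cong (_+ (r + q * suc (2 * k))) (≡-sym (length-fan h)))
      where
      arith : ∀ r m z → r + (m + z) ≡ m + (r + z)
      arith = solve-∀

  fans⇒copy : ∀ {t} → DisjointFans t → ContainsCopy c false (tFan t k)
  fans⇒copy {t} (fans , len , isFans , uq) = f , inj′ , hom′
    where
    m = suc (2 * k)
    vs = concatMap fanVertices fans
    in-range : ∀ (u : Fin (t * m)) → toℕ u < length vs
    in-range u = subst (toℕ u <_) (≡-sym (trans (length-fans isFans) (cong (_* m) len))) (toℕ<n u)
    f : Fin (t * m) → Fin N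
    f u = proj₁ (At-total vs (toℕ u) (in-range u))
    f-at : ∀ u → At vs (toℕ u) (f u)
    f-at u = proj₂ (At-total vs (toℕ u) (in-range u))
    inj′ : ∀ {u v} → f u ≡ f v → u ≡ v
    inj′ {u} {v} e = toℕ-injective (At-injective uq (f-at u) (subst (At vs (toℕ v)) (≡-sym e) (f-at v)))
    fan-at : ∀ u → Σ (Fin N × List (Fin N × Fin N)) λ F → At fans (toℕ u / m) F × At (fanVertices F) (toℕ u % m) (f u)
    fan-at u = locate (toℕ u / m) isFans (m%n<n (toℕ u) m) (subst (λ z → At vs z (f u)) (m≡m%n+[m/n]*n (toℕ u) m) (f-at u))
    hom′ : ∀ u v → adj (tFan t k) u v ≡ true → c (f u) (f v) ≡ false
    hom′ u v e with F , p , p′ ← fan-at u | F′ , q , q′ ← fan-at v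
      with refl ← At-functional p (subst (λ z → At fans z F′) (≡-sym (≡ᵇ-true (proj₁ (∧-true e)))) q)
      = fan-blue (All.lookup isFans (At-∈ p)) p′ q′ (proj₂ (∧-true {(toℕ u / m) ≡ᵇ (toℕ v / m)} e))

-- The lower bound

no-injection-into-interval : ∀ {p N} lo w (f : Fin p → Fin N) → (∀ {u v} → f u ≡ f v → u ≡ v) →
  (∀ v → lo ≤ toℕ (f v) × toℕ (f v) < lo + w) → p ≤ w
no-injection-into-interval {p} {N} lo w f inj range = injective⇒≤ {f = g} λ {u} {v} e → inj (toℕ-injective
  (trans (≡-sym (m∸n+n≡m (proj₁ (range u)))) (trans (cong (_+ lo) (trans (≡-sym (toℕ-fromℕ< (below u))) (trans (cong toℕ e) (toℕ-fromℕ< (below v)))))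
    (m∸n+n≡m (proj₁ (range v))))))
  where
  below : ∀ v → toℕ (f v) ∸ lo < w
  below v = +-cancelʳ-< lo (toℕ (f v) ∸ lo) w
    (subst (_< w + lo) (≡-sym (m∸n+n≡m (proj₁ (range v)))) (subst (toℕ (f v) <_) (+-comm lo w) (proj₂ (range v))))
  g : Fin p → Fin w
  g v = fromℕ< (below v)

-- Here s = n - 1 and t′ = t - 1. The last class may be smaller than t′ or missing, so the same
-- construction refutes every smaller order; t′ ≤ s makes this class too small for `G` as well.
module Lower {N : ℕ} (s t′ : ℕ) (t′≤s : t′ ≤ s) (N≤ : N ≤ s + s + t′) where

  class : Fin N → ℕ
  class x = if toℕ x <ᵇ s then 0 else if toℕ x <ᵇ s + s then 1 else 2

  colouring : Colouring N
  colouring x y = class x ≡ᵇ class y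

  colouring-sym : SymmetricColouring colouring
  colouring-sym x y = ≡ᵇ-sym (class x) (class y)

  <ᵇ-false⁻ : ∀ {a b} → (a <ᵇ b) ≡ false → b ≤ a
  <ᵇ-false⁻ e = ≮⇒≥ λ lt → true≢false (<ᵇ-true lt) e

  class-cases : ∀ x → (class x ≡ 0 × toℕ x < s) ⊎ (class x ≡ 1 × s ≤ toℕ x × toℕ x < s + s) ⊎ (class x ≡ 2 × s + s ≤ toℕ x × toℕ x < s + s + t′)
  class-cases x with toℕ x <ᵇ s in e₁
  ... | true = inj₁ (refl , <ᵇ-true⁻ {toℕ x} {s} e₁)
  ... | false with toℕ x <ᵇ s + s in e₂
  ...   | true = inj₂ (inj₁ (refl , <ᵇ-false⁻ {toℕ x} e₁ , <ᵇ-true⁻ {toℕ x} {s + s} e₂))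
  ...   | false = inj₂ (inj₂ (refl , <ᵇ-false⁻ {toℕ x} e₂ , ≤-trans (toℕ<n x) N≤))

  no-red : ∀ {G : Graph (suc s)} → Connected G → ¬ ContainsCopy colouring true G
  no-red {G} conn (f , inj , hom) = <-irrefl refl absurd
    where
    same : ∀ {u v} → Reachable G u v → class (f u) ≡ class (f v)
    same here = refl
    same (step e r) = trans (≡ᵇ-true (hom _ _ e)) (same r)
    v₀ : Fin (suc s)
    v₀ = zero
    into : ∀ lo w → w ≤ s → (∀ x → class x ≡ class (f v₀) → lo ≤ toℕ x × toℕ x < lo + w) → suc s ≤ s
    into lo w w≤s h = ≤-trans (no-injection-into-interval lo w f inj λ v → h (f v) (same (conn v v₀))) w≤s
    absurd : suc s ≤ s
    absurd with class (f v₀) | class-cases (f v₀) | into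
    ... | .0 | inj₁ (refl , _) | into′ = into′ 0 s ≤-refl λ x e → z≤n , first x e
      where
      first : ∀ x → class x ≡ 0 → toℕ x < s
      first x e with class-cases x
      ... | inj₁ (_ , lt) = lt
      ... | inj₂ (inj₁ (e′ , _)) with () ← trans (≡-sym e) e′
      ... | inj₂ (inj₂ (e′ , _)) with () ← trans (≡-sym e) e′
    ... | .1 | inj₂ (inj₁ (refl , _)) | into′ = into′ s s ≤-refl second
      where
      second : ∀ x → class x ≡ 1 → s ≤ toℕ x × toℕ x < s + s
      second x e with class-cases x
      ... | inj₁ (e′ , _) with () ← trans (≡-sym e) e′
      ... | inj₂ (inj₁ (_ , r)) = r
      ... | inj₂ (inj₂ (e′ , _)) with () ← trans (≡-sym e) e′
    ... | .2 | inj₂ (inj₂ (refl , _)) | into′ = into′ (s + s) t′ t′≤s third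
      where
      third : ∀ x → class x ≡ 2 → s + s ≤ toℕ x × toℕ x < s + s + t′
      third x e with class-cases x
      ... | inj₁ (e′ , _) with () ← trans (≡-sym e) e′
      ... | inj₂ (inj₁ (e′ , _)) with () ← trans (≡-sym e) e′
      ... | inj₂ (inj₂ (_ , r)) = r

  third-class : ∀ x y z → colouring x y ≡ false → colouring x z ≡ false → colouring y z ≡ false →
    (s + s ≤ toℕ x × toℕ x < s + s + t′) ⊎ (s + s ≤ toℕ y × toℕ y < s + s + t′) ⊎ (s + s ≤ toℕ z × toℕ z < s + s + t′)
  third-class x y z xy xz yz with class x | class y | class z | class-cases x | class-cases y | class-cases z
  ... | _ | _ | _ | inj₂ (inj₂ (_ , r)) | _ | _ = inj₁ r
  ... | _ | _ | _ | _ | inj₂ (inj₂ (_ , r)) | _ = inj₂ (inj₁ r)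
  ... | _ | _ | _ | _ | _ | inj₂ (inj₂ (_ , r)) = inj₂ (inj₂ r)
  third-class x y z () xz yz | _ | _ | _ | inj₁ (refl , _) | inj₁ (refl , _) | _
  third-class x y z xy () yz | _ | _ | _ | inj₁ (refl , _) | inj₂ (inj₁ _) | inj₁ (refl , _)
  third-class x y z xy xz () | _ | _ | _ | inj₁ _ | inj₂ (inj₁ (refl , _)) | inj₂ (inj₁ (refl , _))
  third-class x y z xy xz () | _ | _ | _ | inj₂ (inj₁ _) | inj₁ (refl , _) | inj₁ (refl , _)
  third-class x y z xy () yz | _ | _ | _ | inj₂ (inj₁ (refl , _)) | inj₁ _ | inj₂ (inj₁ (refl , _))
  third-class x y z () xz yz | _ | _ | _ | inj₂ (inj₁ (refl , _)) | inj₂ (inj₁ (refl , _)) | _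

  -- One triangle per copy is enough: it supplies a vertex of the last class, and distinct copies
  -- supply distinct vertices, so t′ + 1 of them would lie in an interval of length t′.
  no-blue : ∀ k → 1 ≤ k → ¬ ContainsCopy colouring false (tFan (suc t′) k)
  no-blue (suc k) _ (f , inj , hom) = <-irrefl refl
    (no-injection-into-interval (s + s) t′ (λ i → f (combine i (proj₁ (apex i))))
      (λ {i} {j} e → combine-injectiveˡ i (proj₁ (apex i)) j (proj₁ (apex j)) (inj e)) (λ i → proj₂ (apex i)))
    where
    m : ℕ
    m = suc (2 * suc k)
    2k≡ : suc (suc (2 * k)) ≡ 2 * suc k
    2k≡ = ≡-sym (*-suc 2 k)
    position : ∀ j → j < 3 → Fin m
    position j j<3 = fromℕ< {j} (≤-trans j<3 (s≤s (≤-trans (s≤s (s≤s z≤n)) (≤-reflexive 2k≡))))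
    toℕ-position : ∀ j (j<3 : j < 3) → toℕ (position j j<3) ≡ j
    toℕ-position j j<3 = toℕ-fromℕ< _
    -- `combine i j` is position `j` of copy `i`; written remainder first, it can be divided by `m`
    -- directly.
    value : ∀ (i : Fin (suc t′)) j → toℕ (combine i j) ≡ toℕ j + toℕ i * m
    value i j = trans (toℕ-combine i j) (trans (+-comm (m * toℕ i) (toℕ j)) (cong (toℕ j +_) (*-comm m (toℕ i))))
    quotient : ∀ (i : Fin (suc t′)) j → toℕ (combine i j) / m ≡ toℕ i
    quotient i j = trans (cong (_/ m) (value i j)) (trans (+-distrib-/-∣ʳ (toℕ j) (divides-refl (toℕ i)))
      (cong₂ _+_ (m<n⇒m/n≡0 (toℕ<n j)) (m*n/n≡m (toℕ i) m)))
    remainder : ∀ (i : Fin (suc t′)) j → toℕ (combine i j) % m ≡ toℕ j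
    remainder i j = trans (cong (_% m) (value i j)) (trans ([m+kn]%n≡m%n (toℕ j) (toℕ i) m) (m<n⇒m%n≡m (toℕ<n j)))
    edge : ∀ i j j′ → fanAdjℕ (toℕ j) (toℕ j′) ≡ true → colouring (f (combine i j)) (f (combine i j′)) ≡ false
    edge i j j′ e = hom (combine i j) (combine i j′) (cong₂ _∧_
      (trans (cong₂ _≡ᵇ_ (quotient i j) (quotient i j′)) (≡ᵇ-refl (toℕ i)))
      (trans (cong₂ fanAdjℕ (remainder i j) (remainder i j′)) e))
    0<3 : 0 < 3
    0<3 = s≤s z≤n
    1<3 : 1 < 3
    1<3 = s≤s (s≤s z≤n)
    2<3 : 2 < 3
    2<3 = ≤-refl
    p₀ p₁ p₂ : Fin m
    p₀ = position 0 0<3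
    p₁ = position 1 1<3
    p₂ = position 2 2<3
    apex : ∀ i → Σ (Fin m) λ j → s + s ≤ toℕ (f (combine i j)) × toℕ (f (combine i j)) < s + s + t′
    apex i with third-class (f (combine i p₀)) (f (combine i p₁)) (f (combine i p₂))
      (edge i p₀ p₁ (cong₂ fanAdjℕ (toℕ-position 0 0<3) (toℕ-position 1 1<3)))
      (edge i p₀ p₂ (cong₂ fanAdjℕ (toℕ-position 0 0<3) (toℕ-position 2 2<3)))
      (edge i p₁ p₂ (cong₂ fanAdjℕ (toℕ-position 1 1<3) (toℕ-position 2 2<3)))
    ... | inj₁ r = p₀ , r
    ... | inj₂ (inj₁ r) = p₁ , r
    ... | inj₂ (inj₂ r) = p₂ , r

-- The two bounds combined

arrows : ∀ {k t′ n N ℓ} (G : Graph n) → Bounds k (suc t′) n ℓ → Connected G → degSum G ≤ 2 * n + 2 * ℓ →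
  N + 1 ≡ 2 * n + t′ → Arrows N G (tFan (suc t′) k)
arrows {k} {t′} {n} {N} {ℓ} G bounds conn sparse N≡ c c-sym
  with containsCopy? c true G | containsCopy? c false (tFan (suc t′) k)
... | yes red | _ = inj₁ red
... | no _ | yes blue = inj₂ blue
... | no noRed | no noBlue = ⊥-elim (Upper.impossible c c-sym k t′ n G ℓ bounds conn sparse N≡ noRed
        (noBlue ∘ FanCopy.fans⇒copy c c-sym k))

¬arrows : ∀ {k t′ n N} (G : Graph n) → 1 ≤ k → suc t′ ≤ n → Connected G → N + 1 ≡ 2 * n + t′ →
  ∀ M → M < N → ¬ Arrows M G (tFan (suc t′) k)
¬arrows {k} {t′} {suc s} {N} G 1≤k (s≤s t′≤s) conn N≡ M M<N arr = [ no-red conn , no-blue k 1≤k ]′ (arr colouring colouring-sym)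
  where
  arith : ∀ M s t N → M + (N + (2 * suc s + t)) + 0 ≡ s + s + t + (suc M + (N + 1))
  arith = solve-∀
  open Lower {M} s t′ t′≤s (linear 0 (+-mono-≤ M<N (≤-reflexive N≡)) (arith M s t′ N))

theorem1p7 : (k t n : ℕ) → 1 ≤ k → 1 ≤ t → 161 * t ^ 2 * k ^ 4 ≤ n →
    (G : Graph n) → Connected G →
    edgeCount G * (204 * t * k ^ 3 + 147 * t * k ^ 2)
      ≤ n * (204 * t * k ^ 3 + 147 * t * k ^ 2 + 1) →
    RamseyNumberIs G (tFan t k) (2 * n + t ∸ 2)
theorem1p7 k (suc t′) n 1≤k 1≤t n-large G conn e-small =
  ≤-pred (≤-trans 2≤2n+t′ (≤-reflexive (trans (≡-sym N≡) (+-comm N 1)))) ,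
  arrows G bounds conn sparse N≡ , λ M _ → ¬arrows G 1≤k t≤n conn N≡ M
  where
  D ℓ N : ℕ
  D = 204 * suc t′ * k ^ 3 + 147 * suc t′ * k ^ 2
  -- For a tree the difference would be -1 and is cut off at 0; only upper bounds on the number of
  -- edges in terms of ℓ are drawn from it.
  ℓ = edgeCount G ∸ n
  N = 2 * n + suc t′ ∸ 2
  sparse : degSum G ≤ 2 * n + 2 * ℓ
  sparse = ≤-trans (degSum≤2edges G) (≤-trans (*-monoʳ-≤ 2 (m≤n+m∸n (edgeCount G) n)) (≤-reflexive (*-distribˡ-+ 2 n ℓ)))
  bounds : Bounds k (suc t′) n ℓ
  bounds = record
    { 1≤k = 1≤k ; 1≤t = 1≤t ; n-large = n-large
    -- With e edges, the hypothesis reads eD ≤ nD + n, whence (e - n)D ≤ n.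
    ; ℓ-small = ≤-trans (≤-reflexive (*-distribʳ-∸ D (edgeCount G) n)) (m≤n+o⇒m∸n≤o (edgeCount G * D) (n * D)
        (≤-trans e-small (≤-reflexive (trans (*-distribˡ-+ n D 1) (cong (n * D +_) (*-identityʳ n))))))
    }
  open Numbers bounds using (t≤n; 2≤n)
  2≤2n+t′ : 2 ≤ 2 * n + t′
  2≤2n+t′ = ≤-trans 2≤n (≤-trans (m≤m+n n (n + 0)) (m≤m+n (2 * n) t′))
  N≡ : N + 1 ≡ 2 * n + t′
  N≡ = suc-injective (trans (≡-sym (+-suc N 1)) (trans (m∸n+n≡m (≤-trans 2≤2n+t′ (+-monoʳ-≤ (2 * n) (n≤1+n t′))))
    (+-suc (2 * n) t′)))
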